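{- The topos $\widehat{\Box}$ of cubical sets classifies flat distributive lattices. That is, for every Grothendieck topos $\mathcal{X}$ there is an equivalence, natural in $\mathcal{X}$, between the category of geometric morphisms $\mathcal{X}\to\widehat{\Box}$ and the category of flat distributive lattices in $\mathcal{X}$ (with lattice homomorphisms preserving $0,1$ as morphisms), the universal flat distributive lattice in $\widehat{\Box}$ being $\mathbb{I}$, $\mathbb{I}(n)=DL(n)$; the equivalence sends a geometric morphism $F$ to $F^*\mathbb{I}$.
   Context: All distributive lattices are bounded (with $0,1$), and homomorphisms preserve $0,1$. $DL(n)$ is the free distributive lattice on $n$ generators (a finite set); $DL$ is the corresponding monad on finite sets. A Kleisli map $n\to DL(m)$ is the same as a lattice homomorphism $DL(n)\to DL(m)$. $\Box$ is the full subcategory of $\mathrm{Cat}$ on the finite powers $\mathbb{2}^n$ of the two-element poset $\mathbb{2}$. By duality it is the opposite of the category of free finitely generated distributive lattices (the Lawvere theory of distributive lattices), so its objects can be taken to be the natural numbers $n$, with $\hom_\Box(m,n)$ the set of Kleisli maps $n\to DL(m)$. $\widehat{\Box}$ is the category of presheaves $\Box^{\mathrm{op}}\to\mathrm{Set}$, whose objects are called cubical sets. The functor $n\mapsto DL(n)$ is a distributive lattice $\mathbb{I}$ in $\widehat{\Box}$. For a distributive lattice $D$ and a Kleisli map $\alpha:n\to DL(m)$ (an $n$-tuple of lattice polynomials in $m$ variables), $d\mapsto\alpha d$ denotes the evaluation map $D^m\to D^n$. For $\alpha:n\to DL(m)$ and $\gamma:m\to DL(k)$, $\alpha\gamma:n\to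 DL(k)$ denotes the composite (substitute $\gamma$ in $\alpha$), so that $(\alpha\gamma)d'=\alpha(\gamma d')$. $D$ is flat if for all $n,m\in\mathbb{N}$, all $\alpha,\beta:n\to DL(m)$ and all $d\in D^m$ with $\alpha d=\beta d$, there exist $k\in\mathbb{N}$, $\gamma:m\to DL(k)$ and $d'\in D^k$ such that $\alpha\gamma=\beta\gamma$ and $\gamma d'=d$. (Equivalently, $D$ is a filtered colimit of free finitely generated distributive lattices.) In a Grothendieck topos this condition is interpreted in the internal logic; it is a geometric condition. -}

module Defs where

open import Level using (Level; _⊔_; 0ℓ) renaming (suc to lsuc)
open import Algebra.Core using (Op₂)
open import Algebra.Definitions using (Identity)
open import Algebra.Lattice.Structures using (IsDistributiveLattice)
open import Data.Empty using (⊥)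
open import Data.Fin.Base using (Fin; zero; suc)
open import Data.Nat.Base using (ℕ)
open import Data.Product.Base using (Σ; Σ-syntax; _,_; proj₁; proj₂; _×_)
open import Data.Product.Relation.Binary.Pointwise.NonDependent using (×-setoid)
open import Data.Unit.Base using (tt) renaming (⊤ to 𝟙)
open import Function.Bundles using (Func)
open import Relation.Binary.Bundles using (Setoid)
open import Relation.Binary.Structures using (IsEquivalence)
import Relation.Binary.Reasoning.Setoid as SetoidReasoning

open Func using (to; cong)

record RawBoundedLattice (c ℓ : Level) : Set (lsuc (c ⊔ ℓ)) where
  infix  4 _≈_
  infixr 6 _∨_
  infixr 7 _∧_
  field
    Carrier : Set c
    _≈_     : Carrier → Carrier → Set ℓ
    _∨_     : Op₂ Carrier
    _∧_     : Op₂ Carrier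
    ⊤ᴸ      : Carrier
    ⊥ᴸ      : Carrier

record IsBoundedDistributiveLattice {c ℓ} (L : RawBoundedLattice c ℓ) : Set (c ⊔ ℓ) where
  open RawBoundedLattice L
  field
    isDistributiveLattice : IsDistributiveLattice _≈_ _∨_ _∧_
    ∨-identity            : Identity _≈_ ⊥ᴸ _∨_
    ∧-identity            : Identity _≈_ ⊤ᴸ _∧_

  open IsDistributiveLattice isDistributiveLattice public

-- DL(n) is Term n modulo _≋_, the equational theory of bounded distributive
-- lattices.

infixr 6 _∨ᵗ_
infixr 7 _∧ᵗ_

data Term (n : ℕ) : Set where
  var       : Fin n → Term n
  ⊤ᵗ ⊥ᵗ     : Term n
  _∨ᵗ_ _∧ᵗ_ : Term n → Term n → Term n

infix 4 _≋_

data _≋_ {n : ℕ} : Term n → Term n → Set where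
  ≋-refl      : ∀ {s} → s ≋ s
  ≋-sym       : ∀ {s t} → s ≋ t → t ≋ s
  ≋-trans     : ∀ {s t u} → s ≋ t → t ≋ u → s ≋ u
  ∨-cong      : ∀ {s s′ t t′} → s ≋ s′ → t ≋ t′ → s ∨ᵗ t ≋ s′ ∨ᵗ t′
  ∧-cong      : ∀ {s s′ t t′} → s ≋ s′ → t ≋ t′ → s ∧ᵗ t ≋ s′ ∧ᵗ t′
  ∨-comm      : ∀ s t → s ∨ᵗ t ≋ t ∨ᵗ s
  ∧-comm      : ∀ s t → s ∧ᵗ t ≋ t ∧ᵗ s
  ∨-assoc     : ∀ s t u → (s ∨ᵗ t) ∨ᵗ u ≋ s ∨ᵗ (t ∨ᵗ u)
  ∧-assoc     : ∀ s t u → (s ∧ᵗ t) ∧ᵗ u ≋ s ∧ᵗ (t ∧ᵗ u)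
  ∨-absorbs-∧ : ∀ s t → s ∨ᵗ (s ∧ᵗ t) ≋ s
  ∧-absorbs-∨ : ∀ s t → s ∧ᵗ (s ∨ᵗ t) ≋ s
  ∨-distrib-∧ : ∀ s t u → s ∨ᵗ (t ∧ᵗ u) ≋ (s ∨ᵗ t) ∧ᵗ (s ∨ᵗ u)
  ∧-distrib-∨ : ∀ s t u → s ∧ᵗ (t ∨ᵗ u) ≋ (s ∧ᵗ t) ∨ᵗ (s ∧ᵗ u)
  ∨-identity  : ∀ s → ⊥ᵗ ∨ᵗ s ≋ s
  ∧-identity  : ∀ s → ⊤ᵗ ∧ᵗ s ≋ s

eval : ∀ {c ℓ n} (L : RawBoundedLattice c ℓ) → let open RawBoundedLattice L in
       Term n → (Fin n → Carrier) → Carrier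
eval L (var i)  ρ = ρ i
eval L ⊤ᵗ       ρ = RawBoundedLattice.⊤ᴸ L
eval L ⊥ᵗ       ρ = RawBoundedLattice.⊥ᴸ L
eval L (s ∨ᵗ t) ρ = RawBoundedLattice._∨_ L (eval L s ρ) (eval L t ρ)
eval L (s ∧ᵗ t) ρ = RawBoundedLattice._∧_ L (eval L s ρ) (eval L t ρ)

module _ {c ℓ} (L : RawBoundedLattice c ℓ) (isBDL : IsBoundedDistributiveLattice L) where
  open RawBoundedLattice L
  private module D = IsBoundedDistributiveLattice isBDL

  eval-sound : ∀ {n} {s t : Term n} → s ≋ t → ∀ ρ → eval L s ρ ≈ eval L t ρ
  eval-sound ≋-refl              ρ = D.refl
  eval-sound (≋-sym p)           ρ = D.sym (eval-sound p ρ)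
  eval-sound (≋-trans p q)       ρ = D.trans (eval-sound p ρ) (eval-sound q ρ)
  eval-sound (∨-cong p q)        ρ = D.∨-cong (eval-sound p ρ) (eval-sound q ρ)
  eval-sound (∧-cong p q)        ρ = D.∧-cong (eval-sound p ρ) (eval-sound q ρ)
  eval-sound (∨-comm s t)        ρ = D.∨-comm _ _
  eval-sound (∧-comm s t)        ρ = D.∧-comm _ _
  eval-sound (∨-assoc s t u)     ρ = D.∨-assoc _ _ _
  eval-sound (∧-assoc s t u)     ρ = D.∧-assoc _ _ _
  eval-sound (∨-absorbs-∧ s t)   ρ = D.∨-absorbs-∧ _ _
  eval-sound (∧-absorbs-∨ s t)   ρ = D.∧-absorbs-∨ _ _
  eval-sound (∨-distrib-∧ s t u) ρ = D.∨-distribˡ-∧ _ _ _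
  eval-sound (∧-distrib-∨ s t u) ρ = D.∧-distribˡ-∨ _ _ _
  eval-sound (∨-identity s)      ρ = proj₁ D.∨-identity _
  eval-sound (∧-identity s)      ρ = proj₁ D.∧-identity _

  eval-cong : ∀ {n} (t : Term n) {ρ σ : Fin n → Carrier} →
              (∀ i → ρ i ≈ σ i) → eval L t ρ ≈ eval L t σ
  eval-cong (var i)  p = p i
  eval-cong ⊤ᵗ       p = D.refl
  eval-cong ⊥ᵗ       p = D.refl
  eval-cong (s ∨ᵗ t) p = D.∨-cong (eval-cong s p) (eval-cong t p)
  eval-cong (s ∧ᵗ t) p = D.∧-cong (eval-cong s p) (eval-cong t p)

-- A raw lattice is a bounded distributive lattice as soon as it validates
-- every provable equation in three variables.
module _ {c ℓ} (L : RawBoundedLattice c ℓ) where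
  open RawBoundedLattice L

  isBDL-fromEquations :
    IsEquivalence _≈_ →
    (∀ {x x′ y y′} → x ≈ x′ → y ≈ y′ → (x ∨ y) ≈ (x′ ∨ y′)) →
    (∀ {x x′ y y′} → x ≈ x′ → y ≈ y′ → (x ∧ y) ≈ (x′ ∧ y′)) →
    (∀ {s t : Term 3} → s ≋ t → ∀ ρ → eval L s ρ ≈ eval L t ρ) →
    IsBoundedDistributiveLattice L
  isBDL-fromEquations equiv ∨-c ∧-c eqn = record
    { isDistributiveLattice = record
      { isLattice = record
        { isEquivalence = equiv
        ; ∨-comm        = λ x y → eqn (∨-comm v₀ v₁) ⟦ x , y , y ⟧
        ; ∨-assoc       = λ x y z → eqn (∨-assoc v₀ v₁ v₂) ⟦ x , y , z ⟧
        ; ∨-cong        = ∨-c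
        ; ∧-comm        = λ x y → eqn (∧-comm v₀ v₁) ⟦ x , y , y ⟧
        ; ∧-assoc       = λ x y z → eqn (∧-assoc v₀ v₁ v₂) ⟦ x , y , z ⟧
        ; ∧-cong        = ∧-c
        ; absorptive    = (λ x y → eqn (∨-absorbs-∧ v₀ v₁) ⟦ x , y , y ⟧)
                        , (λ x y → eqn (∧-absorbs-∨ v₀ v₁) ⟦ x , y , y ⟧)
        }
      ; ∨-distrib-∧ = (λ x y z → eqn (∨-distrib-∧ v₀ v₁ v₂) ⟦ x , y , z ⟧)
                    , (λ x y z → eqn ∨-distribʳ ⟦ x , y , z ⟧)
      ; ∧-distrib-∨ = (λ x y z → eqn (∧-distrib-∨ v₀ v₁ v₂) ⟦ x , y , z ⟧)
                    , (λ x y z → eqn ∧-distribʳ ⟦ x , y , z ⟧)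
      }
    ; ∨-identity = (λ x → eqn (∨-identity v₀) ⟦ x , x , x ⟧)
                 , (λ x → eqn (≋-trans (∨-comm v₀ ⊥ᵗ) (∨-identity v₀)) ⟦ x , x , x ⟧)
    ; ∧-identity = (λ x → eqn (∧-identity v₀) ⟦ x , x , x ⟧)
                 , (λ x → eqn (≋-trans (∧-comm v₀ ⊤ᵗ) (∧-identity v₀)) ⟦ x , x , x ⟧)
    }
    where
    v₀ v₁ v₂ : Term 3
    v₀ = var zero
    v₁ = var (suc zero)
    v₂ = var (suc (suc zero))

    ⟦_⟧ : Carrier × Carrier × Carrier → Fin 3 → Carrier
    ⟦ x , y , z ⟧ zero             = x
    ⟦ x , y , z ⟧ (suc zero)       = y
    ⟦ x , y , z ⟧ (suc (suc zero)) = z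

    ∨-distribʳ : (v₁ ∧ᵗ v₂) ∨ᵗ v₀ ≋ (v₁ ∨ᵗ v₀) ∧ᵗ (v₂ ∨ᵗ v₀)
    ∨-distribʳ = ≋-trans (∨-comm _ _)
      (≋-trans (∨-distrib-∧ _ _ _) (∧-cong (∨-comm _ _) (∨-comm _ _)))

    ∧-distribʳ : (v₁ ∨ᵗ v₂) ∧ᵗ v₀ ≋ (v₁ ∧ᵗ v₀) ∨ᵗ (v₂ ∧ᵗ v₀)
    ∧-distribʳ = ≋-trans (∧-comm _ _)
      (≋-trans (∧-distrib-∨ _ _ _) (∨-cong (∧-comm _ _) (∧-comm _ _)))

termLattice : ℕ → RawBoundedLattice 0ℓ 0ℓ
termLattice n = record
  { Carrier = Term n ; _≈_ = _≋_ ; _∨_ = _∨ᵗ_ ; _∧_ = _∧ᵗ_ ; ⊤ᴸ = ⊤ᵗ ; ⊥ᴸ = ⊥ᵗ }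

infixl 8 _[_]

_[_] : ∀ {n m} → Term n → (Fin n → Term m) → Term m
t [ γ ] = eval (termLattice _) t γ

≋-isEquivalence : ∀ {n} → IsEquivalence (_≋_ {n})
≋-isEquivalence = record { refl = ≋-refl ; sym = ≋-sym ; trans = ≋-trans }

[]-≋ : ∀ {n m} {s t : Term n} → s ≋ t → (γ : Fin n → Term m) → s [ γ ] ≋ t [ γ ]
[]-≋ ≋-refl              γ = ≋-refl
[]-≋ (≋-sym p)           γ = ≋-sym ([]-≋ p γ)
[]-≋ (≋-trans p q)       γ = ≋-trans ([]-≋ p γ) ([]-≋ q γ)
[]-≋ (∨-cong p q)        γ = ∨-cong ([]-≋ p γ) ([]-≋ q γ)
[]-≋ (∧-cong p q)        γ = ∧-cong ([]-≋ p γ) ([]-≋ q γ)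
[]-≋ (∨-comm s t)        γ = ∨-comm _ _
[]-≋ (∧-comm s t)        γ = ∧-comm _ _
[]-≋ (∨-assoc s t u)     γ = ∨-assoc _ _ _
[]-≋ (∧-assoc s t u)     γ = ∧-assoc _ _ _
[]-≋ (∨-absorbs-∧ s t)   γ = ∨-absorbs-∧ _ _
[]-≋ (∧-absorbs-∨ s t)   γ = ∧-absorbs-∨ _ _
[]-≋ (∨-distrib-∧ s t u) γ = ∨-distrib-∧ _ _ _
[]-≋ (∧-distrib-∨ s t u) γ = ∧-distrib-∨ _ _ _
[]-≋ (∨-identity s)      γ = ∨-identity _
[]-≋ (∧-identity s)      γ = ∧-identity _

DL : ∀ n → IsBoundedDistributiveLattice (termLattice n)
DL n = isBDL-fromEquations (termLattice n) ≋-isEquivalence ∨-cong ∧-cong []-≋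

[]-var : ∀ {n} (t : Term n) → t [ var ] ≋ t
[]-var (var i)  = ≋-refl
[]-var ⊤ᵗ       = ≋-refl
[]-var ⊥ᵗ       = ≋-refl
[]-var (s ∨ᵗ t) = ∨-cong ([]-var s) ([]-var t)
[]-var (s ∧ᵗ t) = ∧-cong ([]-var s) ([]-var t)

[]-[] : ∀ {n m k} (t : Term n) (γ : Fin n → Term m) (δ : Fin m → Term k) →
        t [ γ ] [ δ ] ≋ t [ (λ i → γ i [ δ ]) ]
[]-[] (var i)  γ δ = ≋-refl
[]-[] ⊤ᵗ       γ δ = ≋-refl
[]-[] ⊥ᵗ       γ δ = ≋-refl
[]-[] (s ∨ᵗ t) γ δ = ∨-cong ([]-[] s γ δ) ([]-[] t γ δ)
[]-[] (s ∧ᵗ t) γ δ = ∧-cong ([]-[] s γ δ) ([]-[] t γ δ)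

-- Maps n → DL(m), represented by tuples of polynomials and compared by _≋ᴷ_;
-- α ⨟ γ substitutes γ in α.
Kleisli : ℕ → ℕ → Set
Kleisli n m = Fin n → Term m

_≋ᴷ_ : ∀ {n m} → Kleisli n m → Kleisli n m → Set
α ≋ᴷ β = ∀ i → α i ≋ β i

_⨟_ : ∀ {n m k} → Kleisli n m → Kleisli m k → Kleisli n k
(α ⨟ γ) i = α i [ γ ]

record Category (o ℓ e : Level) : Set (lsuc (o ⊔ ℓ ⊔ e)) where
  infix  4 _⇒_ _≈_
  infixr 9 _∘_
  field
    Obj       : Set o
    _⇒_       : Obj → Obj → Set ℓ
    _≈_       : ∀ {A B} → A ⇒ B → A ⇒ B → Set e
    id        : ∀ {A} → A ⇒ A
    _∘_       : ∀ {A B C} → B ⇒ C → A ⇒ B → A ⇒ C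
    assoc     : ∀ {A B C D} {f : A ⇒ B} {g : B ⇒ C} {h : C ⇒ D} → (h ∘ g) ∘ f ≈ h ∘ (g ∘ f)
    identityˡ : ∀ {A B} {f : A ⇒ B} → id ∘ f ≈ f
    identityʳ : ∀ {A B} {f : A ⇒ B} → f ∘ id ≈ f
    equiv     : ∀ {A B} → IsEquivalence (_≈_ {A} {B})
    ∘-resp-≈  : ∀ {A B C} {f h : B ⇒ C} {g i : A ⇒ B} → f ≈ h → g ≈ i → f ∘ g ≈ h ∘ i

  module Equiv {A B : Obj} = IsEquivalence (equiv {A} {B})

  hom-setoid : Obj → Obj → Setoid ℓ e
  hom-setoid A B = record { isEquivalence = equiv {A} {B} }

  module HomReasoning {A B : Obj} = SetoidReasoning (hom-setoid A B)

  ∘-resp-≈ˡ : ∀ {A B C} {f h : B ⇒ C} {g : A ⇒ B} → f ≈ h → f ∘ g ≈ h ∘ g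
  ∘-resp-≈ˡ p = ∘-resp-≈ p Equiv.refl

  ∘-resp-≈ʳ : ∀ {A B C} {f : B ⇒ C} {g i : A ⇒ B} → g ≈ i → f ∘ g ≈ f ∘ i
  ∘-resp-≈ʳ p = ∘-resp-≈ Equiv.refl p

op : ∀ {o ℓ e} → Category o ℓ e → Category o ℓ e
op C = record
  { Obj       = Obj
  ; _⇒_       = λ A B → B ⇒ A
  ; _≈_       = _≈_
  ; id        = id
  ; _∘_       = λ f g → g ∘ f
  ; assoc     = Equiv.sym assoc
  ; identityˡ = identityʳ
  ; identityʳ = identityˡ
  ; equiv     = equiv
  ; ∘-resp-≈  = λ p q → ∘-resp-≈ q p
  } where open Category C

record Functor {o ℓ e o′ ℓ′ e′} (C : Category o ℓ e) (D : Category o′ ℓ′ e′) :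
               Set (o ⊔ ℓ ⊔ e ⊔ o′ ⊔ ℓ′ ⊔ e′) where
  private
    module C = Category C
    module D = Category D
  field
    F₀           : C.Obj → D.Obj
    F₁           : ∀ {A B} → A C.⇒ B → F₀ A D.⇒ F₀ B
    identity     : ∀ {A} → F₁ (C.id {A}) D.≈ D.id
    homomorphism : ∀ {A B E} {f : A C.⇒ B} {g : B C.⇒ E} → F₁ (g C.∘ f) D.≈ F₁ g D.∘ F₁ f
    F-resp-≈     : ∀ {A B} {f g : A C.⇒ B} → f C.≈ g → F₁ f D.≈ F₁ g

idF : ∀ {o ℓ e} {C : Category o ℓ e} → Functor C C
idF {C = C} = record
  { F₀ = λ A → A ; F₁ = λ f → f ; identity = Equiv.refl
  ; homomorphism = Equiv.refl ; F-resp-≈ = λ p → p } where open Category C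

infixr 9 _∘F_

_∘F_ : ∀ {o ℓ e o′ ℓ′ e′ o″ ℓ″ e″}
         {C : Category o ℓ e} {D : Category o′ ℓ′ e′} {E : Category o″ ℓ″ e″} →
       Functor D E → Functor C D → Functor C E
_∘F_ {E = E} G F = record
  { F₀           = λ A → G.F₀ (F.F₀ A)
  ; F₁           = λ f → G.F₁ (F.F₁ f)
  ; identity     = Equiv.trans (G.F-resp-≈ F.identity) G.identity
  ; homomorphism = Equiv.trans (G.F-resp-≈ F.homomorphism) G.homomorphism
  ; F-resp-≈     = λ p → G.F-resp-≈ (F.F-resp-≈ p)
  } where
    open Category E
    module F = Functor F
    module G = Functor G

record NaturalTransformation {o ℓ e o′ ℓ′ e′} {C : Category o ℓ e} {D : Category o′ ℓ′ e′}
                             (F G : Functor C D) : Set (o ⊔ ℓ ⊔ ℓ′ ⊔ e′) where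
  private
    module C = Category C
    module F = Functor F
    module G = Functor G
  open Category D
  field
    η       : ∀ A → F.F₀ A ⇒ G.F₀ A
    commute : ∀ {A B} (f : A C.⇒ B) → η B ∘ F.F₁ f ≈ G.F₁ f ∘ η A

record NaturalIsomorphism {o ℓ e o′ ℓ′ e′} {C : Category o ℓ e} {D : Category o′ ℓ′ e′}
                          (F G : Functor C D) : Set (o ⊔ ℓ ⊔ ℓ′ ⊔ e′) where
  open Category D
  field
    F⇒G : NaturalTransformation F G
    F⇐G : NaturalTransformation G F

  module ⇒ = NaturalTransformation F⇒G
  module ⇐ = NaturalTransformation F⇐G

  field
    isoˡ : ∀ A → ⇐.η A ∘ ⇒.η A ≈ id
    isoʳ : ∀ A → ⇒.η A ∘ ⇐.η A ≈ id

record IsEquivalenceOfCategories {o ℓ e o′ ℓ′ e′} {C : Category o ℓ e} {D : Category o′ ℓ′ e′}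
                                 (F : Functor C D) : Set (o ⊔ ℓ ⊔ e ⊔ o′ ⊔ ℓ′ ⊔ e′) where
  field
    inverse : Functor D C
    unit    : NaturalIsomorphism idF (inverse ∘F F)
    counit  : NaturalIsomorphism (F ∘F inverse) idF

record Equivalence {o ℓ e o′ ℓ′ e′} (C : Category o ℓ e) (D : Category o′ ℓ′ e′) :
                   Set (o ⊔ ℓ ⊔ e ⊔ o′ ⊔ ℓ′ ⊔ e′) where
  field
    functor       : Functor C D
    isEquivalence : IsEquivalenceOfCategories functor

functorCategory : ∀ {o ℓ e o′ ℓ′ e′} → Category o ℓ e → Category o′ ℓ′ e′ →
                  Category (o ⊔ ℓ ⊔ e ⊔ o′ ⊔ ℓ′ ⊔ e′) (o ⊔ ℓ ⊔ ℓ′ ⊔ e′) (o ⊔ e′)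
functorCategory C D = record
  { Obj       = Functor C D
  ; _⇒_       = NaturalTransformation
  ; _≈_       = λ α β → ∀ A → η α A ≈ η β A
  ; id        = record { η = λ A → id ; commute = λ f → Equiv.trans identityˡ (Equiv.sym identityʳ) }
  ; _∘_       = λ α β → record
      { η       = λ A → η α A ∘ η β A
      ; commute = λ f → Equiv.trans assoc (Equiv.trans (∘-resp-≈ʳ (commute β f))
                    (Equiv.trans (Equiv.sym assoc) (Equiv.trans (∘-resp-≈ˡ (commute α f)) assoc)))
      }
  ; assoc     = λ A → assoc
  ; identityˡ = λ A → identityˡ
  ; identityʳ = λ A → identityʳ
  ; equiv     = record
      { refl  = λ A → Equiv.refl
      ; sym   = λ p A → Equiv.sym (p A)
      ; trans = λ p q A → Equiv.trans (p A) (q A)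
      }
  ; ∘-resp-≈  = λ p q A → ∘-resp-≈ (p A) (q A)
  } where
    open Category D
    open NaturalTransformation

fullSubcategory : ∀ {o ℓ e p} (C : Category o ℓ e) → (Category.Obj C → Set p) → Category (o ⊔ p) ℓ e
fullSubcategory C P = record
  { Obj       = Σ Obj P
  ; _⇒_       = λ A B → proj₁ A ⇒ proj₁ B
  ; _≈_       = _≈_
  ; id        = id
  ; _∘_       = _∘_
  ; assoc     = assoc
  ; identityˡ = identityˡ
  ; identityʳ = identityʳ
  ; equiv     = equiv
  ; ∘-resp-≈  = ∘-resp-≈
  } where open Category C

corestrict : ∀ {o ℓ e o′ ℓ′ e′ p} {C : Category o ℓ e} {D : Category o′ ℓ′ e′}
               {P : Category.Obj D → Set p} (F : Functor C D) → (∀ A → P (Functor.F₀ F A)) →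
             Functor C (fullSubcategory D P)
corestrict F h = record
  { F₀ = λ A → F₀ A , h A ; F₁ = F₁ ; identity = identity
  ; homomorphism = homomorphism ; F-resp-≈ = F-resp-≈ } where open Functor F

restrict : ∀ {o ℓ e o′ ℓ′ e′ p q} {C : Category o ℓ e} {D : Category o′ ℓ′ e′}
             {P : Category.Obj C → Set p} {Q : Category.Obj D → Set q}
             (F : Functor C D) → (∀ {A} → P A → Q (Functor.F₀ F A)) →
           Functor (fullSubcategory C P) (fullSubcategory D Q)
restrict F h = record
  { F₀ = λ A → F₀ (proj₁ A) , h (proj₂ A) ; F₁ = F₁ ; identity = identity
  ; homomorphism = homomorphism ; F-resp-≈ = F-resp-≈ } where open Functor F

module _ {o ℓ e} (C : Category o ℓ e) where
  open Category C

  record IsTerminal (T : Obj) : Set (o ⊔ ℓ ⊔ e) where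
    field
      !        : ∀ {A} → A ⇒ T
      !-unique : ∀ {A} (f : A ⇒ T) → ! ≈ f

  record IsProduct {A B P : Obj} (π₁ : P ⇒ A) (π₂ : P ⇒ B) : Set (o ⊔ ℓ ⊔ e) where
    field
      ⟨_,_⟩    : ∀ {U} → U ⇒ A → U ⇒ B → U ⇒ P
      project₁ : ∀ {U} {f : U ⇒ A} {g : U ⇒ B} → π₁ ∘ ⟨ f , g ⟩ ≈ f
      project₂ : ∀ {U} {f : U ⇒ A} {g : U ⇒ B} → π₂ ∘ ⟨ f , g ⟩ ≈ g
      unique   : ∀ {U} {f : U ⇒ A} {g : U ⇒ B} {h : U ⇒ P} →
                 π₁ ∘ h ≈ f → π₂ ∘ h ≈ g → ⟨ f , g ⟩ ≈ h

    ⟨⟩-cong : ∀ {U} {f f′ : U ⇒ A} {g g′ : U ⇒ B} → f ≈ f′ → g ≈ g′ → ⟨ f , g ⟩ ≈ ⟨ f′ , g′ ⟩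
    ⟨⟩-cong p q = unique (Equiv.trans project₁ (Equiv.sym p)) (Equiv.trans project₂ (Equiv.sym q))

    ⟨⟩-∘ : ∀ {U V} {f : U ⇒ A} {g : U ⇒ B} {h : V ⇒ U} → ⟨ f , g ⟩ ∘ h ≈ ⟨ f ∘ h , g ∘ h ⟩
    ⟨⟩-∘ = Equiv.sym (unique
      (Equiv.trans (Equiv.sym assoc) (∘-resp-≈ˡ project₁))
      (Equiv.trans (Equiv.sym assoc) (∘-resp-≈ˡ project₂)))

  record IsEqualizer {A B E : Obj} (m : E ⇒ A) (f g : A ⇒ B) : Set (o ⊔ ℓ ⊔ e) where
    field
      equality  : f ∘ m ≈ g ∘ m
      equalize  : ∀ {U} {h : U ⇒ A} → f ∘ h ≈ g ∘ h → U ⇒ E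
      universal : ∀ {U} {h : U ⇒ A} {p : f ∘ h ≈ g ∘ h} → m ∘ equalize p ≈ h
      unique    : ∀ {U} {h : U ⇒ A} {p : f ∘ h ≈ g ∘ h} {k : U ⇒ E} → m ∘ k ≈ h → equalize p ≈ k

  record FiniteProducts : Set (o ⊔ ℓ ⊔ e) where
    infixr 7 _⊗_
    field
      𝟏          : Obj
      isTerminal : IsTerminal 𝟏
      _⊗_        : Obj → Obj → Obj
      π₁         : ∀ {A B} → (A ⊗ B) ⇒ A
      π₂         : ∀ {A B} → (A ⊗ B) ⇒ B
      isProduct  : ∀ {A B} → IsProduct (π₁ {A} {B}) (π₂ {A} {B})

    open IsTerminal isTerminal public
    module Product {A B : Obj} = IsProduct (isProduct {A} {B})
    open Product public

  JointlyEpic : ∀ {i} {I : Set i} {V : I → Obj} {U : Obj} → (∀ i → V i ⇒ U) → Set (o ⊔ ℓ ⊔ e ⊔ i)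
  JointlyEpic p = ∀ {Z} (f g : _ ⇒ Z) → (∀ i → f ∘ p i ≈ g ∘ p i) → f ≈ g

record PreservesFiniteLimits {o ℓ e o′ ℓ′ e′} {C : Category o ℓ e} {D : Category o′ ℓ′ e′}
                             (F : Functor C D) : Set (o ⊔ ℓ ⊔ e ⊔ o′ ⊔ ℓ′ ⊔ e′) where
  private module C = Category C
  open Functor F
  field
    terminal  : ∀ {T} → IsTerminal C T → IsTerminal D (F₀ T)
    product   : ∀ {A B P} {π₁ : P C.⇒ A} {π₂ : P C.⇒ B} →
                IsProduct C π₁ π₂ → IsProduct D (F₁ π₁) (F₁ π₂)
    equalizer : ∀ {A B E} {m : E C.⇒ A} {f g : A C.⇒ B} →
                IsEqualizer C m f g → IsEqualizer D (F₁ m) (F₁ f) (F₁ g)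

record _⊣_ {o ℓ e o′ ℓ′ e′} {C : Category o ℓ e} {D : Category o′ ℓ′ e′}
           (L : Functor C D) (R : Functor D C) : Set (o ⊔ ℓ ⊔ e ⊔ o′ ⊔ ℓ′ ⊔ e′) where
  private
    module C = Category C
    module D = Category D
    module L = Functor L
    module R = Functor R
  field
    φ      : ∀ {A B} → L.F₀ A D.⇒ B → A C.⇒ R.F₀ B
    ψ      : ∀ {A B} → A C.⇒ R.F₀ B → L.F₀ A D.⇒ B
    φ-cong : ∀ {A B} {f g : L.F₀ A D.⇒ B} → f D.≈ g → φ f C.≈ φ g
    ψ-cong : ∀ {A B} {f g : A C.⇒ R.F₀ B} → f C.≈ g → ψ f D.≈ ψ g
    ψφ     : ∀ {A B} (f : L.F₀ A D.⇒ B) → ψ (φ f) D.≈ f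
    φψ     : ∀ {A B} (f : A C.⇒ R.F₀ B) → φ (ψ f) C.≈ f
    φ-nat  : ∀ {A A′ B B′} (h : A′ C.⇒ A) (f : L.F₀ A D.⇒ B) (k : B D.⇒ B′) →
             φ (k D.∘ (f D.∘ L.F₁ h)) C.≈ R.F₁ k C.∘ (φ f C.∘ h)

-- Setoids at level 0ℓ play the role of the category of (small) sets.

Setoids : Category (lsuc 0ℓ) 0ℓ 0ℓ
Setoids = record
  { Obj       = Setoid 0ℓ 0ℓ
  ; _⇒_       = Func
  ; _≈_       = λ {A} {B} f g → ∀ x → Setoid._≈_ B (to f x) (to g x)
  ; id        = record { to = λ x → x ; cong = λ p → p }
  ; _∘_       = λ g f → record { to = λ x → to g (to f x) ; cong = λ p → cong g (cong f p) }
  ; assoc     = λ {A} {B} {C} {D} x → Setoid.refl D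
  ; identityˡ = λ {A} {B} x → Setoid.refl B
  ; identityʳ = λ {A} {B} x → Setoid.refl B
  ; equiv     = λ {A} {B} → record
      { refl  = λ x → Setoid.refl B
      ; sym   = λ p x → Setoid.sym B (p x)
      ; trans = λ p q x → Setoid.trans B (p x) (q x)
      }
  ; ∘-resp-≈  = λ {A} {B} {C} {f} {h} {g} {i} p q x → Setoid.trans C (cong f (q x)) (p (to i x))
  }

Presheaves : Category 0ℓ 0ℓ 0ℓ → Category (lsuc 0ℓ) 0ℓ 0ℓ
Presheaves C = functorCategory (op C) Setoids

-- A small site is a small category with a coverage: covering families are
-- stable under pullback in the weak sense below, and no further closure
-- conditions (which do not affect the notion of sheaf) are imposed.
record Site : Set₁ where
  field
    category : Category 0ℓ 0ℓ 0ℓ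
  open Category category public
  field
    Cover  : Obj → Set
    Index  : ∀ {c} → Cover c → Set
    dom    : ∀ {c} (u : Cover c) → Index u → Obj
    arrow  : ∀ {c} (u : Cover c) (i : Index u) → dom u i ⇒ c
    stable : ∀ {c d} (u : Cover c) (g : d ⇒ c) →
             Σ[ v ∈ Cover d ] (∀ j → Σ[ i ∈ Index u ] Σ[ k ∈ dom v j ⇒ dom u i ]
               (g ∘ arrow v j ≈ arrow u i ∘ k))

module _ (S : Site) where
  private module S = Site S

  module _ (P : Functor (op S.category) Setoids) where
    private module P = Functor P

    Section : S.Obj → Set
    Section c = Setoid.Carrier (P.F₀ c)

    _≈ₛ_ : ∀ {c} → Section c → Section c → Set
    _≈ₛ_ {c} = Setoid._≈_ (P.F₀ c)

    _∣_ : ∀ {c d} → Section c → d S.⇒ c → Section d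
    x ∣ f = to (P.F₁ f) x

    Compatible : ∀ {c} (u : S.Cover c) → (∀ i → Section (S.dom u i)) → Set
    Compatible u s = ∀ i j {w} (a : w S.⇒ S.dom u i) (b : w S.⇒ S.dom u j) →
      S.arrow u i S.∘ a S.≈ S.arrow u j S.∘ b → (s i ∣ a) ≈ₛ (s j ∣ b)

    Amalgamates : ∀ {c} (u : S.Cover c) → (∀ i → Section (S.dom u i)) → Section c → Set
    Amalgamates u s x = ∀ i → (x ∣ S.arrow u i) ≈ₛ s i

    IsSheaf : Set
    IsSheaf = ∀ {c} (u : S.Cover c) (s : ∀ i → Section (S.dom u i)) → Compatible u s →
      Σ[ x ∈ Section c ] (Amalgamates u s x × (∀ y → Amalgamates u s y → x ≈ₛ y))

  Sheaves : Category (lsuc 0ℓ) 0ℓ 0ℓ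
  Sheaves = fullSubcategory (Presheaves S.category) IsSheaf

-- A category equivalent to the sheaves on a small site always has finite
-- products; carrying a choice of them is therefore no restriction.
record GrothendieckTopos : Set₂ where
  field
    category       : Category (lsuc 0ℓ) 0ℓ 0ℓ
    site           : Site
    sheaves        : Equivalence category (Sheaves site)
    finiteProducts : FiniteProducts category
  open Category category public
  open FiniteProducts finiteProducts public

record GeometricMorphism (X Y : GrothendieckTopos) : Set₁ where
  private
    module X = GrothendieckTopos X
    module Y = GrothendieckTopos Y
  field
    inverseImage : Functor Y.category X.category
    directImage  : Functor X.category Y.category
    adjoint      : inverseImage ⊣ directImage
    leftExact    : PreservesFiniteLimits inverseImage

-- 2-cells F ⇒ G are natural transformations F* ⇒ G*.
Geom : GrothendieckTopos → GrothendieckTopos → Category (lsuc 0ℓ) (lsuc 0ℓ) (lsuc 0ℓ)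
Geom X Y = record
  { Obj       = GeometricMorphism X Y
  ; _⇒_       = λ F G → NaturalTransformation (inverseImage F) (inverseImage G)
  ; _≈_       = NT._≈_
  ; id        = NT.id
  ; _∘_       = NT._∘_
  ; assoc     = λ {_} {_} {_} {_} {f} {g} {h} → NT.assoc {f = f} {g} {h}
  ; identityˡ = λ {_} {_} {f} → NT.identityˡ {f = f}
  ; identityʳ = λ {_} {_} {f} → NT.identityʳ {f = f}
  ; equiv     = NT.equiv
  ; ∘-resp-≈  = λ {_} {_} {_} {f} {h} {g} {i} → NT.∘-resp-≈ {f = f} {h} {g} {i}
  } where
    open GeometricMorphism
    module NT = Category (functorCategory (GrothendieckTopos.category Y) (GrothendieckTopos.category X))

⊣-∘ : ∀ {o ℓ e o′ ℓ′ e′ o″ ℓ″ e″}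
        {C : Category o ℓ e} {D : Category o′ ℓ′ e′} {E : Category o″ ℓ″ e″}
        {L : Functor C D} {R : Functor D C} {L′ : Functor D E} {R′ : Functor E D} →
      L ⊣ R → L′ ⊣ R′ → (L′ ∘F L) ⊣ (R ∘F R′)
⊣-∘ {C = C} {E = E} p q = record
  { φ      = λ f → p.φ (q.φ f)
  ; ψ      = λ f → q.ψ (p.ψ f)
  ; φ-cong = λ r → p.φ-cong (q.φ-cong r)
  ; ψ-cong = λ r → q.ψ-cong (p.ψ-cong r)
  ; ψφ     = λ f → E.Equiv.trans (q.ψ-cong (p.ψφ (q.φ f))) (q.ψφ f)
  ; φψ     = λ f → C.Equiv.trans (p.φ-cong (q.φψ (p.ψ f))) (p.φψ f)
  ; φ-nat  = λ h f k → C.Equiv.trans (p.φ-cong (q.φ-nat _ f k)) (p.φ-nat h (q.φ f) _)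
  } where
    module p = _⊣_ p
    module q = _⊣_ q
    module C = Category C
    module E = Category E

_∘ᵍ_ : ∀ {X Y Z} → GeometricMorphism Y Z → GeometricMorphism X Y → GeometricMorphism X Z
F ∘ᵍ G = record
  { inverseImage = G.inverseImage ∘F F.inverseImage
  ; directImage  = F.directImage ∘F G.directImage
  ; adjoint      = ⊣-∘ F.adjoint G.adjoint
  ; leftExact    = record
      { terminal  = λ t → G.terminal (F.terminal t)
      ; product   = λ t → G.product (F.product t)
      ; equalizer = λ t → G.equalizer (F.equalizer t)
      }
  } where
    module F where
      open GeometricMorphism F public
      open PreservesFiniteLimits leftExact public
    module G where
      open GeometricMorphism G public
      open PreservesFiniteLimits leftExact public

precompose : ∀ {X Y} (Z : GrothendieckTopos) → GeometricMorphism X Y → Functor (Geom Y Z) (Geom X Z)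
precompose {X} {Y} Z G = record
  { F₀           = λ F → F ∘ᵍ G
  ; F₁           = λ α → record
      { η       = λ A → G*.F₁ (NaturalTransformation.η α A)
      ; commute = λ f → Equiv.trans (Equiv.sym G*.homomorphism)
                    (Equiv.trans (G*.F-resp-≈ (NaturalTransformation.commute α f)) G*.homomorphism)
      }
  ; identity     = λ A → G*.identity
  ; homomorphism = λ A → G*.homomorphism
  ; F-resp-≈     = λ p A → G*.F-resp-≈ (p A)
  } where
    open Category (GrothendieckTopos.category X)
    module G* = Functor (GeometricMorphism.inverseImage G)

module _ (X : GrothendieckTopos) where
  open GrothendieckTopos X

  record LatticeSignature : Set₁ where
    field
      carrier   : Obj
      join meet : (carrier ⊗ carrier) ⇒ carrier
      top bot   : 𝟏 ⇒ carrier

    generalizedElements : Obj → RawBoundedLattice 0ℓ 0ℓ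
    generalizedElements U = record
      { Carrier = U ⇒ carrier
      ; _≈_     = _≈_
      ; _∨_     = λ x y → join ∘ ⟨ x , y ⟩
      ; _∧_     = λ x y → meet ∘ ⟨ x , y ⟩
      ; ⊤ᴸ      = top ∘ !
      ; ⊥ᴸ      = bot ∘ !
      }

  record InternalDL : Set₁ where
    field
      signature : LatticeSignature
    open LatticeSignature signature public
    field
      isBDL : ∀ U → IsBoundedDistributiveLattice (generalizedElements U)

    -- d ↦ α d on generalized elements: an m-tuple of maps U ⇒ D is a map U ⇒ Dᵐ.
    _·_ : ∀ {n m U} → Kleisli n m → (Fin m → U ⇒ carrier) → (Fin n → U ⇒ carrier)
    (α · d) i = eval (generalizedElements _) (α i) d

  -- Flatness in the internal logic, by the Kripke–Joyal clauses: the
  -- existential holds at stage U when it is witnessed along a small jointly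
  -- epic family of maps into U.
  Flat : InternalDL → Set₁
  Flat D =
    ∀ n m (α β : Kleisli n m) (U : Obj) (d : Fin m → U ⇒ carrier) →
    (∀ i → (α · d) i ≈ (β · d) i) →
    Σ[ I ∈ Set ] Σ[ V ∈ (I → Obj) ] Σ[ p ∈ (∀ i → V i ⇒ U) ]
      JointlyEpic category p ×
      (∀ i → Σ[ k ∈ ℕ ] Σ[ γ ∈ Kleisli m k ] Σ[ d′ ∈ (Fin k → V i ⇒ carrier) ]
        ((α ⨟ γ) ≋ᴷ (β ⨟ γ)) × (∀ j → (γ · d′) j ≈ d j ∘ p i))
    where open InternalDL D

  record LatticeHom (D E : InternalDL) : Set where
    private
      module D = InternalDL D
      module E = InternalDL E
    field
      hom           : D.carrier ⇒ E.carrier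
      preserve-join : hom ∘ D.join ≈ E.join ∘ ⟨ hom ∘ π₁ , hom ∘ π₂ ⟩
      preserve-meet : hom ∘ D.meet ≈ E.meet ∘ ⟨ hom ∘ π₁ , hom ∘ π₂ ⟩
      preserve-top  : hom ∘ D.top ≈ E.top
      preserve-bot  : hom ∘ D.bot ≈ E.bot

open LatticeHom using (hom)

module _ (X : GrothendieckTopos) where
  open GrothendieckTopos X
  open HomReasoning

  private
    binary-id : ∀ {A : Obj} (m : (A ⊗ A) ⇒ A) → id ∘ m ≈ m ∘ ⟨ id ∘ π₁ , id ∘ π₂ ⟩
    binary-id m = begin
      id ∘ m                       ≈⟨ identityˡ ⟩
      m                            ≈⟨ identityʳ ⟨
      m ∘ id                       ≈⟨ ∘-resp-≈ʳ (unique (Equiv.trans identityʳ (Equiv.sym identityˡ))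
                                                        (Equiv.trans identityʳ (Equiv.sym identityˡ))) ⟨
      m ∘ ⟨ id ∘ π₁ , id ∘ π₂ ⟩    ∎

    binary-∘ : ∀ {A B C : Obj} {m : (A ⊗ A) ⇒ A} {m′ : (B ⊗ B) ⇒ B} {m″ : (C ⊗ C) ⇒ C}
                 {f : A ⇒ B} {g : B ⇒ C} →
               f ∘ m ≈ m′ ∘ ⟨ f ∘ π₁ , f ∘ π₂ ⟩ → g ∘ m′ ≈ m″ ∘ ⟨ g ∘ π₁ , g ∘ π₂ ⟩ →
               (g ∘ f) ∘ m ≈ m″ ∘ ⟨ (g ∘ f) ∘ π₁ , (g ∘ f) ∘ π₂ ⟩
    binary-∘ {m = m} {m′} {m″} {f} {g} p q = begin
      (g ∘ f) ∘ m                                          ≈⟨ assoc ⟩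
      g ∘ (f ∘ m)                                          ≈⟨ ∘-resp-≈ʳ p ⟩
      g ∘ (m′ ∘ ⟨ f ∘ π₁ , f ∘ π₂ ⟩)                       ≈⟨ assoc ⟨
      (g ∘ m′) ∘ ⟨ f ∘ π₁ , f ∘ π₂ ⟩                       ≈⟨ ∘-resp-≈ˡ q ⟩
      (m″ ∘ ⟨ g ∘ π₁ , g ∘ π₂ ⟩) ∘ ⟨ f ∘ π₁ , f ∘ π₂ ⟩     ≈⟨ assoc ⟩
      m″ ∘ (⟨ g ∘ π₁ , g ∘ π₂ ⟩ ∘ ⟨ f ∘ π₁ , f ∘ π₂ ⟩)     ≈⟨ ∘-resp-≈ʳ ⟨⟩-∘ ⟩
      m″ ∘ ⟨ (g ∘ π₁) ∘ ⟨ f ∘ π₁ , f ∘ π₂ ⟩ , (g ∘ π₂) ∘ ⟨ f ∘ π₁ , f ∘ π₂ ⟩ ⟩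
        ≈⟨ ∘-resp-≈ʳ (⟨⟩-cong (Equiv.trans assoc (Equiv.trans (∘-resp-≈ʳ project₁) (Equiv.sym assoc)))
                              (Equiv.trans assoc (Equiv.trans (∘-resp-≈ʳ project₂) (Equiv.sym assoc)))) ⟩
      m″ ∘ ⟨ (g ∘ f) ∘ π₁ , (g ∘ f) ∘ π₂ ⟩                 ∎

  DLat : Category (lsuc 0ℓ) 0ℓ 0ℓ
  DLat = record
    { Obj       = InternalDL X
    ; _⇒_       = LatticeHom X
    ; _≈_       = λ f g → hom f ≈ hom g
    ; id        = record
        { hom           = id
        ; preserve-join = binary-id _
        ; preserve-meet = binary-id _
        ; preserve-top  = identityˡ
        ; preserve-bot  = identityˡ
        }
    ; _∘_       = λ g f → record
        { hom           = hom g ∘ hom f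
        ; preserve-join = binary-∘ (preserve-join f) (preserve-join g)
        ; preserve-meet = binary-∘ (preserve-meet f) (preserve-meet g)
        ; preserve-top  = Equiv.trans assoc (Equiv.trans (∘-resp-≈ʳ (preserve-top f)) (preserve-top g))
        ; preserve-bot  = Equiv.trans assoc (Equiv.trans (∘-resp-≈ʳ (preserve-bot f)) (preserve-bot g))
        }
    ; assoc     = assoc
    ; identityˡ = identityˡ
    ; identityʳ = identityʳ
    ; equiv     = record { refl = Equiv.refl ; sym = Equiv.sym ; trans = Equiv.trans }
    ; ∘-resp-≈  = ∘-resp-≈
    } where open LatticeHom

  FlatDLat : Category (lsuc 0ℓ) 0ℓ 0ℓ
  FlatDLat = fullSubcategory DLat (Flat X)

-- The inverse image G*D of a distributive lattice: its operations are
-- G*D × G*D ≅ G*(D × D) → G*D and 1 ≅ G*1 → G*D.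

module _ {X Y : GrothendieckTopos} (G : GeometricMorphism Y X) where
  private
    module X = GrothendieckTopos X
    module P {A B : X.Obj} = IsProduct
      (PreservesFiniteLimits.product (GeometricMorphism.leftExact G) (X.isProduct {A} {B}))
    module T = IsTerminal
      (PreservesFiniteLimits.terminal (GeometricMorphism.leftExact G) X.isTerminal)
  open GrothendieckTopos Y
  open Functor (GeometricMorphism.inverseImage G)
  open HomReasoning

  inverseImageSignature : LatticeSignature X → LatticeSignature Y
  inverseImageSignature D = record
    { carrier = F₀ D.carrier
    ; join    = F₁ D.join ∘ P.⟨ π₁ , π₂ ⟩
    ; meet    = F₁ D.meet ∘ P.⟨ π₁ , π₂ ⟩
    ; top     = F₁ D.top ∘ T.!
    ; bot     = F₁ D.bot ∘ T.!
    } where module D = LatticeSignature D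

  private
    pair-merge : ∀ {A B : X.Obj} {U} {x : U ⇒ F₀ A} {y : U ⇒ F₀ B} →
                 P.⟨ π₁ , π₂ ⟩ ∘ ⟨ x , y ⟩ ≈ P.⟨ x , y ⟩
    pair-merge = Equiv.trans P.⟨⟩-∘ (P.⟨⟩-cong project₁ project₂)

    op₂ : ∀ {A : X.Obj} (m : (A X.⊗ A) X.⇒ A) {V : X.Obj} {U} (h : U ⇒ F₀ V) (a b : V X.⇒ A) →
          (F₁ m ∘ P.⟨ π₁ , π₂ ⟩) ∘ ⟨ F₁ a ∘ h , F₁ b ∘ h ⟩ ≈ F₁ (m X.∘ X.⟨ a , b ⟩) ∘ h
    op₂ m h a b = begin
      (F₁ m ∘ P.⟨ π₁ , π₂ ⟩) ∘ ⟨ F₁ a ∘ h , F₁ b ∘ h ⟩  ≈⟨ assoc ⟩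
      F₁ m ∘ (P.⟨ π₁ , π₂ ⟩ ∘ ⟨ F₁ a ∘ h , F₁ b ∘ h ⟩)  ≈⟨ ∘-resp-≈ʳ pair-merge ⟩
      F₁ m ∘ P.⟨ F₁ a ∘ h , F₁ b ∘ h ⟩                  ≈⟨ ∘-resp-≈ʳ (P.unique (leg X.project₁) (leg X.project₂)) ⟩
      F₁ m ∘ (F₁ X.⟨ a , b ⟩ ∘ h)                       ≈⟨ assoc ⟨
      (F₁ m ∘ F₁ X.⟨ a , b ⟩) ∘ h                       ≈⟨ ∘-resp-≈ˡ homomorphism ⟨
      F₁ (m X.∘ X.⟨ a , b ⟩) ∘ h                        ∎
      where
      leg : ∀ {C E W} {p : C X.⇒ W} {q : E X.⇒ C} {c : E X.⇒ W} → p X.∘ q X.≈ c →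
            ∀ {h} → F₁ p ∘ (F₁ q ∘ h) ≈ F₁ c ∘ h
      leg r = Equiv.trans (Equiv.sym assoc)
        (∘-resp-≈ˡ (Equiv.trans (Equiv.sym homomorphism) (F-resp-≈ r)))

    op₀ : ∀ {A : X.Obj} (t : X.𝟏 X.⇒ A) {V : X.Obj} {U} (h : U ⇒ F₀ V) →
          (F₁ t ∘ T.!) ∘ ! ≈ F₁ (t X.∘ X.!) ∘ h
    op₀ t h = begin
      (F₁ t ∘ T.!) ∘ !       ≈⟨ assoc ⟩
      F₁ t ∘ (T.! ∘ !)       ≈⟨ ∘-resp-≈ʳ (Equiv.trans (Equiv.sym (T.!-unique _)) (T.!-unique _)) ⟩
      F₁ t ∘ (F₁ X.! ∘ h)    ≈⟨ assoc ⟨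
      (F₁ t ∘ F₁ X.!) ∘ h    ≈⟨ ∘-resp-≈ˡ homomorphism ⟨
      F₁ (t X.∘ X.!) ∘ h     ∎

  inverseImageDL : InternalDL X → InternalDL Y
  inverseImageDL D = record
    { signature = inverseImageSignature D.signature
    ; isBDL     = λ U → isBDL-fromEquations (G*D.generalizedElements U) equiv
                    (λ p q → ∘-resp-≈ʳ (⟨⟩-cong p q)) (λ p q → ∘-resp-≈ʳ (⟨⟩-cong p q))
                    (λ p ρ → transfer p ρ)
    } where
    module D = InternalDL D
    module G*D = LatticeSignature (inverseImageSignature D.signature)

    eval-F : ∀ {n V U} (h : U ⇒ F₀ V) (ρ : Fin n → U ⇒ F₀ D.carrier) (a : Fin n → V X.⇒ D.carrier) →
             (∀ i → ρ i ≈ F₁ (a i) ∘ h) → (t : Term n) →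
             eval (G*D.generalizedElements U) t ρ ≈ F₁ (eval (D.generalizedElements V) t a) ∘ h
    eval-F h ρ a p (var i)  = p i
    eval-F h ρ a p ⊤ᵗ       = op₀ D.top h
    eval-F h ρ a p ⊥ᵗ       = op₀ D.bot h
    eval-F h ρ a p (s ∨ᵗ t) = Equiv.trans
      (∘-resp-≈ʳ (⟨⟩-cong (eval-F h ρ a p s) (eval-F h ρ a p t))) (op₂ D.join h _ _)
    eval-F h ρ a p (s ∧ᵗ t) = Equiv.trans
      (∘-resp-≈ʳ (⟨⟩-cong (eval-F h ρ a p s) (eval-F h ρ a p t))) (op₂ D.meet h _ _)

    V₃ : X.Obj
    V₃ = D.carrier X.⊗ (D.carrier X.⊗ D.carrier)

    generic : Fin 3 → V₃ X.⇒ D.carrier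
    generic zero             = X.π₁
    generic (suc zero)       = X.π₁ X.∘ X.π₂
    generic (suc (suc zero)) = X.π₂ X.∘ X.π₂

    classify : ∀ {U} → (Fin 3 → U ⇒ F₀ D.carrier) → U ⇒ F₀ V₃
    classify ρ = P.⟨ ρ zero , P.⟨ ρ (suc zero) , ρ (suc (suc zero)) ⟩ ⟩

    classify-generic : ∀ {U} (ρ : Fin 3 → U ⇒ F₀ D.carrier) i → ρ i ≈ F₁ (generic i) ∘ classify ρ
    classify-generic ρ zero             = Equiv.sym P.project₁
    classify-generic ρ (suc zero)       = Equiv.sym (Equiv.trans (∘-resp-≈ˡ homomorphism)
      (Equiv.trans assoc (Equiv.trans (∘-resp-≈ʳ P.project₂) P.project₁)))
    classify-generic ρ (suc (suc zero)) = Equiv.sym (Equiv.trans (∘-resp-≈ˡ homomorphism)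
      (Equiv.trans assoc (Equiv.trans (∘-resp-≈ʳ P.project₂) P.project₂)))

    transfer : ∀ {U} {s t : Term 3} → s ≋ t → (ρ : Fin 3 → U ⇒ F₀ D.carrier) →
               eval (G*D.generalizedElements U) s ρ ≈ eval (G*D.generalizedElements U) t ρ
    transfer {U} {s} {t} p ρ = begin
      eval (G*D.generalizedElements U) s ρ
        ≈⟨ eval-F (classify ρ) ρ generic (classify-generic ρ) s ⟩
      F₁ (eval (D.generalizedElements V₃) s generic) ∘ classify ρ
        ≈⟨ ∘-resp-≈ˡ (F-resp-≈ (eval-sound _ (D.isBDL V₃) p generic)) ⟩
      F₁ (eval (D.generalizedElements V₃) t generic) ∘ classify ρ
        ≈⟨ eval-F (classify ρ) ρ generic (classify-generic ρ) t ⟨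
      eval (G*D.generalizedElements U) t ρ
        ∎

  inverseImageHom : ∀ {D E} → LatticeHom X D E → LatticeHom Y (inverseImageDL D) (inverseImageDL E)
  inverseImageHom {D} {E} f = record
    { hom           = F₁ f.hom
    ; preserve-join = binary f.preserve-join
    ; preserve-meet = binary f.preserve-meet
    ; preserve-top  = nullary f.preserve-top
    ; preserve-bot  = nullary f.preserve-bot
    } where
    module f = LatticeHom f

    binary : ∀ {A B : X.Obj} {m : (A X.⊗ A) X.⇒ A} {m′ : (B X.⊗ B) X.⇒ B} {k : A X.⇒ B} →
             k X.∘ m X.≈ m′ X.∘ X.⟨ k X.∘ X.π₁ , k X.∘ X.π₂ ⟩ →
             F₁ k ∘ (F₁ m ∘ P.⟨ π₁ , π₂ ⟩) ≈ (F₁ m′ ∘ P.⟨ π₁ , π₂ ⟩) ∘ ⟨ F₁ k ∘ π₁ , F₁ k ∘ π₂ ⟩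
    binary {m = m} {m′} {k} p = begin
      F₁ k ∘ (F₁ m ∘ P.⟨ π₁ , π₂ ⟩)
        ≈⟨ assoc ⟨
      (F₁ k ∘ F₁ m) ∘ P.⟨ π₁ , π₂ ⟩
        ≈⟨ ∘-resp-≈ˡ (Equiv.trans (Equiv.sym homomorphism) (F-resp-≈ p)) ⟩
      F₁ (m′ X.∘ X.⟨ k X.∘ X.π₁ , k X.∘ X.π₂ ⟩) ∘ P.⟨ π₁ , π₂ ⟩
        ≈⟨ op₂ m′ P.⟨ π₁ , π₂ ⟩ _ _ ⟨
      (F₁ m′ ∘ P.⟨ π₁ , π₂ ⟩) ∘ ⟨ F₁ (k X.∘ X.π₁) ∘ P.⟨ π₁ , π₂ ⟩ , F₁ (k X.∘ X.π₂) ∘ P.⟨ π₁ , π₂ ⟩ ⟩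
        ≈⟨ ∘-resp-≈ʳ (⟨⟩-cong
             (Equiv.trans (∘-resp-≈ˡ homomorphism) (Equiv.trans assoc (∘-resp-≈ʳ P.project₁)))
             (Equiv.trans (∘-resp-≈ˡ homomorphism) (Equiv.trans assoc (∘-resp-≈ʳ P.project₂)))) ⟩
      (F₁ m′ ∘ P.⟨ π₁ , π₂ ⟩) ∘ ⟨ F₁ k ∘ π₁ , F₁ k ∘ π₂ ⟩
        ∎

    nullary : ∀ {A B : X.Obj} {t : X.𝟏 X.⇒ A} {t′ : X.𝟏 X.⇒ B} {k : A X.⇒ B} →
              k X.∘ t X.≈ t′ → F₁ k ∘ (F₁ t ∘ T.!) ≈ F₁ t′ ∘ T.!
    nullary p = Equiv.trans (Equiv.sym assoc)
      (∘-resp-≈ˡ (Equiv.trans (Equiv.sym homomorphism) (F-resp-≈ p)))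

  inverseImageDLat : Functor (DLat X) (DLat Y)
  inverseImageDLat = record
    { F₀           = inverseImageDL
    ; F₁           = inverseImageHom
    ; identity     = identity
    ; homomorphism = homomorphism
    ; F-resp-≈     = F-resp-≈
    }

-- F ↦ F*D
module _ (E X : GrothendieckTopos) (D : InternalDL E) where
  private
    module E = GrothendieckTopos E
    module D = InternalDL D
  open GrothendieckTopos X
  open HomReasoning

  evaluateAt : Functor (Geom X E) (DLat X)
  evaluateAt = record
    { F₀           = λ F → inverseImageDL F D
    ; F₁           = λ {F} {G} α → record
        { hom           = NaturalTransformation.η α D.carrier
        ; preserve-join = binary F G α D.join
        ; preserve-meet = binary F G α D.meet
        ; preserve-top  = nullary F G α D.top
        ; preserve-bot  = nullary F G α D.bot
        }
    ; identity     = Equiv.refl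
    ; homomorphism = Equiv.refl
    ; F-resp-≈     = λ p → p D.carrier
    } where
    module _ (F G : GeometricMorphism X E)
             (α : NaturalTransformation (GeometricMorphism.inverseImage F)
                                        (GeometricMorphism.inverseImage G)) where
      module F = Functor (GeometricMorphism.inverseImage F)
      module G = Functor (GeometricMorphism.inverseImage G)
      open NaturalTransformation α
      module FP {A B : E.Obj} = IsProduct
        (PreservesFiniteLimits.product (GeometricMorphism.leftExact F) (E.isProduct {A} {B}))
      module GP {A B : E.Obj} = IsProduct
        (PreservesFiniteLimits.product (GeometricMorphism.leftExact G) (E.isProduct {A} {B}))
      module FT = IsTerminal
        (PreservesFiniteLimits.terminal (GeometricMorphism.leftExact F) E.isTerminal)
      module GT = IsTerminal
        (PreservesFiniteLimits.terminal (GeometricMorphism.leftExact G) E.isTerminal)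

      binary : ∀ {A : E.Obj} (m : (A E.⊗ A) E.⇒ A) →
               η A ∘ (F.F₁ m ∘ FP.⟨ π₁ , π₂ ⟩) ≈
               (G.F₁ m ∘ GP.⟨ π₁ , π₂ ⟩) ∘ ⟨ η A ∘ π₁ , η A ∘ π₂ ⟩
      binary {A} m = begin
        η A ∘ (F.F₁ m ∘ FP.⟨ π₁ , π₂ ⟩)                          ≈⟨ assoc ⟨
        (η A ∘ F.F₁ m) ∘ FP.⟨ π₁ , π₂ ⟩                          ≈⟨ ∘-resp-≈ˡ (commute m) ⟩
        (G.F₁ m ∘ η (A E.⊗ A)) ∘ FP.⟨ π₁ , π₂ ⟩                  ≈⟨ assoc ⟩
        G.F₁ m ∘ (η (A E.⊗ A) ∘ FP.⟨ π₁ , π₂ ⟩)                  ≈⟨ ∘-resp-≈ʳ pairs ⟨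
        G.F₁ m ∘ (GP.⟨ π₁ , π₂ ⟩ ∘ ⟨ η A ∘ π₁ , η A ∘ π₂ ⟩)      ≈⟨ assoc ⟨
        (G.F₁ m ∘ GP.⟨ π₁ , π₂ ⟩) ∘ ⟨ η A ∘ π₁ , η A ∘ π₂ ⟩      ∎
        where
        leg : ∀ {B C} (q : C E.⇒ B) {U V} {u : U ⇒ F.F₀ C} {v : V ⇒ F.F₀ B} {w : U ⇒ V} →
              F.F₁ q ∘ u ≈ v ∘ w → G.F₁ q ∘ (η C ∘ u) ≈ η B ∘ (v ∘ w)
        leg q r = Equiv.trans (Equiv.sym assoc) (Equiv.trans (∘-resp-≈ˡ (Equiv.sym (commute q)))
          (Equiv.trans assoc (∘-resp-≈ʳ r)))

        pairs : GP.⟨ π₁ , π₂ ⟩ ∘ ⟨ η A ∘ π₁ , η A ∘ π₂ ⟩ ≈ η (A E.⊗ A) ∘ FP.⟨ π₁ , π₂ ⟩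
        pairs = Equiv.trans GP.⟨⟩-∘ (GP.unique
          (Equiv.trans (leg E.π₁ (Equiv.trans FP.project₁ (Equiv.sym identityʳ)))
            (Equiv.trans (∘-resp-≈ʳ identityʳ) (Equiv.sym project₁)))
          (Equiv.trans (leg E.π₂ (Equiv.trans FP.project₂ (Equiv.sym identityʳ)))
            (Equiv.trans (∘-resp-≈ʳ identityʳ) (Equiv.sym project₂))))

      nullary : ∀ {A : E.Obj} (t : E.𝟏 E.⇒ A) → η A ∘ (F.F₁ t ∘ FT.!) ≈ G.F₁ t ∘ GT.!
      nullary {A} t = begin
        η A ∘ (F.F₁ t ∘ FT.!)        ≈⟨ assoc ⟨
        (η A ∘ F.F₁ t) ∘ FT.!        ≈⟨ ∘-resp-≈ˡ (commute t) ⟩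
        (G.F₁ t ∘ η E.𝟏) ∘ FT.!      ≈⟨ assoc ⟩
        G.F₁ t ∘ (η E.𝟏 ∘ FT.!)      ≈⟨ ∘-resp-≈ʳ (GT.!-unique _) ⟨
        G.F₁ t ∘ GT.!                ∎

-- Presheaves are the sheaves for the coverage without covering families.

module _ (C : Category 0ℓ 0ℓ 0ℓ) where
  private module Psh = Category (Presheaves C)

  trivialSite : Site
  trivialSite = record
    { category = C
    ; Cover    = λ _ → ⊥
    ; Index    = λ ()
    ; dom      = λ ()
    ; arrow    = λ ()
    ; stable   = λ ()
    }

  _×ᵖ_ : Psh.Obj → Psh.Obj → Psh.Obj
  P ×ᵖ Q = record
    { F₀           = λ c → ×-setoid (P.F₀ c) (Q.F₀ c)
    ; F₁           = λ f → record
        { to   = λ (x , y) → to (P.F₁ f) x , to (Q.F₁ f) y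
        ; cong = λ (p , q) → cong (P.F₁ f) p , cong (Q.F₁ f) q
        }
    ; identity     = λ (x , y) → P.identity x , Q.identity y
    ; homomorphism = λ (x , y) → P.homomorphism x , Q.homomorphism y
    ; F-resp-≈     = λ p (x , y) → P.F-resp-≈ p x , Q.F-resp-≈ p y
    }
    where
    module P = Functor P
    module Q = Functor Q

  presheafFiniteProducts : FiniteProducts (Presheaves C)
  presheafFiniteProducts = record
    { 𝟏          = record
        { F₀           = λ _ → record { Carrier = 𝟙 ; _≈_ = λ _ _ → 𝟙 }
        ; F₁           = λ _ → record { to = λ x → x ; cong = λ p → p }
        ; identity     = λ _ → tt
        ; homomorphism = λ _ → tt
        ; F-resp-≈     = λ _ _ → tt
        }
    ; isTerminal = record
        { !        = record
            { η       = λ _ → record { to = λ _ → tt ; cong = λ _ → tt }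
            ; commute = λ _ _ → tt
            }
        ; !-unique = λ _ _ _ → tt
        }
    ; _⊗_        = _×ᵖ_
    ; π₁         = λ {P} {Q} → record
        { η       = λ c → record { to = proj₁ ; cong = proj₁ }
        ; commute = λ {_} {d} f _ → Setoid.refl (Functor.F₀ P d)
        }
    ; π₂         = λ {P} {Q} → record
        { η       = λ c → record { to = proj₂ ; cong = proj₂ }
        ; commute = λ {_} {d} f _ → Setoid.refl (Functor.F₀ Q d)
        }
    ; isProduct  = λ {P} {Q} → record
        { ⟨_,_⟩    = λ f g → record
            { η       = λ c → record
                { to   = λ x → to (η f c) x , to (η g c) x
                ; cong = λ p → cong (η f c) p , cong (η g c) p
                }
            ; commute = λ h x → commute f h x , commute g h x
            }
        ; project₁ = λ c x → Setoid.refl (Functor.F₀ P c)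
        ; project₂ = λ c x → Setoid.refl (Functor.F₀ Q c)
        ; unique   = λ p q c x → Setoid.sym (Functor.F₀ P c) (p c x) , Setoid.sym (Functor.F₀ Q c) (q c x)
        }
    } where open NaturalTransformation

  presheafTopos : GrothendieckTopos
  presheafTopos = record
    { category       = Presheaves C
    ; site           = trivialSite
    ; sheaves        = record
        { functor       = corestrict idF (λ _ ())
        ; isEquivalence = record
            { inverse = record
                { F₀           = proj₁
                ; F₁           = λ f → f
                ; identity     = λ {A} → Psh.Equiv.refl {x = Psh.id {proj₁ A}}
                ; homomorphism = λ {_} {_} {_} {f} {g} → Psh.Equiv.refl {x = g Psh.∘ f}
                ; F-resp-≈     = λ p → p
                }
            ; unit    = record
                { F⇒G  = record { η = λ _ → Psh.id ; commute = λ {A} {B} f → natural {A} {B} f }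
                ; F⇐G  = record { η = λ _ → Psh.id ; commute = λ {A} {B} f → natural {A} {B} f }
                ; isoˡ = λ A → Psh.identityˡ {f = Psh.id {A}}
                ; isoʳ = λ A → Psh.identityˡ {f = Psh.id {A}}
                }
            ; counit  = record
                { F⇒G  = record { η = λ _ → Psh.id ; commute = λ {A} {B} f → natural {proj₁ A} {proj₁ B} f }
                ; F⇐G  = record { η = λ _ → Psh.id ; commute = λ {A} {B} f → natural {proj₁ A} {proj₁ B} f }
                ; isoˡ = λ A → Psh.identityˡ {f = Psh.id {proj₁ A}}
                ; isoʳ = λ A → Psh.identityˡ {f = Psh.id {proj₁ A}}
                }
            }
        }
    ; finiteProducts = presheafFiniteProducts
    } where
    natural : ∀ {A B} (f : A Psh.⇒ B) → Psh.id Psh.∘ f Psh.≈ f Psh.∘ Psh.id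
    natural {A} {B} f c x = Setoid.refl (Functor.F₀ B c)

-- The cube category: m ⇒ n in □ is a map n → DL(m).

□ : Category 0ℓ 0ℓ 0ℓ
□ = record
  { Obj       = ℕ
  ; _⇒_       = λ m n → Kleisli n m
  ; _≈_       = _≋ᴷ_
  ; id        = var
  ; _∘_       = λ α γ → α ⨟ γ
  ; assoc     = λ {_} {_} {_} {_} {f} {g} {h} i → []-[] (h i) g f
  ; identityˡ = λ i → ≋-refl
  ; identityʳ = λ {_} {_} {f} i → []-var (f i)
  ; equiv     = record
      { refl  = λ i → ≋-refl
      ; sym   = λ p i → ≋-sym (p i)
      ; trans = λ p q i → ≋-trans (p i) (q i)
      }
  ; ∘-resp-≈  = λ {_} {_} {_} {f} {h} {g} {i} p q j →
      ≋-trans (eval-cong _ (DL _) (f j) q) ([]-≋ (p j) i)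
  }

cubicalSets : GrothendieckTopos
cubicalSets = presheafTopos □

𝕀 : InternalDL cubicalSets
𝕀 = record
  { signature = signature
  ; isBDL     = λ U → isBDL-fromEquations (generalizedElements U)
      (Category.equiv (Presheaves □) {U} {carrier})
      (λ p q c x → ∨-cong (p c x) (q c x))
      (λ p q c x → ∧-cong (p c x) (q c x))
      (λ {s} {t} p ρ c x → ≋-trans (≋-reflexive U ρ c x s)
        (≋-trans ([]-≋ p _) (≋-sym (≋-reflexive U ρ c x t))))
  } where
  interval : Functor (op □) Setoids
  interval = record
    { F₀           = λ n → record { isEquivalence = ≋-isEquivalence {n} }
    ; F₁           = λ γ → record { to = _[ γ ] ; cong = λ p → []-≋ p γ }
    ; identity     = []-var
    ; homomorphism = λ {_} {_} {_} {γ} {δ} t → ≋-sym ([]-[] t γ δ)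
    ; F-resp-≈     = λ p t → eval-cong _ (DL _) t p
    }

  signature : LatticeSignature cubicalSets
  signature = record
    { carrier = interval
    ; join    = record
        { η       = λ n → record { to = λ (s , t) → s ∨ᵗ t ; cong = λ (p , q) → ∨-cong p q }
        ; commute = λ _ _ → ≋-refl
        }
    ; meet    = record
        { η       = λ n → record { to = λ (s , t) → s ∧ᵗ t ; cong = λ (p , q) → ∧-cong p q }
        ; commute = λ _ _ → ≋-refl
        }
    ; top     = record
        { η       = λ n → record { to = λ _ → ⊤ᵗ ; cong = λ _ → ≋-refl }
        ; commute = λ _ _ → ≋-refl
        }
    ; bot     = record
        { η       = λ n → record { to = λ _ → ⊥ᵗ ; cong = λ _ → ≋-refl }
        ; commute = λ _ _ → ≋-refl
        }
    }

  open LatticeSignature signature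
  open NaturalTransformation

  ≋-reflexive : ∀ (U : Functor (op □) Setoids) {n} (ρ : Fin n → NaturalTransformation U interval)
                c x (t : Term n) →
                to (η (eval (generalizedElements U) t ρ) c) x ≋ t [ (λ i → to (η (ρ i) c) x) ]
  ≋-reflexive U ρ c x (var i)  = ≋-refl
  ≋-reflexive U ρ c x ⊤ᵗ       = ≋-refl
  ≋-reflexive U ρ c x ⊥ᵗ       = ≋-refl
  ≋-reflexive U ρ c x (s ∨ᵗ t) = ∨-cong (≋-reflexive U ρ c x s) (≋-reflexive U ρ c x t)
  ≋-reflexive U ρ c x (s ∧ᵗ t) = ∧-cong (≋-reflexive U ρ c x s) (≋-reflexive U ρ c x t)

InverseImagePreservesFlat : Set₂
InverseImagePreservesFlat =
  ∀ {X Y : GrothendieckTopos} (G : GeometricMorphism Y X) {D : InternalDL X} →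
  Flat X D → Flat Y (inverseImageDL G D)

module _ (pres : InverseImagePreservesFlat) where

  inverseImageFlat : ∀ {X Y : GrothendieckTopos} → GeometricMorphism Y X →
                     Functor (FlatDLat X) (FlatDLat Y)
  inverseImageFlat G = restrict (inverseImageDLat G) (λ {D} → pres G {D})

  evaluateAtFlat : (E : GrothendieckTopos) (D : InternalDL E) → Flat E D →
                   (X : GrothendieckTopos) → Functor (Geom X E) (FlatDLat X)
  evaluateAtFlat E D flat X = corestrict (evaluateAt E X D) (λ F → pres F {D} flat)

  -- Naturality of F ↦ F*D along G : Y → X.  The carriers of (F ∘ G)*D and
  -- G*(F*D) coincide, and the comparison is required to be the identity on
  -- them, so it is automatically coherent in G.
  NaturalAlong : (E : GrothendieckTopos) (D : InternalDL E) → Flat E D →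
                 {X Y : GrothendieckTopos} → GeometricMorphism Y X → Set₁
  NaturalAlong E D flat {X} {Y} G =
    Σ[ θ ∈ NaturalIsomorphism (evaluateAtFlat E D flat Y ∘F precompose E G)
                              (inverseImageFlat G ∘F evaluateAtFlat E D flat X) ]
      (∀ (F : GeometricMorphism X E) → hom (NaturalIsomorphism.⇒.η θ F) ≈ id)
    where open GrothendieckTopos Y

{-# OPTIONS --safe #-}
-- Diaconescu's theorem for the cube category, by a direct argument.  A flat lattice D
-- in X extends to F* by F*P = ∫ⁿ P(n) × Dⁿ, with right adjoint A ↦ (n ↦ Hom(Dⁿ, A)).
-- Since D is flat, two formal sections (n, x, d) and (m, y, e) agree exactly when they
-- locally have a common refinement, and this makes F* left exact.  Conversely F* is
-- determined by F*𝕀, because the n-cube is 𝕀ⁿ, every presheaf is jointly covered by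
-- cubes, and F* preserves finite powers and jointly epic families.
module Submission where

open import Defs
open import Level using (0ℓ)
open import Data.Bool.Base using (Bool; true; false)
open import Data.Fin.Base using (Fin; zero; suc; _↑ˡ_; _↑ʳ_)
open import Data.Nat.Base using (ℕ; zero; suc; _+_)
open import Data.Product.Base using (Σ-syntax; _,_; proj₁; proj₂; _×_)
open import Data.Sum.Base using (_⊎_; inj₁; inj₂)
open import Data.Vec.Functional using (_++_)
open import Data.Vec.Functional.Properties using (lookup-++ˡ; lookup-++ʳ)
open import Function.Bundles using (Func)
open import Relation.Binary.Bundles using (Setoid)
open import Relation.Binary.PropositionalEquality.Core as ≡ using (_≡_)
open import Relation.Binary.Structures using (IsEquivalence)

open Func using (to; cong)
open NaturalTransformation

-- Local truth and descent on a site

-- Flatness asks only that parallel maps be equalized, yet left exactness needs the category of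
-- elements of D to be cofiltered locally. The missing cone over two tuples is their concatenation,
-- since the cube category has finite products and n ↦ Dⁿ preserves them. The obstacle is to make
-- "locally" precise. Flatness speaks of jointly epic families in X, while the argument needs actual
-- factorizations after a refinement, and X is known only through an equivalence with sheaves for a
-- coverage that is weakly stable and not assumed transitive. Hence refinement is an inductive tree
-- of covers, sections of objects of X become arrows out of sheafified representables, and joint
-- epimorphy is shown to be local surjectivity on such arrows. Sheafification itself has to stay
-- within small sets, which is why its sections are relations given by codes. With this in place, an
-- arrow into an object of X may be constructed by local unique existence: the lifts required by
-- products, equalizers and the terminal object are unique by joint monicity, so local solutions
-- glue without any choice.

module LocalTruth (S : Site) where
  open Site S

  -- R holds locally at f when f, after refinement along covers, factors
  -- through arrows satisfying R.  Building the sieve generated by R into the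
  -- leaves makes Local R stable under restriction for every R.
  data Local {c} (R : ∀ {d} → d ⇒ c → Set) {d} (f : d ⇒ c) : Set where
    here  : ∀ {e} (g : e ⇒ c) (k : d ⇒ e) → g ∘ k ≈ f → R g → Local R f
    there : (u : Cover d) → (∀ i → Local R (f ∘ arrow u i)) → Local R f

  now : ∀ {c} {R : ∀ {d} → d ⇒ c → Set} {d} {f : d ⇒ c} → R f → Local R f
  now r = here _ id identityʳ r

  restrictLocal : ∀ {c} {R : ∀ {d} → d ⇒ c → Set} {d e} {f : d ⇒ c} {h : e ⇒ c} (k : e ⇒ d) →
                  f ∘ k ≈ h → Local R f → Local R h
  restrictLocal k p (here g l q r) = here g (l ∘ k)
    (Equiv.trans (Equiv.sym assoc) (Equiv.trans (∘-resp-≈ˡ q) p)) r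
  restrictLocal {R = R} {f = f} {h} k p (there u r) = there v λ j →
    let i , l , q = s j in
    restrictLocal l
      (Equiv.trans assoc (Equiv.trans (∘-resp-≈ʳ (Equiv.sym q))
        (Equiv.trans (Equiv.sym assoc) (∘-resp-≈ˡ p))))
      (r i)
    where
    v = proj₁ (stable u k)
    s = proj₂ (stable u k)

  joinLocal : ∀ {c} {R R′ : ∀ {d} → d ⇒ c → Set} {d} {f : d ⇒ c} →
              (∀ {e} (g : e ⇒ c) → R g → Local R′ g) → Local R f → Local R′ f
  joinLocal m (here g k p r) = restrictLocal k p (m g r)
  joinLocal m (there u r)    = there u λ i → joinLocal m (r i)

  rebase : ∀ {c d} {R : ∀ {e} → e ⇒ c → Set} {R′ : ∀ {e} → e ⇒ d → Set} (f : d ⇒ c) →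
           (∀ {e} (g : e ⇒ d) → R′ g → R (f ∘ g)) →
           ∀ {e} {g : e ⇒ d} {h : e ⇒ c} → f ∘ g ≈ h → Local R′ g → Local R h
  rebase f m p (here g k q r) = here (f ∘ g) k
    (Equiv.trans assoc (Equiv.trans (∘-resp-≈ʳ q) p)) (m g r)
  rebase f m p (there u r) = there u λ i →
    rebase f m (Equiv.trans (Equiv.sym assoc) (∘-resp-≈ˡ p)) (r i)

  infixl 1 _>>=_

  -- Nested local existence is local existence. The second tree is grafted onto the leaves of the
  -- first, which stands in for transitivity of the coverage.
  _>>=_ : ∀ {c} {R R′ : ∀ {d} → d ⇒ c → Set} → Local R (id {c}) →
          (∀ {d} (f : d ⇒ c) → R f → Local (λ g → R′ (f ∘ g)) (id {d})) → Local R′ (id {c})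
  r >>= m = joinLocal (λ f s → rebase f (λ g t → t) identityʳ (m f s)) r

  mapLocal : ∀ {c} {R R′ : ∀ {d} → d ⇒ c → Set} →
             (∀ {d} (f : d ⇒ c) → R f → R′ f) → Local R (id {c}) → Local R′ (id {c})
  mapLocal m = joinLocal (λ g r → now (m g r))

  -- R f need not pass to k, so the hypothesis sees a restriction of f that factors through k.
  pullLocal : ∀ {c d} {R : ∀ {e} → e ⇒ c → Set} {R′ : ∀ {e} → e ⇒ d → Set} (k : d ⇒ c) →
              (∀ {e w} (f : e ⇒ c) (g : w ⇒ e) (h : w ⇒ d) → f ∘ g ≈ k ∘ h → R f → R′ h) →
              ∀ {e} {f : e ⇒ c} {h : e ⇒ d} → k ∘ h ≈ f → Local R f → Local R′ h
  pullLocal k m p (here g l q r) = now (m g l _ (Equiv.trans q (Equiv.sym p)) r)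
  pullLocal k m p (there u r) = there u λ i →
    pullLocal k m (Equiv.trans (Equiv.sym assoc) (∘-resp-≈ˡ p)) (r i)

  Stable : ∀ {c} → (∀ {d} → d ⇒ c → Set) → Set
  Stable {c} R = ∀ {d e} {f : d ⇒ c} (g : e ⇒ d) {h : e ⇒ c} → f ∘ g ≈ h → R f → R h

  -- The refinements on which the two properties hold are found independently, so each property must
  -- survive restriction to a common refinement.
  both : ∀ {c} {R R′ : ∀ {d} → d ⇒ c → Set} → Stable R → Stable R′ →
         Local R (id {c}) → Local R′ (id {c}) → Local (λ f → R f × R′ f) (id {c})
  both stableR stableR′ r r′ = r >>= λ f s → pullLocal f
    (λ g h k p s′ → stableR k Equiv.refl s , stableR′ h p s′) identityʳ (restrictLocal f identityˡ r′)

  module Descent (A : Functor (op category) Setoids) (sheaf : IsSheaf S A) where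
    private
      module A {c} = Setoid (Functor.F₀ A c)
      open Functor A

      _∣ᴬ_ : ∀ {c d} → Section S A c → d ⇒ c → Section S A d
      x ∣ᴬ f = to (F₁ f) x

    separated : ∀ {c} (u : Cover c) {x y : Section S A c} →
                (∀ i → (x ∣ᴬ arrow u i) A.≈ (y ∣ᴬ arrow u i)) → x A.≈ y
    separated u {x} {y} p =
      let _ , _ , unique = sheaf u (λ i → x ∣ᴬ arrow u i) (λ i j a b q →
            A.trans (A.sym (homomorphism x)) (A.trans (F-resp-≈ q x) (homomorphism x)))
      in A.trans (A.sym (unique x (λ i → A.refl))) (unique y (λ i → A.sym (p i)))

    locally-≈ : ∀ {c} {x y : Section S A c} →
                Local (λ f → (x ∣ᴬ f) A.≈ (y ∣ᴬ f)) (id {c}) → x A.≈ y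
    locally-≈ {c} {x} {y} p =
      A.trans (A.sym (identity x)) (A.trans (go p) (identity y))
      where
      go : ∀ {d} {f : d ⇒ c} → Local (λ g → (x ∣ᴬ g) A.≈ (y ∣ᴬ g)) f → (x ∣ᴬ f) A.≈ (y ∣ᴬ f)
      go (here g k q r) = A.trans (A.sym (F-resp-≈ q x)) (A.trans (homomorphism x)
        (A.trans (cong (F₁ k) r) (A.trans (A.sym (homomorphism y)) (F-resp-≈ q y))))
      go (there u r) = separated u λ i →
        A.trans (A.sym (homomorphism x)) (A.trans (go (r i)) (homomorphism y))

    -- Unique existence is local. By induction on the tree, solutions on the pieces of a cover are
    -- compatible because `unique` applies to their restrictions; the sheaf condition glues them,
    -- and `local` says that the glued section is again a solution.
    descend : ∀ {c} (R : ∀ {d} → d ⇒ c → Section S A d → Set) →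
              (∀ {d e} {f : d ⇒ c} {g : e ⇒ c} {x y} (k : e ⇒ d) →
                f ∘ k ≈ g → (x ∣ᴬ k) A.≈ y → R f x → R g y) →
              (∀ {d} {f : d ⇒ c} {x y} → R f x → R f y → x A.≈ y) →
              (∀ {d} {f : d ⇒ c} {x} (u : Cover d) →
                (∀ i → R (f ∘ arrow u i) (x ∣ᴬ arrow u i)) → R f x) →
              ∀ {d} {f : d ⇒ c} → Local (λ g → Σ[ x ∈ Section S A _ ] R g x) f →
              Σ[ x ∈ Section S A d ] R f x
    descend R restrict unique local (here g k p (x , r)) = x ∣ᴬ k , restrict k p A.refl r
    descend {c} R restrict unique local {d} {f} (there u r) =
      x , local u λ i → restrict id identityʳ
        (A.trans (identity _) (A.sym (amalgam i))) (proj₂ (s i))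
      where
      s : ∀ i → Σ[ x ∈ Section S A _ ] R (f ∘ arrow u i) x
      s i = descend R restrict unique local (r i)

      glued = sheaf u (λ i → proj₁ (s i)) λ i j a b p → unique
        (restrict a Equiv.refl A.refl (proj₂ (s i)))
        (restrict b (Equiv.trans assoc (Equiv.trans (∘-resp-≈ʳ (Equiv.sym p)) (Equiv.sym assoc)))
          A.refl (proj₂ (s j)))

      x = proj₁ glued
      amalgam = proj₁ (proj₂ glued)

-- Extension of maps into sheaves along local isomorphisms

module LocalIsomorphism (S : Site) {Q A : Functor (op (Site.category S)) Setoids}
                        (ι : NaturalTransformation Q A) where
  open Site S
  open LocalTruth S
  private
    module Q = Functor Q
    module A = Functor A
    module Aᵉ {c} = Setoid (A.F₀ c)

    infixl 8 _∣ꟴ_ _∣ᴬ_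
    _∣ꟴ_ : ∀ {c d} → Section S Q c → d ⇒ c → Section S Q d
    x ∣ꟴ f = to (Q.F₁ f) x

    _∣ᴬ_ : ∀ {c d} → Section S A c → d ⇒ c → Section S A d
    x ∣ᴬ f = to (A.F₁ f) x

    inc : ∀ {c} → Section S Q c → Section S A c
    inc {c} = to (η ι c)

    infix 4 _≈Q_ _≈A_
    _≈Q_ : ∀ {c} → Section S Q c → Section S Q c → Set
    _≈Q_ {c} = Setoid._≈_ (Q.F₀ c)

    _≈A_ : ∀ {c} → Section S A c → Section S A c → Set
    _≈A_ {c} = Setoid._≈_ (A.F₀ c)

  LocallyInjective : Set
  LocallyInjective = ∀ {c} (x y : Section S Q c) → inc x ≈A inc y → Local (λ f → x ∣ꟴ f ≈Q y ∣ꟴ f) (id {c})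

  LocallySurjective : Set
  LocallySurjective = ∀ {c} (z : Section S A c) → Local (λ f → Σ[ x ∈ Section S Q _ ] inc x ≈A z ∣ᴬ f) (id {c})

  module Extension (injective : LocallyInjective) (surjective : LocallySurjective)
                   (B : Functor (op category) Setoids) (sheaf : IsSheaf S B)
                   (g : NaturalTransformation Q B) where
    open Descent B sheaf
    private
      module B = Functor B
      module Bᵉ {c} = Setoid (B.F₀ c)

      infixl 8 _∣ᴮ_
      _∣ᴮ_ : ∀ {c d} → Section S B c → d ⇒ c → Section S B d
      x ∣ᴮ f = to (B.F₁ f) x

      -- The graph of the extension: `b` is forced by every section of `Q` lying over a restriction
      -- of `z`. Quantifying over all restrictions makes it stable, local surjectivity makes it
      -- single-valued, and local injectivity makes values exist locally, so `descend` applies.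
      IsValue : ∀ {c} → Section S A c → ∀ {d} → d ⇒ c → Section S B d → Set
      IsValue z {d} f b = ∀ {e} (k : e ⇒ d) q → inc q ≈A z ∣ᴬ (f ∘ k) → to (η g e) q Bᵉ.≈ b ∣ᴮ k

      stability : ∀ {c} (z : Section S A c) {d e} {f : d ⇒ c} {h : e ⇒ c} {x y} (k : e ⇒ d) →
                  f ∘ k ≈ h → (x ∣ᴮ k) Bᵉ.≈ y → IsValue z f x → IsValue z h y
      stability z {x = x} k p r v l q e = Bᵉ.trans
        (v (k ∘ l) q (Aᵉ.trans e (A.F-resp-≈ (Equiv.trans (∘-resp-≈ˡ (Equiv.sym p)) assoc) z)))
        (Bᵉ.trans (B.homomorphism x) (cong (B.F₁ l) r))

      uniqueness : ∀ {c} (z : Section S A c) {d} {f : d ⇒ c} {x y} →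
                   IsValue z f x → IsValue z f y → x Bᵉ.≈ y
      uniqueness z {f = f} v w = locally-≈ (mapLocal
        (λ k (q , e) → let e′ = Aᵉ.trans e (Aᵉ.sym (A.homomorphism z)) in
          Bᵉ.trans (Bᵉ.sym (v k q e′)) (w k q e′))
        (surjective (z ∣ᴬ f)))

      locality : ∀ {c} (z : Section S A c) {d} {f : d ⇒ c} {x} (u : Cover d) →
                 (∀ i → IsValue z (f ∘ arrow u i) (x ∣ᴮ arrow u i)) → IsValue z f x
      locality z {x = x} u v k q e = let w , s = stable u k in separated w λ j →
        let i , k′ , r = s j in
        Bᵉ.trans (Bᵉ.sym (commute g (arrow w j) q))
        (Bᵉ.trans (v i k′ (q ∣ꟴ arrow w j) (Aᵉ.trans (commute ι (arrow w j) q)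
          (Aᵉ.trans (cong (A.F₁ (arrow w j)) e) (Aᵉ.trans (Aᵉ.sym (A.homomorphism z))
            (A.F-resp-≈ (Equiv.trans assoc (Equiv.trans (∘-resp-≈ʳ r) (Equiv.sym assoc))) z)))))
        (Bᵉ.trans (Bᵉ.sym (B.homomorphism x)) (Bᵉ.trans (B.F-resp-≈ (Equiv.sym r) x) (B.homomorphism x))))

      existence : ∀ {c} (z : Section S A c) → Σ[ b ∈ Section S B c ] IsValue z id b
      existence z = descend (IsValue z) (stability z) (uniqueness z) (locality z) (mapLocal
        -- A section `q` over the restricted `z` offers the value `g q`. Any competitor `q′` has the
        -- same image as a restriction of `q`, so the two agree locally by `injective`, and `B` is
        -- separated.
        (λ f (q , e) → to (η g _) q , λ k q′ e′ → locally-≈ (mapLocal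
          (λ l r → Bᵉ.trans (Bᵉ.sym (commute g l q′)) (Bᵉ.trans (cong (η g _) r)
            (Bᵉ.trans (commute g l (q ∣ꟴ k)) (cong (B.F₁ l) (commute g k q)))))
          (injective q′ (q ∣ꟴ k) (Aᵉ.trans e′ (Aᵉ.trans (A.homomorphism z)
            (Aᵉ.trans (cong (A.F₁ k) (Aᵉ.sym e)) (Aᵉ.sym (commute ι k q))))))))
        (surjective z))

    extend : NaturalTransformation A B
    extend = record
      { η       = λ c → record
          { to   = λ z → proj₁ (existence z)
          ; cong = λ {z} {z′} p → uniqueness z′
              (λ k q e → proj₂ (existence z) k q (Aᵉ.trans e (cong (A.F₁ _) (Aᵉ.sym p))))
              (proj₂ (existence z′))
          }
      ; commute = λ f z → uniqueness (z ∣ᴬ f) (proj₂ (existence (z ∣ᴬ f)))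
          (λ k q e → Bᵉ.trans
            (proj₂ (existence z) (f ∘ k) q (Aᵉ.trans e (Aᵉ.trans (Aᵉ.sym (A.homomorphism z))
              (A.F-resp-≈ (Equiv.trans (∘-resp-≈ʳ identityˡ) (Equiv.sym identityˡ)) z))))
            (B.homomorphism (proj₁ (existence z))))
      }

    extend-inc : ∀ {c} (q : Section S Q c) → to (η extend c) (inc q) Bᵉ.≈ to (η g c) q
    extend-inc q = Bᵉ.sym (Bᵉ.trans
      (proj₂ (existence (inc q)) id q (Aᵉ.sym (Aᵉ.trans (A.F-resp-≈ identityˡ (inc q)) (A.identity _))))
      (B.identity _))

-- Sheafification

module Sheafification (S : Site) (Q : Functor (op (Site.category S)) Setoids) where
  open Site S
  open LocalTruth S
  private
    module Q = Functor Q
    module Qᵉ {c} = Setoid (Q.F₀ c)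

    infixl 8 _∣ꟴ_
    _∣ꟴ_ : ∀ {c d} → Section S Q c → d ⇒ c → Section S Q d
    x ∣ꟴ f = to (Q.F₁ f) x

  -- A section of the sheafification is a single-valued, locally inhabited
  -- relation between arrows and sections of Q.  Codes keep these relations small.
  data Code (c : Obj) : Set where
    leaf : Section S Q c → Code c
    node : (u : Cover c) (e : Index u → Obj) → (∀ i → dom u i ⇒ e i) → (∀ i → Code (e i)) → Code c

  -- Agreement at a leaf is required only locally, so `Q` need not be separated and one step does
  -- the work of two plus constructions. A node carries the arrows `g i` because a germ to be glued
  -- is a code together with an arrow to its base.
  Value : ∀ {c} → Code c → ∀ {d} → d ⇒ c → Section S Q d → Set
  Value (leaf x)       {d} f y = Local (λ g → (x ∣ꟴ (f ∘ g)) Qᵉ.≈ (y ∣ꟴ g)) (id {d})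
  Value (node u e g t) {d} f y = ∀ {w} (k : w ⇒ d) i (h : w ⇒ dom u i) →
    arrow u i ∘ h ≈ f ∘ k → Value (t i) (g i ∘ h) (y ∣ꟴ k)

  LocallyEqual : ∀ {c} (x y : Section S Q c) → Set
  LocallyEqual {c} x y = Local (λ g → (x ∣ꟴ g) Qᵉ.≈ (y ∣ꟴ g)) (id {c})

  private
    ∣-triangle : ∀ {c d e} (x : Section S Q c) {f : d ⇒ c} {g : e ⇒ d} {h : e ⇒ c} → f ∘ g ≈ h →
                 ((x ∣ꟴ f) ∣ꟴ g) Qᵉ.≈ (x ∣ꟴ h)
    ∣-triangle x p = Qᵉ.trans (Qᵉ.sym (Q.homomorphism x)) (Q.F-resp-≈ p x)

    ∣-square : ∀ {c d d′ e} (x : Section S Q c) {f : d ⇒ c} {g : e ⇒ d} {f′ : d′ ⇒ c} {g′ : e ⇒ d′} →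
               f ∘ g ≈ f′ ∘ g′ → ((x ∣ꟴ f) ∣ꟴ g) Qᵉ.≈ ((x ∣ꟴ f′) ∣ꟴ g′)
    ∣-square x p = Qᵉ.trans (∣-triangle x p) (Q.homomorphism x)

  Value-restrict : ∀ {c} (t : Code c) {d e} {f : d ⇒ c} {h : e ⇒ c} {x y} (k : e ⇒ d) →
                   f ∘ k ≈ h → (x ∣ꟴ k) Qᵉ.≈ y → Value t f x → Value t h y
  Value-restrict (leaf z) {x = x} k p q v =
    pullLocal k (λ m g n r s → Qᵉ.trans
        (Qᵉ.sym (∣-triangle z (Equiv.trans assoc (Equiv.trans (∘-resp-≈ʳ r)
          (Equiv.trans (Equiv.sym assoc) (∘-resp-≈ˡ p))))))
        (Qᵉ.trans (cong (Q.F₁ g) s) (Qᵉ.trans (∣-square x r) (cong (Q.F₁ n) q))))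
      identityʳ (restrictLocal k identityˡ v)
  Value-restrict (node u e g t) {x = x} k p q v k′ i l r =
    Value-restrict (t i) id identityʳ
      (Qᵉ.trans (Q.identity _) (Qᵉ.trans (Q.homomorphism x) (cong (Q.F₁ k′) q)))
      (v (k ∘ k′) i l (Equiv.trans r (Equiv.trans (∘-resp-≈ˡ (Equiv.sym p)) assoc)))

  -- At a leaf this adds one cover to the tree. At a node the cover must first be pulled back along
  -- `k`, which weak stability allows.
  Value-local : ∀ {c} (t : Code c) {d} {f : d ⇒ c} {x} (v : Cover d) →
                (∀ j → Value t (f ∘ arrow v j) (x ∣ꟴ arrow v j)) → Value t f x
  Value-local (leaf z) {x = x} v p = there v λ j → rebase (arrow v j)
    (λ g r → Qᵉ.trans (Q.F-resp-≈ (Equiv.sym assoc) z) (Qᵉ.trans r (∣-triangle x Equiv.refl)))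
    (Equiv.trans identityʳ (Equiv.sym identityˡ)) (p j)
  Value-local (node u e g t) {f = f} {x} v p k i h q = Value-local (t i) w λ j →
    let j′ , k′ , r = s j in
    Value-restrict (t i) id (Equiv.trans identityʳ (Equiv.sym assoc))
      (Qᵉ.trans (Q.identity _) (∣-square x (Equiv.sym r)))
      (p j′ k′ i (h ∘ arrow w j) (Equiv.trans (Equiv.sym assoc) (Equiv.trans (∘-resp-≈ˡ q)
        (Equiv.trans assoc (Equiv.trans (∘-resp-≈ʳ r) (Equiv.sym assoc))))))
    where
    w = proj₁ (stable v k)
    s = proj₂ (stable v k)

  Value-locally : ∀ {c} (t : Code c) {d} {f : d ⇒ c} {x} →
                  Local (λ k → Value t (f ∘ k) (x ∣ꟴ k)) (id {d}) → Value t f x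
  Value-locally t {d} {f} {x} p = Value-restrict t id (Equiv.trans identityʳ identityʳ)
      (Qᵉ.trans (∣-triangle x identityˡ) (Q.identity x)) (go p)
    where
    go : ∀ {e} {k : e ⇒ d} → Local (λ k → Value t (f ∘ k) (x ∣ꟴ k)) k → Value t (f ∘ k) (x ∣ꟴ k)
    go (here g l q r) = Value-restrict t l (Equiv.trans assoc (∘-resp-≈ʳ q)) (∣-triangle x q) r
    go (there u r)    = Value-local t u λ i →
      Value-restrict t id (Equiv.trans identityʳ (Equiv.sym assoc))
        (Qᵉ.trans (Q.identity _) (Q.homomorphism x)) (go (r i))

  Value-cong : ∀ {c} (t : Code c) {d} {f : d ⇒ c} {x y} → LocallyEqual x y → Value t f x → Value t f y
  Value-cong t p v = Value-locally t
    (mapLocal (λ k r → Value-restrict t k Equiv.refl r v) p)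

  -- Restriction only composes `along` and leaves the code alone, so functoriality reduces to
  -- associativity instead of a recursion on codes.
  record Germ (c : Obj) : Set where
    field
      {base}  : Obj
      along   : c ⇒ base
      code    : Code base
      total   : ∀ {d} (f : d ⇒ c) →
                Local (λ g → Σ[ x ∈ Section S Q _ ] Value code (along ∘ (f ∘ g)) x) (id {d})
      unique  : ∀ {d} (f : d ⇒ c) {x y} → Value code (along ∘ f) x → Value code (along ∘ f) y →
                LocallyEqual x y

  _≼_ : ∀ {c} → Germ c → Germ c → Set
  _≼_ {c} s t = ∀ {d} (f : d ⇒ c) {x} → Value S.code (S.along ∘ f) x → Value T.code (T.along ∘ f) x
    where
    module S = Germ s
    module T = Germ t

  -- Between total single-valued relations, inclusion is an equality.
  ≼-sym : ∀ {c} (s t : Germ c) → s ≼ t → t ≼ s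
  ≼-sym s t p f v = Value-locally S.code (mapLocal (λ k (x , w) →
      Value-cong S.code
        (T.unique (f ∘ k) (p (f ∘ k) w) (Value-restrict T.code k assoc Qᵉ.refl v))
        (Value-restrict S.code id (Equiv.trans identityʳ (Equiv.sym assoc)) (Q.identity x) w))
    (S.total f))
    where
    module S = Germ s
    module T = Germ t

  private
    move : ∀ {c} (t : Code c) {d} {f h : d ⇒ c} {x} → f ≈ h → Value t f x → Value t h x
    move t p = Value-restrict t id (Equiv.trans identityʳ p) (Q.identity _)

  germs : Functor (op category) Setoids
  germs = record
    { F₀ = λ c → record
        { Carrier = Germ c
        ; _≈_     = _≼_
        ; isEquivalence = record
            { refl  = λ f v → v
            ; sym   = λ {s} {t} → ≼-sym s t
            ; trans = λ p q f v → q f (p f v)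
            }
        }
    ; F₁ = λ f → record
        { to = λ s → let open Germ s in record
            { along  = along ∘ f
            ; code   = code
            ; total  = λ g → mapLocal (λ k (x , v) → x ,
                move code (Equiv.trans (∘-resp-≈ʳ assoc) (Equiv.sym assoc)) v) (total (f ∘ g))
            ; unique = λ g v w → unique (f ∘ g) (move code assoc v) (move code assoc w)
            }
        ; cong = λ {s} {t} p g v → move (Germ.code t) (Equiv.sym assoc)
            (p (f ∘ g) (move (Germ.code s) assoc v))
        }
    ; identity     = λ s g → move (Germ.code s) (∘-resp-≈ˡ identityʳ)
    ; homomorphism = λ s g → move (Germ.code s) (∘-resp-≈ˡ (Equiv.sym assoc))
    ; F-resp-≈     = λ p s g → move (Germ.code s) (∘-resp-≈ˡ (∘-resp-≈ʳ p))
    }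

  -- Codes are closed under gluing by construction: the glued germ is the `node` of the family.
  -- Compatibility enters in `extend`, which turns a value on one piece into a value of the whole
  -- node.
  germs-sheaf : IsSheaf S germs
  germs-sheaf {c} u s compatible = glued , amalgamates , unique
    where
    module s i = Germ (s i)

    t : Code c
    t = node u s.base s.along s.code

    extend : ∀ {d} (k : d ⇒ c) i (h : d ⇒ dom u i) {x} → arrow u i ∘ h ≈ k →
             Value (s.code i) (s.along i ∘ h) x → Value t k x
    extend k i h p v k′ j h′ q = move (s.code j) (∘-resp-≈ʳ identityʳ)
      (compat (move (s.code i) (∘-resp-≈ʳ (Equiv.sym identityʳ))
        (Value-restrict (s.code i) k′ assoc Qᵉ.refl v)))
      where
      compat : ∀ {x} → Value (s.code i) (s.along i ∘ ((h ∘ k′) ∘ id)) x →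
               Value (s.code j) (s.along j ∘ (h′ ∘ id)) x
      compat v = move (s.code j) assoc (compatible i j (h ∘ k′) h′
        (Equiv.trans (Equiv.sym assoc) (Equiv.trans (∘-resp-≈ˡ p) (Equiv.sym q))) id
        (move (s.code i) (Equiv.sym assoc) v))

    evaluate : ∀ {d} (k : d ⇒ c) i (h : d ⇒ dom u i) {x} → arrow u i ∘ h ≈ k →
               Value t k x → Value (s.code i) (s.along i ∘ h) x
    evaluate k i h p v = Value-restrict (s.code i) id identityʳ
      (Qᵉ.trans (Q.identity _) (Q.identity _)) (v id i h (Equiv.trans p (Equiv.sym identityʳ)))

    glued : Germ c
    glued = record
      { along  = id
      ; code   = t
      ; total  = λ f → let v , r = stable u f in there v λ j →
          let i , k , q = r j in
          rebase (arrow v j) (λ g (x , w) → x , extend _ i (k ∘ g)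
              (Equiv.trans (Equiv.sym assoc) (Equiv.trans (∘-resp-≈ˡ (Equiv.sym q))
                (Equiv.trans assoc (Equiv.sym identityˡ)))) w)
            (Equiv.trans identityʳ (Equiv.sym identityˡ)) (s.total i k)
      ; unique = λ f {x} {y} a b → let v , r = stable u f in there v λ j →
          let i , k , q = r j
              q′ = Equiv.trans (Equiv.sym q) (∘-resp-≈ˡ (Equiv.sym identityˡ)) in
          rebase (arrow v j) (λ g e → Qᵉ.trans (Q.homomorphism x) (Qᵉ.trans e (Qᵉ.sym (Q.homomorphism y))))
            (Equiv.trans identityʳ (Equiv.sym identityˡ))
            (s.unique i k
              (evaluate _ i k q′ (Value-restrict t (arrow v j) Equiv.refl Qᵉ.refl a))
              (evaluate _ i k q′ (Value-restrict t (arrow v j) Equiv.refl Qᵉ.refl b)))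
      }

    amalgamates : Amalgamates S germs u s glued
    amalgamates i f v = evaluate _ i f (∘-resp-≈ˡ (Equiv.sym identityˡ)) v

    unique : ∀ y → Amalgamates S germs u s y → glued ≼ y
    -- The inclusion of `y` into the node can be read off on each piece; `≼-sym` reverses it.
    unique y p = ≼-sym y glued λ f v k i h q →
      move (s.code i) Equiv.refl (p i h (move (Germ.code y)
        (Equiv.trans assoc (Equiv.trans (∘-resp-≈ʳ (Equiv.sym (Equiv.trans q (∘-resp-≈ˡ identityˡ)))) (Equiv.sym assoc)))
        (Value-restrict (Germ.code y) k Equiv.refl Qᵉ.refl v)))

  germ : ∀ {c} → Section S Q c → Germ c
  germ x = record
    { along  = id
    ; code   = leaf x
    ; total  = λ f → now (x ∣ꟴ f , now (Qᵉ.trans (Q.F-resp-≈ (∘-resp-≈ˡ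
        (Equiv.trans identityˡ identityʳ)) x) (Q.homomorphism x)))
    ; unique = λ f {y} {z} p q → p >>= λ g r → pullLocal g
        (λ g′ m n e s → Qᵉ.trans (Q.homomorphism y) (Qᵉ.trans (cong (Q.F₁ n) (Qᵉ.sym r))
          (Qᵉ.trans (∣-square x (Equiv.trans assoc (Equiv.trans (∘-resp-≈ʳ (Equiv.sym e)) (Equiv.sym assoc))))
            (Qᵉ.trans (cong (Q.F₁ m) s) (∣-triangle z e)))))
        identityʳ (restrictLocal g identityˡ q)
    }

  germ-cong : ∀ {c} {x y : Section S Q c} → x Qᵉ.≈ y → germ x ≼ germ y
  germ-cong p f = mapLocal λ g → Qᵉ.trans (cong (Q.F₁ _) (Qᵉ.sym p))

  germ-∣ : ∀ {c d} (x : Section S Q c) (f : d ⇒ c) → germ (x ∣ꟴ f) ≼ to (Functor.F₁ germs f) (germ x)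
  germ-∣ x f g = mapLocal λ k → Qᵉ.trans (Qᵉ.sym (∣-triangle x
    (Equiv.trans (Equiv.sym assoc) (∘-resp-≈ˡ (Equiv.trans (Equiv.sym assoc)
      (∘-resp-≈ˡ (Equiv.trans identityʳ (Equiv.sym identityˡ))))))))

  germ-injective : ∀ {c} {x y : Section S Q c} → germ x ≼ germ y → LocallyEqual x y
  germ-injective {x = x} {y} p = mapLocal
    (λ g q → Qᵉ.sym (Qᵉ.trans (Q.F-resp-≈ (Equiv.sym (Equiv.trans (∘-resp-≈ˡ identityˡ) identityˡ)) y) q))
    (p id (now (Q.F-resp-≈ (Equiv.trans (∘-resp-≈ˡ identityˡ) identityˡ) x)))

  -- Totality at the identity gives local values `x`. Whatever is locally equal to a restriction of
  -- a value is again a value, so the germ of `x` is included in the restriction of `s`, and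
  -- inclusion is already equality of germs.
  germ-surjective : ∀ {c} (s : Germ c) →
                    Local (λ f → Σ[ x ∈ Section S Q _ ] germ x ≼ to (Functor.F₁ germs f) s) (id {c})
  germ-surjective s = mapLocal
    (λ f (x , v) → x , λ g p → Value-locally code (mapLocal
      (λ k q → Value-restrict code (g ∘ k)
        (Equiv.trans (Equiv.sym assoc) (∘-resp-≈ˡ (Equiv.trans (∘-resp-≈ˡ (∘-resp-≈ʳ identityˡ)) Equiv.refl)))
        (Qᵉ.trans (Q.F-resp-≈ (Equiv.trans (Equiv.sym identityˡ) (Equiv.sym assoc)) x) q) v) p))
    (total id)
    where open Germ s

-- Restricted Yoneda: for `idF` this is the representable presheaf at `A`, and for the generators of
-- a topos it is the sheaf of sections of `A`.
nerve : ∀ {o} {C : Category 0ℓ 0ℓ 0ℓ} {D : Category o 0ℓ 0ℓ} → Functor C D → Category.Obj D →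
        Functor (op C) Setoids
nerve {D = D} L A = record
  { F₀           = λ c → hom-setoid (L.F₀ c) A
  ; F₁           = λ f → record { to = _∘ L.F₁ f ; cong = ∘-resp-≈ˡ }
  ; identity     = λ x → Equiv.trans (∘-resp-≈ʳ L.identity) identityʳ
  ; homomorphism = λ x → Equiv.trans (∘-resp-≈ʳ L.homomorphism) (Equiv.sym assoc)
  ; F-resp-≈     = λ p x → ∘-resp-≈ʳ (L.F-resp-≈ p)
  } where
    open Category D
    module L = Functor L

-- Generators of a Grothendieck topos

module _ (X : GrothendieckTopos) where
  open GrothendieckTopos X

  -- A sheafification of `Q` inside `X`. Its universal property follows from the two local
  -- conditions once nerves are sheaves.
  record Realization (L : Functor (Site.category site) category)
                     (Q : Functor (op (Site.category site)) Setoids) : Set₁ where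
    field
      object  : Obj
      include : NaturalTransformation Q (nerve L object)
    open LocalIsomorphism site include public using (LocallyInjective; LocallySurjective)
    field
      injective  : LocallyInjective
      surjective : LocallySurjective

-- Presents X by a family of generators indexed by its site, so that sections
-- of A over c become arrows L₀ c ⇒ A.
record Generators (X : GrothendieckTopos) : Set₁ where
  open GrothendieckTopos X
  field
    generator : Functor (Site.category site) category
  open Functor generator public renaming
    (F₀ to L₀; F₁ to L₁; identity to L-id; homomorphism to L-∘; F-resp-≈ to L-cong)

  N : Obj → Functor (op (Site.category site)) Setoids
  N = nerve generator

  field
    sheaf    : ∀ A → IsSheaf site (N A)
    faithful : ∀ {A B} {f g : A ⇒ B} → (∀ {c} (x : L₀ c ⇒ A) → f ∘ x ≈ g ∘ x) → f ≈ g
    full     : ∀ {A B} (k : NaturalTransformation (N A) (N B)) →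
               Σ[ f ∈ A ⇒ B ] (∀ {c} (x : L₀ c ⇒ A) → f ∘ x ≈ to (NaturalTransformation.η k c) x)
    realize  : ∀ Q → Realization X generator Q

-- A fully faithful functor to sheaves on the site. With `Sheafified` for every presheaf, this is
-- all that the construction of generators takes from the equivalence.
record SheafRepresentation (X : GrothendieckTopos) : Set₁ where
  open GrothendieckTopos X
  field
    P       : Obj → Functor (op (Site.category site)) Setoids
    sheaf   : ∀ A → IsSheaf site (P A)
    act     : ∀ {A B} → A ⇒ B → NaturalTransformation (P A) (P B)

  Sec : Obj → Site.Obj site → Set
  Sec A = Section site (P A)

  infix 4 _≈ˢ_
  _≈ˢ_ : ∀ {A c} → Sec A c → Sec A c → Set
  _≈ˢ_ {A} {c} = Setoid._≈_ (Functor.F₀ (P A) c)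

  infixr 9 _$_
  _$_ : ∀ {A B c} → A ⇒ B → Sec A c → Sec B c
  _$_ {c = c} f x = to (η (act f) c) x

  infixl 8 _∣ˢ_
  _∣ˢ_ : ∀ {A c d} → Sec A c → Site._⇒_ site d c → Sec A d
  _∣ˢ_ {A} x f = to (Functor.F₁ (P A) f) x

  field
    $-id     : ∀ {A c} (x : Sec A c) → id $ x ≈ˢ x
    $-∘      : ∀ {A B C c} (h : B ⇒ C) (g : A ⇒ B) (x : Sec A c) → (h ∘ g) $ x ≈ˢ h $ (g $ x)
    $-congˡ  : ∀ {A B c} {g h : A ⇒ B} → g ≈ h → (x : Sec A c) → g $ x ≈ˢ h $ x
    faithful : ∀ {A B} {f g : A ⇒ B} → (∀ {c} (x : Sec A c) → f $ x ≈ˢ g $ x) → f ≈ g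
    full     : ∀ {A B} (k : NaturalTransformation (P A) (P B)) →
               Σ[ f ∈ A ⇒ B ] (∀ {c} (x : Sec A c) → f $ x ≈ˢ to (η k c) x)

  record Sheafified (Q : Functor (op (Site.category site)) Setoids) : Set₁ where
    field
      object  : Obj
      ι       : NaturalTransformation Q (P object)
    open LocalIsomorphism site ι public using (LocallyInjective; LocallySurjective)
    field
      injective  : LocallyInjective
      surjective : LocallySurjective

module _ (X : GrothendieckTopos) where
  open GrothendieckTopos X
  private
    module S = Site site
    module S′ = LocalTruth site
    module Sh = Category (Sheaves site)
    module Φ = Functor (Equivalence.functor sheaves)
    open IsEquivalenceOfCategories (Equivalence.isEquivalence sheaves)
    module Ψ = Functor inverse
    module unit = NaturalIsomorphism unit
    module counit = NaturalIsomorphism counit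

    P : Obj → Functor (op S.category) Setoids
    P A = proj₁ (Φ.F₀ A)
    module P A = Functor (P A)
    module Pᵉ {A c} = Setoid (P.F₀ A c)

    Sec : Obj → S.Obj → Set
    Sec A = Section site (P A)

    infix 4 _≈ˢ_
    _≈ˢ_ : ∀ {A c} → Sec A c → Sec A c → Set
    _≈ˢ_ {A} {c} = Setoid._≈_ (P.F₀ A c)

    infixr 9 _$_
    _$_ : ∀ {A B c} → A ⇒ B → Sec A c → Sec B c
    _$_ {c = c} f x = to (η (Φ.F₁ f) c) x

    infixl 8 _∣ˢ_
    _∣ˢ_ : ∀ {A c d} → Sec A c → d S.⇒ c → Sec A d
    _∣ˢ_ {A} x f = to (P.F₁ A f) x

    faithfulΦ : ∀ {A B} {f g : A ⇒ B} → (∀ {c} (x : Sec A c) → f $ x ≈ˢ g $ x) → f ≈ g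
    faithfulΦ {A} {B} {f} {g} p = begin
      f                                          ≈⟨ roundtrip f ⟩
      unit.⇐.η B ∘ (Ψ.F₁ (Φ.F₁ f) ∘ unit.⇒.η A)  ≈⟨ ∘-resp-≈ʳ (∘-resp-≈ˡ (Ψ.F-resp-≈ λ c x → p x)) ⟩
      unit.⇐.η B ∘ (Ψ.F₁ (Φ.F₁ g) ∘ unit.⇒.η A)  ≈⟨ roundtrip g ⟨
      g                                          ∎
      where
      open HomReasoning
      roundtrip : ∀ h → h ≈ unit.⇐.η B ∘ (Ψ.F₁ (Φ.F₁ h) ∘ unit.⇒.η A)
      roundtrip h = Equiv.sym (Equiv.trans (∘-resp-≈ʳ (Equiv.sym (unit.⇒.commute h)))
        (Equiv.trans (Equiv.sym assoc) (Equiv.trans (∘-resp-≈ˡ (unit.isoˡ B)) identityˡ)))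

    -- An equivalence comes here without triangle identities, so the image of `f` is compared with
    -- `k` indirectly: naturality of the unit gives equality after `Ψ`, and conjugating with the
    -- counit removes `Ψ`.
    fullΦ : ∀ {A B} (k : NaturalTransformation (P A) (P B)) →
            Σ[ f ∈ A ⇒ B ] (∀ {c} (x : Sec A c) → f $ x ≈ˢ to (η k c) x)
    fullΦ {A} {B} k = f , λ {c} x →
      Pᵉ.trans (conjugate (Φ.F₁ f) x)
        (Pᵉ.trans (cong (η (counit.⇒.η (Φ.F₀ B)) c) (Φ.F-resp-≈ ΨΦf≈Ψk c _))
        (Pᵉ.sym (conjugate k x)))
      where
      f : A ⇒ B
      f = unit.⇐.η B ∘ (Ψ.F₁ k ∘ unit.⇒.η A)

      open HomReasoning

      ΨΦf≈Ψk : Ψ.F₁ (Φ.F₁ f) ≈ Ψ.F₁ k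
      ΨΦf≈Ψk = begin
        Ψ.F₁ (Φ.F₁ f)                                          ≈⟨ identityʳ ⟨
        Ψ.F₁ (Φ.F₁ f) ∘ id                                     ≈⟨ ∘-resp-≈ʳ (unit.isoʳ A) ⟨
        Ψ.F₁ (Φ.F₁ f) ∘ (unit.⇒.η A ∘ unit.⇐.η A)              ≈⟨ assoc ⟨
        (Ψ.F₁ (Φ.F₁ f) ∘ unit.⇒.η A) ∘ unit.⇐.η A              ≈⟨ ∘-resp-≈ˡ (unit.⇒.commute f) ⟨
        (unit.⇒.η B ∘ f) ∘ unit.⇐.η A                          ≈⟨ ∘-resp-≈ˡ assoc ⟨
        ((unit.⇒.η B ∘ unit.⇐.η B) ∘ (Ψ.F₁ k ∘ unit.⇒.η A)) ∘ unit.⇐.η A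
                                                               ≈⟨ ∘-resp-≈ˡ (∘-resp-≈ˡ (unit.isoʳ B)) ⟩
        (id ∘ (Ψ.F₁ k ∘ unit.⇒.η A)) ∘ unit.⇐.η A              ≈⟨ ∘-resp-≈ˡ identityˡ ⟩
        (Ψ.F₁ k ∘ unit.⇒.η A) ∘ unit.⇐.η A                     ≈⟨ assoc ⟩
        Ψ.F₁ k ∘ (unit.⇒.η A ∘ unit.⇐.η A)                     ≈⟨ ∘-resp-≈ʳ (unit.isoʳ A) ⟩
        Ψ.F₁ k ∘ id                                            ≈⟨ identityʳ ⟩
        Ψ.F₁ k                                                 ∎

      conjugate : ∀ (h : NaturalTransformation (P A) (P B)) {c} (x : Sec A c) →
                  to (η h c) x ≈ˢ
                  to (η (counit.⇒.η (Φ.F₀ B)) c) (to (η (Φ.F₁ (Ψ.F₁ h)) c) (to (η (counit.⇐.η (Φ.F₀ A)) c) x))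
      conjugate h {c} x = Pᵉ.sym (Pᵉ.trans (counit.⇒.commute {Φ.F₀ A} {Φ.F₀ B} h c _)
        (cong (η h c) (counit.isoʳ (Φ.F₀ A) c x)))

  module _ (Q : Functor (op S.category) Setoids) where
    open Sheafification site Q
    private
      G : Sh.Obj
      G = germs , germs-sheaf

      module Q = Functor Q

    open LocalIsomorphism using (LocallyInjective; LocallySurjective)

    germ-object : Obj
    germ-object = Ψ.F₀ G

    germ-unit : NaturalTransformation Q (P germ-object)
    germ-unit = record
      { η       = λ c → record
          { to   = λ x → to (η (counit.⇐.η G) c) (germ x)
          ; cong = λ {x} {y} p → cong (η (counit.⇐.η G) c) {germ x} {germ y} (germ-cong p)
          }
      ; commute = λ {c} {d} f x → Pᵉ.trans
          (cong (η (counit.⇐.η G) d) {germ (to (Q.F₁ f) x)} {to (Functor.F₁ germs f) (germ x)} (germ-∣ x f))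
          (commute (counit.⇐.η G) f (germ x))
      }

    germ-unit-injective : LocallyInjective site germ-unit
    germ-unit-injective {c} x y p = germ-injective λ {d} → trans {germ x} {roundtrip (germ x)} {germ y}
      (sym {roundtrip (germ x)} {germ x} (counit.isoʳ G c (germ x)))
      (trans {roundtrip (germ x)} {roundtrip (germ y)} {germ y}
        (cong (η (counit.⇒.η G) c) p) (counit.isoʳ G c (germ y)))
      where
      open Setoid (Functor.F₀ germs c)
      roundtrip : Germ c → Germ c
      roundtrip s = to (η (counit.⇒.η G) c) (to (η (counit.⇐.η G) c) s)

    germ-unit-surjective : LocallySurjective site germ-unit
    germ-unit-surjective {c} z = S′.mapLocal
      (λ {d} f (x , p) → x , Pᵉ.trans
        (cong (η (counit.⇐.η G) d) {germ x} {to (Functor.F₁ germs f) s} p)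
        (Pᵉ.trans (commute (counit.⇐.η G) f s) (cong (P.F₁ _ f) (counit.isoˡ G c z))))
      (germ-surjective s)
      where
      s : Germ c
      s = to (η (counit.⇒.η G) c) z

  sheafRepresentation : SheafRepresentation X
  sheafRepresentation = record
    { P        = P
    ; sheaf    = λ A → proj₂ (Φ.F₀ A)
    ; act      = Φ.F₁
    ; $-id     = Φ.identity _
    ; $-∘      = λ h g → Φ.homomorphism _
    ; $-congˡ  = λ p → Φ.F-resp-≈ p _
    ; faithful = faithfulΦ
    ; full     = fullΦ
    }

  open SheafRepresentation sheafRepresentation using (Sheafified)

  sheafified : ∀ Q → Sheafified Q
  sheafified Q = record
    { object = germ-object Q ; ι = germ-unit Q ; injective = germ-unit-injective Q ; surjective = germ-unit-surjective Q }

-- Sheafified representables as generators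

module GeneratorsOf (X : GrothendieckTopos) (representation : SheafRepresentation X)
                    (sheafified : ∀ Q → SheafRepresentation.Sheafified representation Q) where
  open GrothendieckTopos X
  private
    module S = Site site
    module S′ = LocalTruth site
    open SheafRepresentation representation
    module P A = Functor (P A)
    module Pᵉ {A c} = Setoid (P.F₀ A c)

    module _ (Q : Functor (op S.category) Setoids) where
      open Sheafified (sheafified Q) public
        renaming (object to sheafify; injective to ι-injective; surjective to ι-surjective)

    $-∣ : ∀ {A B c d} (h : A ⇒ B) (x : Sec A c) (f : d S.⇒ c) → h $ (x ∣ˢ f) ≈ˢ (h $ x) ∣ˢ f
    $-∣ h x f = commute (act h) f x

    $-congʳ : ∀ {A B c} (h : A ⇒ B) {x y : Sec A c} → x ≈ˢ y → h $ x ≈ˢ h $ y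
    $-congʳ {c = c} h = cong (η (act h) c)

  private
    sections : ∀ {A c} → Sec A c → NaturalTransformation (nerve idF c) (P A)
    sections {A} x = record
      { η       = λ d → record { to = λ h → x ∣ˢ h ; cong = λ p → P.F-resp-≈ A p x }
      ; commute = λ f h → P.homomorphism A x
      }

  -- By `represent` and `represent-unique`, arrows from this object to `A` correspond to sections of
  -- `A` over `c`, with `universal` as the generic section.
  generatorObj : S.Obj → Obj
  generatorObj c = sheafify (nerve idF c)

  universal : ∀ c → Sec (generatorObj c) c
  universal c = to (η (ι (nerve idF c)) c) S.id

  -- Every section of the sheafified representable is locally a restriction of the universal one,
  -- where `f` and `g` agree by assumption; `P A` is separated.
  represent-unique : ∀ {A c} {f g : generatorObj c ⇒ A} → f $ universal c ≈ˢ g $ universal c → f ≈ g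
  represent-unique {A} {c} {f} {g} p = faithful λ w →
    locally-≈ (S′.mapLocal (λ k (h , q) → Pᵉ.trans (Pᵉ.sym ($-∣ f w k))
        (Pᵉ.trans ($-congʳ f (Pᵉ.sym (Pᵉ.trans (generated h) q)))
        (Pᵉ.trans (agree h) (Pᵉ.trans ($-congʳ g (Pᵉ.trans (generated h) q)) ($-∣ g w k)))))
      (ι-surjective (nerve idF c) w))
    where
    open S′.Descent (P A) (sheaf A)

    generated : ∀ {d} (h : d S.⇒ c) → universal c ∣ˢ h ≈ˢ to (η (ι (nerve idF c)) d) h
    generated {d} h = Pᵉ.trans (Pᵉ.sym (commute (ι (nerve idF c)) h S.id))
      (cong (η (ι (nerve idF c)) d) S.identityˡ)

    agree : ∀ {d} (h : d S.⇒ c) → f $ (universal c ∣ˢ h) ≈ˢ g $ (universal c ∣ˢ h)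
    agree h = Pᵉ.trans ($-∣ f _ h) (Pᵉ.trans (cong (P.F₁ A h) p) (Pᵉ.sym ($-∣ g _ h)))

  abstract
    represent : ∀ {A c} (x : Sec A c) → Σ[ f ∈ generatorObj c ⇒ A ] f $ universal c ≈ˢ x
    represent {A} {c} x =
      let f , p = full extend in
      f , Pᵉ.trans (p (universal c)) (Pᵉ.trans (extend-inc S.id) (P.identity A x))
      where
      open LocalIsomorphism.Extension site (ι (nerve idF c))
        (ι-injective (nerve idF c)) (ι-surjective (nerve idF c)) (P A) (sheaf A) (sections x)

  private
    rep : ∀ {A c} → Sec A c → generatorObj c ⇒ A
    rep x = proj₁ (represent x)

    rep-$ : ∀ {A c} (x : Sec A c) → rep x $ universal c ≈ˢ x
    rep-$ x = proj₂ (represent x)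

    L : Functor S.category category
    L = record
      { F₀           = generatorObj
      ; F₁           = λ {c} {d} f → rep (universal d ∣ˢ f)
      ; identity     = λ {c} → represent-unique (Pᵉ.trans (rep-$ _)
          (Pᵉ.trans (P.identity _ _) (Pᵉ.sym ($-id _))))
      ; homomorphism = λ {_} {_} {e} {f} {g} → represent-unique (Pᵉ.trans (rep-$ _)
          (Pᵉ.trans (P.homomorphism _ (universal e)) (Pᵉ.trans (cong (P.F₁ _ f) (Pᵉ.sym (rep-$ _)))
          (Pᵉ.trans (Pᵉ.sym ($-∣ _ _ f)) (Pᵉ.trans ($-congʳ _ (Pᵉ.sym (rep-$ _))) (Pᵉ.sym ($-∘ _ _ _)))))))
      ; F-resp-≈     = λ {_} {d} p → represent-unique (Pᵉ.trans (rep-$ _)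
          (Pᵉ.trans (P.F-resp-≈ _ p (universal d)) (Pᵉ.sym (rep-$ _))))
      }

    at : ∀ {A c} → generatorObj c ⇒ A → Sec A c
    at {c = c} x = x $ universal c

    at-∘L : ∀ {A c d} (x : generatorObj c ⇒ A) (f : d S.⇒ c) → at (x ∘ Functor.F₁ L f) ≈ˢ at x ∣ˢ f
    at-∘L x f = Pᵉ.trans ($-∘ _ _ _) (Pᵉ.trans ($-congʳ x (rep-$ _)) ($-∣ x _ f))

  generators : Generators X
  generators = record
    { generator = L
    ; sheaf     = λ A u s compatible →
        let x , amalgamates , unique = sheaf A u (λ i → at (s i)) (λ i j a b p →
              Pᵉ.trans (Pᵉ.sym (at-∘L (s i) a)) (Pᵉ.trans ($-congˡ (compatible i j a b p) _) (at-∘L (s j) b)))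
        in rep x
         , (λ i → represent-unique (Pᵉ.trans (at-∘L (rep x) _)
             (Pᵉ.trans (cong (P.F₁ A _) (rep-$ x)) (amalgamates i))))
         , (λ y q → represent-unique (Pᵉ.trans (rep-$ x) (unique (at y)
             (λ i → Pᵉ.trans (Pᵉ.sym (at-∘L y _)) ($-congˡ (q i) _)))))
    ; faithful  = λ {A} {B} {f} {g} p → faithful λ x →
        Pᵉ.trans ($-congʳ f (Pᵉ.sym (rep-$ x))) (Pᵉ.trans (Pᵉ.sym ($-∘ f _ _))
          (Pᵉ.trans ($-congˡ (p (rep x)) _) (Pᵉ.trans ($-∘ g _ _) ($-congʳ g (rep-$ x)))))
    ; full      = λ {A} {B} k →
        let f , p = full (record
              { η       = λ c → record
                  { to   = λ x → at (to (η k c) (rep x))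
                  ; cong = λ q → $-congˡ (cong (η k c) (represent-unique
                      (Pᵉ.trans (rep-$ _) (Pᵉ.trans q (Pᵉ.sym (rep-$ _)))))) _
                  }
              ; commute = λ {c} {d} g x → Pᵉ.trans
                  ($-congˡ (Equiv.trans (cong (η k d) (represent-unique (Pᵉ.trans (rep-$ _)
                      (Pᵉ.trans (cong (P.F₁ A g) (Pᵉ.sym (rep-$ x))) (Pᵉ.sym (at-∘L (rep x) g))))))
                    (commute k g (rep x))) _)
                  (at-∘L _ g)
              })
        in f , λ {c} x → represent-unique (Pᵉ.trans ($-∘ f x _) (Pᵉ.trans (p (at x))
          ($-congˡ (cong (η k c) (represent-unique (rep-$ (at x)))) _)))
    ; realize   = λ Q → record
        { object     = sheafify Q
        ; include    = record
            { η       = λ c → record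
                { to   = λ x → rep (to (η (ι Q) c) x)
                ; cong = λ p → represent-unique (Pᵉ.trans (rep-$ _)
                    (Pᵉ.trans (cong (η (ι Q) c) p) (Pᵉ.sym (rep-$ _))))
                }
            ; commute = λ f x → represent-unique (Pᵉ.trans (rep-$ _) (Pᵉ.trans (commute (ι Q) f x)
                (Pᵉ.trans (cong (P.F₁ _ f) (Pᵉ.sym (rep-$ _))) (Pᵉ.sym (at-∘L _ f)))))
            }
        ; injective  = λ x y p → ι-injective Q x y
            (Pᵉ.trans (Pᵉ.sym (rep-$ _)) (Pᵉ.trans ($-congˡ p _) (rep-$ _)))
        ; surjective = λ z → S′.mapLocal
            (λ f (x , p) → x , represent-unique (Pᵉ.trans (rep-$ _) (Pᵉ.trans p (Pᵉ.sym (at-∘L z f)))))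
            (ι-surjective Q (at z))
        }
    }

generators : ∀ X → Generators X
generators X = GeneratorsOf.generators X (sheafRepresentation X) (sheafified X)

-- Jointly monic and jointly epic families and equalizers through generator points

module GeneratedTopos {X : GrothendieckTopos} (generated : Generators X) where
  open GrothendieckTopos X
  open Generators generated public
  open LocalTruth site
  private module S = Site site

  reassoc : ∀ {A B c d} {h : A ⇒ B} {x : L₀ c ⇒ A} {y : L₀ d ⇒ L₀ c} {z : L₀ d ⇒ A} →
            x ∘ y ≈ z → (h ∘ x) ∘ y ≈ h ∘ z
  reassoc p = Equiv.trans assoc (∘-resp-≈ʳ p)

  L-triangle : ∀ {A c d e} {x : L₀ c ⇒ A} {f : d S.⇒ c} {g : e S.⇒ d} {h : e S.⇒ c} →
               f S.∘ g S.≈ h → (x ∘ L₁ f) ∘ L₁ g ≈ x ∘ L₁ h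
  L-triangle p = reassoc (Equiv.trans (Equiv.sym L-∘) (L-cong p))

  ∘L-id : ∀ {A c} {x : L₀ c ⇒ A} → x ∘ L₁ S.id ≈ x
  ∘L-id = Equiv.trans (∘-resp-≈ʳ L-id) identityʳ

  locally-equal : ∀ {A c} {x y : L₀ c ⇒ A} →
                  Local (λ f → x ∘ L₁ f ≈ y ∘ L₁ f) (S.id {c}) → x ≈ y
  locally-equal {A} = Descent.locally-≈ (N A) (sheaf A)

  module _ {I : Set} {T : Obj} {A : I → Obj} (g : ∀ i → T ⇒ A i) where

    JointlyMonic : Set
    JointlyMonic = ∀ {c} (z z′ : L₀ c ⇒ T) → (∀ i → g i ∘ z ≈ g i ∘ z′) → z ≈ z′

    jointlyMonic⇒unique : JointlyMonic → ∀ {U} {h k : U ⇒ T} → (∀ i → g i ∘ h ≈ g i ∘ k) → h ≈ k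
    jointlyMonic⇒unique monic p = faithful λ x → monic _ _ λ i →
      Equiv.trans (Equiv.sym assoc) (Equiv.trans (∘-resp-≈ˡ (p i)) assoc)

    -- Unique choice: joint monicity makes the local solutions at a generator point unique, so they
    -- descend, and it makes the resulting assignment natural. Fullness then turns it into an arrow.
    lift : JointlyMonic → ∀ {U} (h : ∀ i → U ⇒ A i) →
           (∀ {c} (x : L₀ c ⇒ U) →
             Local (λ {d} f → Σ[ z ∈ L₀ d ⇒ T ] (∀ i → g i ∘ z ≈ h i ∘ (x ∘ L₁ f))) (S.id {c})) →
           Σ[ k ∈ U ⇒ T ] (∀ i → g i ∘ k ≈ h i)
    lift monic {U} h local =
      let k , p = full record
            { η       = λ c → record
                { to   = λ x → proj₁ (pointwise x)
                ; cong = λ q → monic _ _ λ i → Equiv.trans (proj₂ (pointwise _) i)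
                    (Equiv.trans (∘-resp-≈ʳ q) (Equiv.sym (proj₂ (pointwise _) i)))
                }
            ; commute = λ f x → monic _ _ λ i → Equiv.trans (proj₂ (pointwise _) i)
                (Equiv.trans (Equiv.sym assoc) (Equiv.trans
                  (∘-resp-≈ˡ (Equiv.sym (proj₂ (pointwise x) i))) assoc))
            }
      in k , λ i → faithful λ x → Equiv.trans assoc (Equiv.trans (∘-resp-≈ʳ (p x)) (proj₂ (pointwise x) i))
      where
      module _ {c} (x : L₀ c ⇒ U) where
        Lifts : ∀ {d} → d S.⇒ c → L₀ d ⇒ T → Set
        Lifts f z = ∀ i → g i ∘ z ≈ h i ∘ (x ∘ L₁ f)

        descended : Σ[ z ∈ L₀ c ⇒ T ] Lifts S.id z
        descended = Descent.descend (N T) (sheaf T) Lifts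
          (λ k p q r i → Equiv.trans (∘-resp-≈ʳ (Equiv.sym q)) (Equiv.trans (Equiv.sym assoc)
            (Equiv.trans (∘-resp-≈ˡ (r i)) (reassoc (L-triangle p)))))
          (λ r s → monic _ _ λ i → Equiv.trans (r i) (Equiv.sym (s i)))
          (λ u r i → Descent.separated (N (A i)) (sheaf (A i)) u λ j →
            Equiv.trans assoc (Equiv.trans (r j i) (Equiv.sym (reassoc (L-triangle S.Equiv.refl)))))
          (local x)

        pointwise : Σ[ z ∈ L₀ c ⇒ T ] (∀ i → g i ∘ z ≈ h i ∘ x)
        pointwise = proj₁ descended , λ i → Equiv.trans (proj₂ descended i) (∘-resp-≈ʳ ∘L-id)

  module _ {Q : Functor (op S.category) Setoids} (R : Realization X generator Q) where
    private module R = Realization R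

    inc : ∀ {c} → Section site Q c → L₀ c ⇒ R.object
    inc {c} = to (η R.include c)

    extend : ∀ {A} (g : NaturalTransformation Q (N A)) →
             Σ[ f ∈ R.object ⇒ A ] (∀ {c} (q : Section site Q c) → f ∘ inc q ≈ to (η g c) q)
    extend {A} g =
      let f , p = full E.extend in f , λ q → Equiv.trans (p (inc q)) (E.extend-inc q)
      where module E = LocalIsomorphism.Extension site R.include R.injective R.surjective (N A) (sheaf A) g

    extend-unique : ∀ {A} {f g : R.object ⇒ A} →
                    (∀ {c} (q : Section site Q c) → f ∘ inc q ≈ g ∘ inc q) → f ≈ g
    extend-unique p = faithful λ z → locally-equal (mapLocal
      (λ f (q , e) → Equiv.trans (reassoc (Equiv.sym e)) (Equiv.trans (p q) (Equiv.sym (reassoc (Equiv.sym e)))))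
      (R.surjective z))

    surjective₂ : ∀ {c} (z z′ : L₀ c ⇒ R.object) →
                  Local (λ {d} f → Σ[ q ∈ Section site Q d ] Σ[ q′ ∈ Section site Q d ]
                    (inc q ≈ z ∘ L₁ f) × (inc q′ ≈ z′ ∘ L₁ f)) (S.id {c})
    surjective₂ z z′ = R.surjective z >>= λ f (q , e) → mapLocal
      (λ g (q′ , e′) → to (Functor.F₁ Q g) q , q′
        , Equiv.trans (commute R.include g q) (Equiv.trans (∘-resp-≈ˡ e) (L-triangle S.Equiv.refl))
        , Equiv.trans e′ (L-triangle S.Equiv.refl))
      (R.surjective (z′ ∘ L₁ f))

  module _ {I : Set} {V : I → Obj} {U : Obj} (p : ∀ i → V i ⇒ U) where

    Hit : ∀ {c} → L₀ c ⇒ U → Set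
    Hit {c} x = Σ[ i ∈ I ] Σ[ y ∈ L₀ c ⇒ V i ] p i ∘ y ≈ x

    LocallySurjective : Set
    LocallySurjective = ∀ {c} (x : L₀ c ⇒ U) → Local (λ f → Hit (x ∘ L₁ f)) (S.id {c})

    locallySurjective⇒jointlyEpic : LocallySurjective → JointlyEpic category p
    locallySurjective⇒jointlyEpic surjective f g agree = faithful λ x → locally-equal (mapLocal
      (λ h (i , y , e) → Equiv.trans (reassoc (Equiv.sym e)) (Equiv.trans (Equiv.sym assoc)
        (Equiv.trans (∘-resp-≈ˡ (agree i)) (Equiv.trans assoc (Equiv.sym (reassoc (Equiv.sym e)))))))
      (surjective x))

    -- The two inclusions into two copies of U glued along the image of p agree
    -- when p is jointly epic, and then all of U is locally in the image.
    jointlyEpic⇒locallySurjective : JointlyEpic category p → LocallySurjective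
    -- Injectivity yields, locally, either equal tags or a hit. The tags are `true` and `false`, so
    -- only the hit remains.
    jointlyEpic⇒locallySurjective epic x = mapLocal (λ f → λ where (_ , inj₂ hit) → hit)
      (R.injective (true , x) (false , x)
        (Equiv.trans (Equiv.sym (proj₂ (copy true) x)) (Equiv.trans
          (∘-resp-≈ˡ (epic (proj₁ (copy true)) (proj₁ (copy false)) λ i → faithful λ y →
            Equiv.trans assoc (Equiv.trans (proj₂ (copy true) _) (Equiv.trans
              (cong (η R.include _) (Equiv.refl , inj₂ (i , y , Equiv.refl)))
              (Equiv.sym (Equiv.trans assoc (proj₂ (copy false) _)))))))
          (proj₂ (copy false) x))))
      where
      hit-cong : ∀ {c} {y z : L₀ c ⇒ U} → y ≈ z → Hit y → Hit z
      hit-cong e (i , y , q) = i , y , Equiv.trans q e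

      doubled : Functor (op S.category) Setoids
      doubled = record
        { F₀           = λ c → record
            { Carrier       = Bool × (L₀ c ⇒ U)
            ; _≈_           = λ (b , y) (b′ , z) → y ≈ z × (b ≡ b′ ⊎ Hit y)
            ; isEquivalence = record
                { refl  = Equiv.refl , inj₁ ≡.refl
                ; sym   = λ where
                    (e , inj₁ q) → Equiv.sym e , inj₁ (≡.sym q)
                    (e , inj₂ h) → Equiv.sym e , inj₂ (hit-cong e h)
                ; trans = λ where
                    (e , inj₁ q) (e′ , inj₁ q′) → Equiv.trans e e′ , inj₁ (≡.trans q q′)
                    (e , inj₁ q) (e′ , inj₂ h)  → Equiv.trans e e′ , inj₂ (hit-cong (Equiv.sym e) h)
                    (e , inj₂ h) (e′ , _)       → Equiv.trans e e′ , inj₂ h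
                }
            }
        ; F₁           = λ f → record
            { to   = λ (b , y) → b , y ∘ L₁ f
            ; cong = λ where
                (e , inj₁ q)           → ∘-resp-≈ˡ e , inj₁ q
                (e , inj₂ (i , y , q)) → ∘-resp-≈ˡ e , inj₂ (i , y ∘ L₁ f , Equiv.trans (Equiv.sym assoc) (∘-resp-≈ˡ q))
            }
        ; identity     = λ _ → ∘L-id , inj₁ ≡.refl
        ; homomorphism = λ _ → Equiv.sym (L-triangle S.Equiv.refl) , inj₁ ≡.refl
        ; F-resp-≈     = λ q _ → ∘-resp-≈ʳ (L-cong q) , inj₁ ≡.refl
        }

      module R = Realization (realize doubled)

      copy : ∀ b → Σ[ f ∈ U ⇒ R.object ] (∀ {c} (y : L₀ c ⇒ U) → f ∘ y ≈ to (η R.include c) (b , y))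
      copy b = full record
        { η       = λ c → record
            { to   = λ y → to (η R.include c) (b , y)
            ; cong = λ e → cong (η R.include c) (e , inj₁ ≡.refl)
            }
        ; commute = λ f y → commute R.include f (b , y)
        }

  record Equalizer {A B : Obj} (f g : A ⇒ B) : Set₁ where
    field
      object      : Obj
      arrow       : object ⇒ A
      isEqualizer : IsEqualizer category arrow f g
    open IsEqualizer isEqualizer public

  -- Realizes the presheaf of those sections of `A` on which `f` and `g` agree. For two polynomial
  -- maps between powers of a lattice, this is the stage at which the premise of flatness holds
  -- universally.
  equalizer : ∀ {A B} (f g : A ⇒ B) → Equalizer f g
  equalizer {A} {B} f g = record
    { object      = R.object
    ; arrow       = m
    ; isEqualizer = record
        { equality  = extend-unique (realize agreement) λ (x , e) → Equiv.trans assoc (Equiv.trans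
            (∘-resp-≈ʳ (m-inc (x , e))) (Equiv.trans e (Equiv.sym (Equiv.trans assoc (∘-resp-≈ʳ (m-inc (x , e)))))))
        ; equalize  = λ p → proj₁ (factor p)
        ; universal = λ {_} {_} {p} → proj₂ (factor p) zero
        ; unique    = λ {_} {_} {p} q → jointlyMonic⇒unique (λ (_ : Single) → m) monic
            λ i → Equiv.trans (proj₂ (factor p) i) (Equiv.sym q)
        }
    } where
    Single : Set
    Single = Fin 1

    agreement : Functor (op S.category) Setoids
    agreement = record
      { F₀           = λ c → record
          { Carrier       = Σ[ x ∈ L₀ c ⇒ A ] f ∘ x ≈ g ∘ x
          ; _≈_           = λ (x , _) (y , _) → x ≈ y
          ; isEquivalence = record { refl = Equiv.refl ; sym = Equiv.sym ; trans = Equiv.trans }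
          }
      ; F₁           = λ h → record
          { to   = λ (x , e) → x ∘ L₁ h , Equiv.trans (Equiv.sym assoc) (Equiv.trans (∘-resp-≈ˡ e) assoc)
          ; cong = ∘-resp-≈ˡ
          }
      ; identity     = λ _ → ∘L-id
      ; homomorphism = λ _ → Equiv.sym (L-triangle S.Equiv.refl)
      ; F-resp-≈     = λ q _ → ∘-resp-≈ʳ (L-cong q)
      }

    module R = Realization (realize agreement)

    inclusion : Σ[ m ∈ R.object ⇒ A ] (∀ {c} q → m ∘ inc (realize agreement) {c} q ≈ proj₁ q)
    inclusion = extend (realize agreement) record
      { η       = λ c → record { to = proj₁ ; cong = λ p → p }
      ; commute = λ _ _ → Equiv.refl
      }

    m = proj₁ inclusion
    m-inc = proj₂ inclusion

    monic : JointlyMonic (λ (_ : Single) → m)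
    monic z z′ p = locally-equal (mapLocal
      (λ h (q , q′ , e , e′) → Equiv.trans (Equiv.sym e) (Equiv.trans
        (cong (η R.include _) (Equiv.trans (Equiv.sym (m-inc q)) (Equiv.trans (∘-resp-≈ʳ e)
          (Equiv.trans (Equiv.sym assoc) (Equiv.trans (∘-resp-≈ˡ (p zero))
          (Equiv.trans assoc (Equiv.trans (∘-resp-≈ʳ (Equiv.sym e′)) (m-inc q′))))))))
        e′))
      (surjective₂ (realize agreement) z z′))

    factor : ∀ {U} {h : U ⇒ A} → f ∘ h ≈ g ∘ h → Σ[ k ∈ U ⇒ R.object ] ((i : Single) → m ∘ k ≈ h)
    factor {h = h} p = lift (λ _ → m) monic (λ _ → h) λ x → now
      ( inc (realize agreement) (h ∘ (x ∘ L₁ S.id) ,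
          Equiv.trans (Equiv.sym assoc) (Equiv.trans (∘-resp-≈ˡ p) assoc))
      , λ i → m-inc _ )

-- Finite powers of an object

module Power (X : GrothendieckTopos) (A : GrothendieckTopos.Obj X) where
  open GrothendieckTopos X

  power : ℕ → Obj
  power zero    = 𝟏
  power (suc n) = A ⊗ power n

  proj : ∀ {n} → Fin n → power n ⇒ A
  proj zero    = π₁
  proj (suc i) = proj i ∘ π₂

  tuple : ∀ {n U} → (Fin n → U ⇒ A) → U ⇒ power n
  tuple {zero}  x = !
  tuple {suc n} x = ⟨ x zero , tuple (λ i → x (suc i)) ⟩

  proj-tuple : ∀ {n U} (x : Fin n → U ⇒ A) (i : Fin n) → proj i ∘ tuple x ≈ x i
  proj-tuple x zero    = project₁
  proj-tuple x (suc i) = Equiv.trans assoc (Equiv.trans (∘-resp-≈ʳ project₂) (proj-tuple _ i))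

  power-ext : ∀ n {U} {x y : U ⇒ power n} → (∀ (i : Fin n) → proj i ∘ x ≈ proj i ∘ y) → x ≈ y
  power-ext zero    p = Equiv.trans (Equiv.sym (!-unique _)) (!-unique _)
  power-ext (suc n) p = Equiv.trans (Equiv.sym (unique Equiv.refl Equiv.refl))
    (unique (Equiv.sym (p zero)) (Equiv.sym (power-ext n λ i →
      Equiv.trans (Equiv.sym assoc) (Equiv.trans (p (suc i)) assoc))))

-- Polynomials under homomorphisms and inverse images

module _ {c ℓ} (L : RawBoundedLattice c ℓ) (isBDL : IsBoundedDistributiveLattice L) where
  open RawBoundedLattice L
  private module D = IsBoundedDistributiveLattice isBDL

  eval-[] : ∀ {n m} (t : Term n) (γ : Kleisli n m) (ρ : Fin m → Carrier) →
            eval L (t [ γ ]) ρ ≈ eval L t (λ i → eval L (γ i) ρ)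
  eval-[] (var i)  γ ρ = D.refl
  eval-[] ⊤ᵗ       γ ρ = D.refl
  eval-[] ⊥ᵗ       γ ρ = D.refl
  eval-[] (s ∨ᵗ t) γ ρ = D.∨-cong (eval-[] s γ ρ) (eval-[] t γ ρ)
  eval-[] (s ∧ᵗ t) γ ρ = D.∧-cong (eval-[] s γ ρ) (eval-[] t γ ρ)

module Evaluation (X : GrothendieckTopos) where
  open GrothendieckTopos X

  binary-∘ : ∀ {A B U V} {m : (A ⊗ A) ⇒ B} {x y : U ⇒ A} {h : V ⇒ U} →
             (m ∘ ⟨ x , y ⟩) ∘ h ≈ m ∘ ⟨ x ∘ h , y ∘ h ⟩
  binary-∘ = Equiv.trans assoc (∘-resp-≈ʳ ⟨⟩-∘)

  nullary-∘ : ∀ {B U V} {t : 𝟏 ⇒ B} {h : V ⇒ U} → (t ∘ !) ∘ h ≈ t ∘ !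
  nullary-∘ = Equiv.trans assoc (∘-resp-≈ʳ (Equiv.sym (!-unique _)))

  module _ (D : InternalDL X) where
    open InternalDL D

    evalᴰ : ∀ {n U} → Term n → (Fin n → U ⇒ carrier) → U ⇒ carrier
    evalᴰ = eval (generalizedElements _)

    eval-∘ : ∀ {n U V} (t : Term n) (d : Fin n → U ⇒ carrier) (h : V ⇒ U) →
             evalᴰ t d ∘ h ≈ evalᴰ t (λ i → d i ∘ h)
    eval-∘ (var i)  d h = Equiv.refl
    eval-∘ ⊤ᵗ       d h = nullary-∘
    eval-∘ ⊥ᵗ       d h = nullary-∘
    eval-∘ (s ∨ᵗ t) d h = Equiv.trans binary-∘ (∘-resp-≈ʳ (⟨⟩-cong (eval-∘ s d h) (eval-∘ t d h)))
    eval-∘ (s ∧ᵗ t) d h = Equiv.trans binary-∘ (∘-resp-≈ʳ (⟨⟩-cong (eval-∘ s d h) (eval-∘ t d h)))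

    evalᴰ-cong : ∀ {n U} (t : Term n) {d e : Fin n → U ⇒ carrier} → (∀ i → d i ≈ e i) → evalᴰ t d ≈ evalᴰ t e
    evalᴰ-cong t = eval-cong _ (isBDL _) t

    evalᴰ-sound : ∀ {n U} {s t : Term n} → s ≋ t → (d : Fin n → U ⇒ carrier) → evalᴰ s d ≈ evalᴰ t d
    evalᴰ-sound p d = eval-sound _ (isBDL _) p d

    evalᴰ-[] : ∀ {n m U} (t : Term n) (γ : Kleisli n m) (d : Fin m → U ⇒ carrier) →
               evalᴰ (t [ γ ]) d ≈ evalᴰ t (γ · d)
    evalᴰ-[] t γ d = eval-[] _ (isBDL _) t γ d

  module _ {D E : InternalDL X} (f : LatticeHom X D E) where
    private
      module D = InternalDL D
      module E = InternalDL E
    open LatticeHom f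

    preserves-binary : ∀ {m : (D.carrier ⊗ D.carrier) ⇒ D.carrier} {m′ : (E.carrier ⊗ E.carrier) ⇒ E.carrier} →
                       hom ∘ m ≈ m′ ∘ ⟨ hom ∘ π₁ , hom ∘ π₂ ⟩ → ∀ {U} {x y : U ⇒ D.carrier} →
                       hom ∘ (m ∘ ⟨ x , y ⟩) ≈ m′ ∘ ⟨ hom ∘ x , hom ∘ y ⟩
    preserves-binary p = Equiv.trans (Equiv.sym assoc) (Equiv.trans (∘-resp-≈ˡ p)
      (Equiv.trans binary-∘ (∘-resp-≈ʳ (⟨⟩-cong
        (Equiv.trans assoc (∘-resp-≈ʳ project₁)) (Equiv.trans assoc (∘-resp-≈ʳ project₂))))))

    eval-hom : ∀ {n U} (t : Term n) (d : Fin n → U ⇒ D.carrier) →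
               hom ∘ evalᴰ D t d ≈ evalᴰ E t (λ i → hom ∘ d i)
    eval-hom (var i)  d = Equiv.refl
    eval-hom ⊤ᵗ       d = Equiv.trans (Equiv.sym assoc) (∘-resp-≈ˡ preserve-top)
    eval-hom ⊥ᵗ       d = Equiv.trans (Equiv.sym assoc) (∘-resp-≈ˡ preserve-bot)
    eval-hom (s ∨ᵗ t) d = Equiv.trans (preserves-binary preserve-join)
      (∘-resp-≈ʳ (⟨⟩-cong (eval-hom s d) (eval-hom t d)))
    eval-hom (s ∧ᵗ t) d = Equiv.trans (preserves-binary preserve-meet)
      (∘-resp-≈ʳ (⟨⟩-cong (eval-hom s d) (eval-hom t d)))

module InverseImage {X Y : GrothendieckTopos} (G : GeometricMorphism Y X) where
  private
    module X = GrothendieckTopos X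
    module P {A B : X.Obj} = IsProduct
      (PreservesFiniteLimits.product (GeometricMorphism.leftExact G) (X.isProduct {A} {B}))
    module T = IsTerminal
      (PreservesFiniteLimits.terminal (GeometricMorphism.leftExact G) X.isTerminal)
  open GrothendieckTopos Y
  open GeometricMorphism G public
  open Functor inverseImage public
  open _⊣_ adjoint public
  open Evaluation Y using (evalᴰ)

  F-triangle : ∀ {A B C U} {f : B X.⇒ C} {g : A X.⇒ B} {h : A X.⇒ C} {x : U ⇒ F₀ A} →
               f X.∘ g X.≈ h → F₁ f ∘ (F₁ g ∘ x) ≈ F₁ h ∘ x
  F-triangle p = Equiv.trans (Equiv.sym assoc)
    (∘-resp-≈ˡ (Equiv.trans (Equiv.sym homomorphism) (F-resp-≈ p)))

  private
    binary : ∀ {A B : X.Obj} (m : (A X.⊗ A) X.⇒ B) {V U} {h : U ⇒ F₀ V} {a b : V X.⇒ A} →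
             (F₁ m ∘ P.⟨ π₁ , π₂ ⟩) ∘ ⟨ F₁ a ∘ h , F₁ b ∘ h ⟩ ≈ F₁ (m X.∘ X.⟨ a , b ⟩) ∘ h
    binary m = Equiv.trans assoc (Equiv.trans
      (∘-resp-≈ʳ (Equiv.trans P.⟨⟩-∘ (Equiv.trans (P.⟨⟩-cong project₁ project₂)
        (P.unique (F-triangle X.project₁) (F-triangle X.project₂)))))
      (F-triangle X.Equiv.refl))

    nullary : ∀ {B : X.Obj} (t : X.𝟏 X.⇒ B) {V U} {h : U ⇒ F₀ V} →
              (F₁ t ∘ T.!) ∘ ! ≈ F₁ (t X.∘ X.!) ∘ h
    nullary t = Equiv.trans assoc (Equiv.trans
      (∘-resp-≈ʳ (Equiv.trans (Equiv.sym (T.!-unique _)) (T.!-unique _)))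
      (F-triangle X.Equiv.refl))

  -- A stage `U` need not be of the form `F₀ V`, so the tuple is written through an arrow
  -- `h : U ⇒ F₀ V`. Every tuple has this form with `V` a power of the carrier.
  eval-inverseImage : ∀ (D : InternalDL X) {n V U} (t : Term n) (a : Fin n → V X.⇒ InternalDL.carrier D)
                      (h : U ⇒ F₀ V) →
                      evalᴰ (inverseImageDL G D) t (λ i → F₁ (a i) ∘ h) ≈ F₁ (Evaluation.evalᴰ X D t a) ∘ h
  eval-inverseImage D (var i)  a h = Equiv.refl
  eval-inverseImage D ⊤ᵗ       a h = nullary (InternalDL.top D)
  eval-inverseImage D ⊥ᵗ       a h = nullary (InternalDL.bot D)
  eval-inverseImage D (s ∨ᵗ t) a h = Equiv.trans
    (∘-resp-≈ʳ (⟨⟩-cong (eval-inverseImage D s a h) (eval-inverseImage D t a h))) (binary (InternalDL.join D))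
  eval-inverseImage D (s ∧ᵗ t) a h = Equiv.trans
    (∘-resp-≈ʳ (⟨⟩-cong (eval-inverseImage D s a h) (eval-inverseImage D t a h))) (binary (InternalDL.meet D))

  φ-∘ : ∀ {A A′ B} (f : F₀ A ⇒ B) (h : A′ X.⇒ A) → φ (f ∘ F₁ h) X.≈ φ f X.∘ h
  φ-∘ f h = X.Equiv.trans (φ-cong (Equiv.sym identityˡ)) (X.Equiv.trans (φ-nat h f id)
    (X.Equiv.trans (X.∘-resp-≈ˡ (Functor.identity directImage)) X.identityˡ))

  φ-injective : ∀ {A B} {f g : F₀ A ⇒ B} → φ f X.≈ φ g → f ≈ g
  φ-injective p = Equiv.trans (Equiv.sym (ψφ _)) (Equiv.trans (ψ-cong p) (ψφ _))

  -- Left adjoints preserve joint epimorphy: transposition turns a test pair out of `F₀ U` into a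
  -- test pair out of `U`.
  jointlyEpic : ∀ {i} {I : Set i} {V : I → X.Obj} {U : X.Obj} (p : ∀ i → V i X.⇒ U) →
                JointlyEpic X.category p → JointlyEpic category (λ i → F₁ (p i))
  jointlyEpic p epic f g agree = φ-injective (epic (φ f) (φ g) λ i →
    X.Equiv.trans (X.Equiv.sym (φ-∘ f (p i))) (X.Equiv.trans (φ-cong (agree i)) (φ-∘ g (p i))))

  module _ (A : X.Obj) where
    open Power X A

    -- Built from the preserved product cones, so the image of a power serves directly as a power,
    -- with no comparison isomorphism to powers chosen in `Y`.
    tupleᶠ : ∀ {n U} → (Fin n → U ⇒ F₀ A) → U ⇒ F₀ (power n)
    tupleᶠ {zero}  x = T.!
    tupleᶠ {suc n} x = P.⟨ x zero , tupleᶠ (λ i → x (suc i)) ⟩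

    proj-tupleᶠ : ∀ {n U} (x : Fin n → U ⇒ F₀ A) (i : Fin n) → F₁ (proj i) ∘ tupleᶠ x ≈ x i
    proj-tupleᶠ x zero    = P.project₁
    proj-tupleᶠ x (suc i) = Equiv.trans (Equiv.sym (F-triangle X.Equiv.refl))
      (Equiv.trans (∘-resp-≈ʳ P.project₂) (proj-tupleᶠ _ i))

    power-extᶠ : ∀ n {U} {x y : U ⇒ F₀ (power n)} →
                 (∀ (i : Fin n) → F₁ (proj i) ∘ x ≈ F₁ (proj i) ∘ y) → x ≈ y
    power-extᶠ zero    p = Equiv.trans (Equiv.sym (T.!-unique _)) (T.!-unique _)
    power-extᶠ (suc n) p = Equiv.trans (Equiv.sym (P.unique Equiv.refl Equiv.refl))
      (P.unique (Equiv.sym (p zero)) (Equiv.sym (power-extᶠ n λ i →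
        Equiv.trans (F-triangle X.Equiv.refl) (Equiv.trans (p (suc i)) (Equiv.sym (F-triangle X.Equiv.refl))))))

-- Flatness of D at the equalizer E ⊆ Dᵐ of α and β, the universal instance of
-- the hypothesis, is carried along by G*, which preserves the equalizer and the
-- jointly epic family; the family on U is its pullback, covered by generators.
inverseImage-flat : InverseImagePreservesFlat
inverseImage-flat {X} {Y} G {D} flat n m α β U d αd≈βd =
  let I , V , p , epic , solution = flat n m α β E.object dᴱ αdᴱ≈βdᴱ
      surjective = GY.jointlyEpic⇒locallySurjective (λ i → F₁ (p i)) (jointlyEpic p epic)
      -- The cover of G*E is pulled back along `h` on generator points: those `x` for which `h ∘ x`
      -- lifts to some piece. The index is small because the site and the hom sets are.
      I′ = Σ[ c ∈ S.Obj ] Σ[ x ∈ GY.L₀ c ⇒ U ] GY.Hit (λ i → F₁ (p i)) (h ∘ x)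
  in I′ , (λ (c , _) → GY.L₀ c) , (λ (_ , x , _) → x)
   , GY.locallySurjective⇒jointlyEpic {I′} (λ (_ , x , _) → x) (λ x → mapLocal
       (λ f (i , y , e) → (_ , x ∘ GY.L₁ f , i , y , Equiv.trans e assoc) , id , identityʳ)
       (surjective (h ∘ x)))
   , λ (c , x , i , y , e) →
       let k , γ , d′ , αγ≋βγ , γd′≈d = solution i in
       k , γ , (λ j → F₁ (d′ j) ∘ y) , αγ≋βγ , λ j → begin
         evalᴰ G*D (γ j) (λ j → F₁ (d′ j) ∘ y)    ≈⟨ eval-inverseImage D (γ j) d′ y ⟩
         F₁ (EX.evalᴰ D (γ j) d′) ∘ y             ≈⟨ ∘-resp-≈ˡ (F-resp-≈ (γd′≈d j)) ⟩
         F₁ (dᴱ j X.∘ p i) ∘ y                    ≈⟨ F-triangle X.Equiv.refl ⟨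
         F₁ (dᴱ j) ∘ (F₁ (p i) ∘ y)               ≈⟨ ∘-resp-≈ʳ e ⟩
         F₁ (dᴱ j) ∘ (h ∘ x)                      ≈⟨ assoc ⟨
         (F₁ (dᴱ j) ∘ h) ∘ x                      ≈⟨ ∘-resp-≈ˡ (dᴱ∘h j) ⟩
         d j ∘ x                                  ∎
  where
  module X = GrothendieckTopos X
  module GX = GeneratedTopos (generators X)
  module GY = GeneratedTopos (generators Y)
  module D = InternalDL D
  module EX = Evaluation X
  module S = Site (GrothendieckTopos.site Y)
  open GrothendieckTopos Y
  open LocalTruth site using (mapLocal)
  open InverseImage G
  open Evaluation Y using (evalᴰ; evalᴰ-cong)
  open Power X D.carrier
  open HomReasoning

  G*D : InternalDL Y
  G*D = inverseImageDL G D

  evaluation : Kleisli n m → power m X.⇒ power n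
  evaluation α = tuple (α D.· proj)

  module E = GX.Equalizer (GX.equalizer (evaluation α) (evaluation β))

  dᴱ : Fin m → E.object X.⇒ D.carrier
  dᴱ j = proj j X.∘ E.arrow

  dᴱ-evaluation : ∀ γ i → EX.evalᴰ D (γ i) dᴱ X.≈ proj {n} i X.∘ (evaluation γ X.∘ E.arrow)
  dᴱ-evaluation γ i = X.Equiv.trans (X.Equiv.sym (EX.eval-∘ D (γ i) proj E.arrow))
    (X.Equiv.trans (X.∘-resp-≈ˡ (X.Equiv.sym (proj-tuple _ i))) X.assoc)

  αdᴱ≈βdᴱ : ∀ i → (α D.· dᴱ) i X.≈ (β D.· dᴱ) i
  αdᴱ≈βdᴱ i = X.Equiv.trans (dᴱ-evaluation α i) (X.Equiv.trans (X.∘-resp-≈ʳ E.equality)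
    (X.Equiv.sym (dᴱ-evaluation β i)))

  δ : U ⇒ F₀ (power m)
  δ = tupleᶠ D.carrier d

  δ-evaluation : ∀ γ (i : Fin n) → F₁ (proj i) ∘ (F₁ (evaluation γ) ∘ δ) ≈ evalᴰ G*D (γ i) d
  δ-evaluation γ i = begin
    F₁ (proj i) ∘ (F₁ (evaluation γ) ∘ δ)           ≈⟨ F-triangle (proj-tuple _ i) ⟩
    F₁ (EX.evalᴰ D (γ i) proj) ∘ δ                  ≈⟨ eval-inverseImage D (γ i) proj δ ⟨
    evalᴰ G*D (γ i) (λ j → F₁ (proj j) ∘ δ)         ≈⟨ evalᴰ-cong G*D (γ i) (proj-tupleᶠ D.carrier d) ⟩
    evalᴰ G*D (γ i) d                               ∎

  module E* = IsEqualizer (PreservesFiniteLimits.equalizer leftExact E.isEqualizer)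

  δ-equalizes : F₁ (evaluation α) ∘ δ ≈ F₁ (evaluation β) ∘ δ
  δ-equalizes = power-extᶠ D.carrier n λ i →
    Equiv.trans (δ-evaluation α i) (Equiv.trans (αd≈βd i) (Equiv.sym (δ-evaluation β i)))

  h : U ⇒ F₀ E.object
  h = E*.equalize δ-equalizes

  dᴱ∘h : ∀ j → F₁ (dᴱ j) ∘ h ≈ d j
  dᴱ∘h j = begin
    F₁ (proj j X.∘ E.arrow) ∘ h      ≈⟨ F-triangle X.Equiv.refl ⟨
    F₁ (proj j) ∘ (F₁ E.arrow ∘ h)   ≈⟨ ∘-resp-≈ʳ E*.universal ⟩
    F₁ (proj j) ∘ δ                  ≈⟨ proj-tupleᶠ D.carrier d j ⟩
    d j                              ∎

-- The interval and the representables

module Yoneda where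
  open GrothendieckTopos cubicalSets

  よ : ℕ → Obj
  よ = nerve idF

  element : ∀ {n} (P : Obj) → Setoid.Carrier (Functor.F₀ P n) → よ n ⇒ P
  element P x = record
    { η       = λ c → record { to = λ γ → to (P.F₁ γ) x ; cong = λ p → P.F-resp-≈ p x }
    ; commute = λ δ γ → P.homomorphism x
    } where module P = Functor P

  elements-jointlyEpic : ∀ (P : Obj) →
    JointlyEpic category {I = Σ[ n ∈ ℕ ] Setoid.Carrier (Functor.F₀ P n)} (λ (_ , x) → element P x)
  elements-jointlyEpic P {Z} f g agree n x = Z.trans (cong (η f n) (P.sym (Functor.identity P x)))
    (Z.trans (agree (n , x) n var) (cong (η g n) (Functor.identity P x)))
    where
    module Z = Setoid (Functor.F₀ Z n)
    module P = Setoid (Functor.F₀ P n)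

  interval : Obj
  interval = InternalDL.carrier 𝕀

  coordinate : ∀ {n} → Fin n → よ n ⇒ interval
  coordinate i = element interval (var i)

  open Evaluation cubicalSets using (evalᴰ)

  eval-𝕀 : ∀ {U : Obj} {n} (t : Term n) (d : Fin n → U ⇒ interval) {c} x →
           to (η (evalᴰ 𝕀 t d) c) x ≋ t [ (λ i → to (η (d i) c) x) ]
  eval-𝕀 (var i)  d x = ≋-refl
  eval-𝕀 ⊤ᵗ       d x = ≋-refl
  eval-𝕀 ⊥ᵗ       d x = ≋-refl
  eval-𝕀 (s ∨ᵗ t) d x = ∨-cong (eval-𝕀 s d x) (eval-𝕀 t d x)
  eval-𝕀 (s ∧ᵗ t) d x = ∧-cong (eval-𝕀 s d x) (eval-𝕀 t d x)

  element-eval : ∀ {n} (t : Term n) → element interval t ≈ evalᴰ 𝕀 t coordinate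
  element-eval t c γ = ≋-sym (eval-𝕀 t coordinate γ)

  -- Over an element `x` of `U` at `c`, the tuple `d` becomes a Kleisli map γ from m to DL(c), and
  -- it is γ applied to the generic tuple of coordinates. The premise at `x` says precisely that α
  -- and β agree after substituting γ, so the cover of `U` by its elements suffices.
  𝕀-flat : Flat cubicalSets 𝕀
  𝕀-flat n m α β U d αd≈βd =
    (Σ[ c ∈ ℕ ] Setoid.Carrier (U.F₀ c)) , (λ (c , _) → よ c) , (λ (_ , x) → element U x)
    , (λ {Z} → elements-jointlyEpic U {Z})
    , λ (c , x) → c , (λ j → to (η (d j) c) x) , coordinate
      , (λ i → ≋-trans (≋-sym (eval-𝕀 (α i) d x)) (≋-trans (αd≈βd i c x) (eval-𝕀 (β i) d x)))
      , λ j e γ → ≋-trans (eval-𝕀 (to (η (d j) c) x) coordinate γ) (≋-sym (commute (d j) γ x))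
    where module U = Functor U

  open Power cubicalSets interval

  toPower : ∀ n → よ n ⇒ power n
  toPower n = tuple coordinate

  -- At stage `c`, an element of the n-th power of the interval and an element of the n-cube are
  -- both n-tuples of terms in `c` variables.
  fromPower : ∀ n → power n ⇒ よ n
  fromPower n = record
    { η       = λ c → record { to = λ x i → to (η (proj i) c) x ; cong = λ p i → cong (η (proj i) c) p }
    ; commute = λ γ x i → commute (proj i) γ x
    }

  coordinate-fromPower : ∀ {n} (i : Fin n) → coordinate i ∘ fromPower n ≈ proj i
  coordinate-fromPower i c x = ≋-refl

  proj-toPower : ∀ {n} (i : Fin n) → proj i ∘ toPower n ≈ coordinate i
  proj-toPower i = proj-tuple coordinate i

  from-toPower : ∀ n → fromPower n ∘ toPower n ≈ id
  from-toPower n c γ i = proj-tuple coordinate i c γ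

-- Full faithfulness of evaluation at the interval

module FullyFaithful {X : GrothendieckTopos} where
  open GrothendieckTopos X
  open Yoneda
  open Evaluation X
  open HomReasoning
  private
    module E = GrothendieckTopos cubicalSets
    module EE = Evaluation cubicalSets

  module Representables (F : GeometricMorphism X cubicalSets) where
    open InverseImage F
    open Power cubicalSets interval

    tupleʸ : ∀ {n U} → (Fin n → U ⇒ F₀ interval) → U ⇒ F₀ (よ n)
    tupleʸ {n} x = F₁ (fromPower n) ∘ tupleᶠ interval x

    coordinate-tupleʸ : ∀ {n U} (x : Fin n → U ⇒ F₀ interval) i → F₁ (coordinate i) ∘ tupleʸ x ≈ x i
    coordinate-tupleʸ {n} x i = Equiv.trans
      (F-triangle {f = coordinate i} {fromPower n} {proj i} (coordinate-fromPower i))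
      (proj-tupleᶠ interval x i)

    よ-ext : ∀ n {U} {x y : U ⇒ F₀ (よ n)} →
             (∀ (i : Fin n) → F₁ (coordinate i) ∘ x ≈ F₁ (coordinate i) ∘ y) → x ≈ y
    よ-ext n {x = x} {y} p = begin
      x                                         ≈⟨ roundtrip x ⟩
      F₁ (fromPower n) ∘ (F₁ (toPower n) ∘ x)   ≈⟨ ∘-resp-≈ʳ (power-extᶠ interval n λ i →
        Equiv.trans (leg i) (Equiv.trans (p i) (Equiv.sym (leg i)))) ⟩
      F₁ (fromPower n) ∘ (F₁ (toPower n) ∘ y)   ≈⟨ roundtrip y ⟨
      y                                         ∎
      where
      leg : ∀ {U} {z : U ⇒ F₀ (よ n)} (i : Fin n) →
            F₁ (proj i) ∘ (F₁ (toPower n) ∘ z) ≈ F₁ (coordinate i) ∘ z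
      leg i = F-triangle {f = proj i} {toPower n} {coordinate i} (proj-toPower i)

      roundtrip : ∀ {U} (z : U ⇒ F₀ (よ n)) → z ≈ F₁ (fromPower n) ∘ (F₁ (toPower n) ∘ z)
      roundtrip z = Equiv.sym (Equiv.trans (F-triangle {f = fromPower n} {toPower n} {E.id} (from-toPower n))
        (Equiv.trans (∘-resp-≈ˡ identity) identityˡ))

    elements-epic : ∀ P {Z} {f g : F₀ P ⇒ Z} →
                    (∀ n (x : Setoid.Carrier (Functor.F₀ P n)) → f ∘ F₁ (element P x) ≈ g ∘ F₁ (element P x)) →
                    f ≈ g
    elements-epic P {f = f} {g} p = jointlyEpic (λ (_ , x) → element P x)
      (λ {Z} → elements-jointlyEpic P {Z}) f g λ (n , x) → p n x

  module _ (F G : GeometricMorphism X cubicalSets) where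
    private
      module F where
        open InverseImage F public
        open Representables F public
      module G where
        open InverseImage G public
        open Representables G public

      F𝕀 G𝕀 : InternalDL X
      F𝕀 = inverseImageDL F 𝕀
      G𝕀 = inverseImageDL G 𝕀

    -- Naturality at the elements of `P` reduces to the components at cubes, and naturality at the
    -- coordinates reduces those to the component at the interval.
    evaluate-faithful : (α β : NaturalTransformation F.inverseImage G.inverseImage) →
                        η α interval ≈ η β interval → ∀ P → η α P ≈ η β P
    evaluate-faithful α β p P = F.elements-epic P λ n x → begin
      η α P ∘ F.F₁ (element P x)         ≈⟨ commute α (element P x) ⟩
      G.F₁ (element P x) ∘ η α (よ n)    ≈⟨ ∘-resp-≈ʳ (G.よ-ext n λ i → begin
        G.F₁ (coordinate i) ∘ η α (よ n)   ≈⟨ commute α (coordinate i) ⟨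
        η α interval ∘ F.F₁ (coordinate i) ≈⟨ ∘-resp-≈ˡ p ⟩
        η β interval ∘ F.F₁ (coordinate i) ≈⟨ commute β (coordinate i) ⟩
        G.F₁ (coordinate i) ∘ η β (よ n)   ∎) ⟩
      G.F₁ (element P x) ∘ η β (よ n)    ≈⟨ commute β (element P x) ⟨
      η β P ∘ F.F₁ (element P x)         ∎

    module _ (h : LatticeHom X F𝕀 G𝕀) where
      open LatticeHom h using (hom)

      component : ∀ n → F.F₀ (よ n) ⇒ G.F₀ (よ n)
      component n = G.tupleʸ λ i → hom ∘ F.F₁ (coordinate i)

      -- This is where `h` must be a lattice homomorphism: an element of the interval at n is a
      -- polynomial in the coordinates, on which `component` is given by `hom`.
      component-element : ∀ {n} (t : Term n) →
                          G.F₁ (element interval t) ∘ component n ≈ hom ∘ F.F₁ (element interval t)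
      component-element {n} t = begin
        G.F₁ (element interval t) ∘ component n
          ≈⟨ ∘-resp-≈ˡ (G.F-resp-≈ {f = element interval t} {EE.evalᴰ 𝕀 t coordinate} (element-eval t)) ⟩
        G.F₁ (EE.evalᴰ 𝕀 t coordinate) ∘ component n
          ≈⟨ G.eval-inverseImage 𝕀 t coordinate (component n) ⟨
        evalᴰ G𝕀 t (λ i → G.F₁ (coordinate i) ∘ component n)
          ≈⟨ evalᴰ-cong G𝕀 t (λ i → Equiv.trans (G.coordinate-tupleʸ _ i) (∘-resp-≈ʳ (Equiv.sym identityʳ))) ⟩
        evalᴰ G𝕀 t (λ i → hom ∘ (F.F₁ (coordinate i) ∘ id))
          ≈⟨ eval-hom h t _ ⟨
        hom ∘ evalᴰ F𝕀 t (λ i → F.F₁ (coordinate i) ∘ id)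
          ≈⟨ ∘-resp-≈ʳ (F.eval-inverseImage 𝕀 t coordinate id) ⟩
        hom ∘ (F.F₁ (EE.evalᴰ 𝕀 t coordinate) ∘ id)
          ≈⟨ ∘-resp-≈ʳ identityʳ ⟩
        hom ∘ F.F₁ (EE.evalᴰ 𝕀 t coordinate)
          ≈⟨ ∘-resp-≈ʳ (F.F-resp-≈ {f = element interval t} {EE.evalᴰ 𝕀 t coordinate} (element-eval t)) ⟨
        hom ∘ F.F₁ (element interval t)
          ∎

      component-natural : ∀ {m n} (δ : Kleisli n m) →
                          G.F₁ (element (よ n) δ) ∘ component m ≈ component n ∘ F.F₁ (element (よ n) δ)
      component-natural {m} {n} δ = G.よ-ext n λ i → begin
        G.F₁ (coordinate i) ∘ (G.F₁ (element (よ n) δ) ∘ component m)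
          ≈⟨ G.F-triangle {f = coordinate i} {element (よ n) δ} {element interval (δ i)} (λ c γ → ≋-refl) ⟩
        G.F₁ (element interval (δ i)) ∘ component m
          ≈⟨ component-element (δ i) ⟩
        hom ∘ F.F₁ (element interval (δ i))
          ≈⟨ ∘-resp-≈ʳ (Equiv.trans (Equiv.sym F.homomorphism) (F.F-resp-≈
               {f = coordinate i E.∘ element (よ n) δ} {element interval (δ i)} (λ c γ → ≋-refl))) ⟨
        hom ∘ (F.F₁ (coordinate i) ∘ F.F₁ (element (よ n) δ))
          ≈⟨ assoc ⟨
        (hom ∘ F.F₁ (coordinate i)) ∘ F.F₁ (element (よ n) δ)
          ≈⟨ ∘-resp-≈ˡ (G.coordinate-tupleʸ _ i) ⟨
        (G.F₁ (coordinate i) ∘ component n) ∘ F.F₁ (element (よ n) δ)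
          ≈⟨ assoc ⟩
        G.F₁ (coordinate i) ∘ (component n ∘ F.F₁ (element (よ n) δ))
          ∎

      module _ (P : E.Obj) where
        private
          module P = Functor P
          module R {n} = Setoid (Functor.F₀ (Functor.F₀ F.directImage (G.F₀ P)) n)

        leg : ∀ {n} (x : Setoid.Carrier (P.F₀ n)) → F.F₀ (よ n) ⇒ G.F₀ P
        leg {n} x = G.F₁ (element P x) ∘ component n

        leg-restrict : ∀ {m n} (δ : Kleisli n m) x →
                       leg (to (P.F₁ δ) x) ≈ leg x ∘ F.F₁ (element (よ n) δ)
        leg-restrict {m} {n} δ x = begin
          G.F₁ (element P (to (P.F₁ δ) x)) ∘ component m
            ≈⟨ G.F-triangle {f = element P x} {element (よ n) δ} {element P (to (P.F₁ δ) x)}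
                 (λ c γ → P.homomorphism x) ⟨
          G.F₁ (element P x) ∘ (G.F₁ (element (よ n) δ) ∘ component m)
            ≈⟨ ∘-resp-≈ʳ (component-natural δ) ⟩
          G.F₁ (element P x) ∘ (component n ∘ F.F₁ (element (よ n) δ))
            ≈⟨ assoc ⟨
          leg x ∘ F.F₁ (element (よ n) δ)
            ∎

        -- The legs form a cocone over the elements of `P`. Instead of forming the colimit, the
        -- adjunction replaces a map from F*P to G*P by a map from `P` into the direct image of G*P,
        -- whose value at `x` is, by Yoneda, the transpose of `leg x` at the generic element `var`.
        mate : P E.⇒ Functor.F₀ F.directImage (G.F₀ P)
        mate = record
          { η       = λ n → record
              { to   = λ x → to (η (F.φ (leg x)) n) var
              ; cong = λ {x} {y} p → F.φ-cong (∘-resp-≈ˡ (G.F-resp-≈ {f = element P x} {element P y}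
                  (λ c γ → cong (P.F₁ γ) p))) n var
              }
          ; commute = λ {n} {m} δ x → R.trans
              (F.φ-cong (leg-restrict δ x) m var)
              (R.trans (F.φ-∘ (leg x) (element (よ n) δ) m var)
              (R.trans (cong (η (F.φ (leg x)) m) {δ ⨟ var} {var ⨟ δ} (λ i → []-var (δ i)))
              (commute (F.φ (leg x)) δ var)))
          }

        extension : F.F₀ P ⇒ G.F₀ P
        extension = F.ψ mate

        extension-element : ∀ {n} (x : Setoid.Carrier (P.F₀ n)) → extension ∘ F.F₁ (element P x) ≈ leg x
        extension-element {n} x = F.φ-injective λ m γ → R.trans
          (F.φ-∘ extension (element P x) m γ)
          (R.trans (F.φψ mate m (to (P.F₁ γ) x))
          (R.trans (F.φ-cong (leg-restrict γ x) m var)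
          (R.trans (F.φ-∘ (leg x) (element (よ n) γ) m var)
          (cong (η (F.φ (leg x)) m) {γ ⨟ var} {γ} (λ i → []-var (γ i))))))

      evaluate-full : Σ[ α ∈ NaturalTransformation F.inverseImage G.inverseImage ] η α interval ≈ hom
      evaluate-full = record
        { η       = extension
        ; commute = λ {P} {Q} f → F.elements-epic P λ n x → begin
            (extension Q ∘ F.F₁ f) ∘ F.F₁ (element P x)
              ≈⟨ Equiv.trans assoc (∘-resp-≈ʳ (Equiv.trans (Equiv.sym F.homomorphism)
                   (F.F-resp-≈ {f = f E.∘ element P x} {element Q (to (η f n) x)} (λ c γ → commute f γ x)))) ⟩
            extension Q ∘ F.F₁ (element Q (to (η f n) x))
              ≈⟨ extension-element Q (to (η f n) x) ⟩
            G.F₁ (element Q (to (η f n) x)) ∘ component n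
              ≈⟨ G.F-triangle {f = f} {element P x} {element Q (to (η f n) x)} (λ c γ → commute f γ x) ⟨
            G.F₁ f ∘ (G.F₁ (element P x) ∘ component n)
              ≈⟨ ∘-resp-≈ʳ (extension-element P x) ⟨
            G.F₁ f ∘ (extension P ∘ F.F₁ (element P x))
              ≈⟨ assoc ⟨
            (G.F₁ f ∘ extension P) ∘ F.F₁ (element P x)
              ∎
        } , F.elements-epic interval λ n t →
              Equiv.trans (extension-element interval t) (component-element t)

-- The left exact extension of a flat lattice

module FlatExtension {X : GrothendieckTopos} (generated : Generators X) (D : InternalDL X) (flat : Flat X D) where
  open GrothendieckTopos X
  open GeneratedTopos generated
  open InternalDL D using (carrier; _·_)
  open Evaluation X
  open Power X carrier
  open LocalTruth site
  open HomReasoning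
  private module S = Site site

  infixl 8 _∣ᵈ_
  _∣ᵈ_ : ∀ {n U V} → (Fin n → U ⇒ carrier) → V ⇒ U → (Fin n → V ⇒ carrier)
  (d ∣ᵈ h) i = d i ∘ h

  infix 4 _≈ᵈ_
  _≈ᵈ_ : ∀ {n U} (d e : Fin n → U ⇒ carrier) → Set
  d ≈ᵈ e = ∀ i → d i ≈ e i

  ·-cong : ∀ {n m U} (α : Kleisli n m) {d e : Fin m → U ⇒ carrier} → d ≈ᵈ e → α · d ≈ᵈ α · e
  ·-cong α p i = evalᴰ-cong D (α i) p

  ·-∣ : ∀ {n m U V} (α : Kleisli n m) (d : Fin m → U ⇒ carrier) (h : V ⇒ U) → (α · d) ∣ᵈ h ≈ᵈ α · (d ∣ᵈ h)
  ·-∣ α d h i = eval-∘ D (α i) d h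

  ⨟-· : ∀ {n m k U} (α : Kleisli n m) (γ : Kleisli m k) (d : Fin k → U ⇒ carrier) →
        (α ⨟ γ) · d ≈ᵈ α · (γ · d)
  ⨟-· α γ d i = evalᴰ-[] D (α i) γ d

  ·-restrict : ∀ {n m U V} (α : Kleisli n m) {b : Fin m → U ⇒ carrier} {d : Fin n → U ⇒ carrier}
               (h : V ⇒ U) → α · b ≈ᵈ d → α · (b ∣ᵈ h) ≈ᵈ d ∣ᵈ h
  ·-restrict α h p i = Equiv.trans (Equiv.sym (·-∣ α _ h i)) (∘-resp-≈ˡ (p i))

  solve-∘ : ∀ {p q r c c′} (α : Kleisli p q) (γ : Kleisli q r) {d : Fin p → L₀ c ⇒ carrier}
           {b : Fin q → L₀ c ⇒ carrier} {b′ : Fin r → L₀ c′ ⇒ carrier} {h : L₀ c′ ⇒ L₀ c} →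
           α · b ≈ᵈ d → γ · b′ ≈ᵈ b ∣ᵈ h → α · (γ · b′) ≈ᵈ d ∣ᵈ h
  solve-∘ α γ p q i = Equiv.trans (·-cong α q i) (·-restrict α _ p i)

  solve-⨟ : ∀ {p q r s c c′ c″} (α : Kleisli p q) (γ : Kleisli q r) (δ : Kleisli r s)
              {d : Fin p → L₀ c ⇒ carrier} {b : Fin q → L₀ c ⇒ carrier} {b₁ : Fin r → L₀ c′ ⇒ carrier}
              {b₂ : Fin s → L₀ c″ ⇒ carrier} {f : c′ S.⇒ c} {g : c″ S.⇒ c′} →
              α · b ≈ᵈ d → γ · b₁ ≈ᵈ b ∣ᵈ L₁ f → δ · b₂ ≈ᵈ b₁ ∣ᵈ L₁ g →
              ((α ⨟ γ) ⨟ δ) · b₂ ≈ᵈ d ∣ᵈ L₁ (f S.∘ g)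
  solve-⨟ α γ δ p q r i = Equiv.trans (⨟-· (α ⨟ γ) δ _ i)
    (Equiv.trans (solve-∘ (α ⨟ γ) δ (λ j → Equiv.trans (⨟-· α γ _ j) (solve-∘ α γ p q j)) r i)
      (L-triangle S.Equiv.refl))

  -- Flatness in site form: the jointly epic family is locally surjective, and applying this to the
  -- identity of `L₀ c` makes the witnesses live over generators again.
  flat-locally : ∀ {n m c} (α β : Kleisli n m) (d : Fin m → L₀ c ⇒ carrier) → α · d ≈ᵈ β · d →
    Local (λ {e} f → Σ[ k ∈ ℕ ] Σ[ γ ∈ Kleisli m k ] Σ[ b ∈ (Fin k → L₀ e ⇒ carrier) ]
      ((α ⨟ γ) ≋ᴷ (β ⨟ γ)) × (γ · b ≈ᵈ d ∣ᵈ L₁ f)) (S.id {c})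
  flat-locally {n} {m} {c} α β d αd≈βd =
    let I , V , p , epic , solution = flat n m α β (L₀ c) d αd≈βd in
    mapLocal
      (λ f (i , y , e) → let k , γ , b , αγ≋βγ , γb≈d = solution i in
        k , γ , b ∣ᵈ y , αγ≋βγ , λ j → Equiv.trans (·-restrict γ y γb≈d j)
          (Equiv.trans assoc (∘-resp-≈ʳ (Equiv.trans e identityˡ))))
      (jointlyEpic⇒locallySurjective p epic id)

  left : ∀ {n m} → Kleisli n (n + m)
  left {m = m} i = var (i ↑ˡ m)

  right : ∀ {n m} → Kleisli m (n + m)
  right {n} i = var (n ↑ʳ i)

  left-++ : ∀ {n m U} (d : Fin n → U ⇒ carrier) (e : Fin m → U ⇒ carrier) → left · (d ++ e) ≈ᵈ d
  left-++ d e i = Equiv.reflexive (lookup-++ˡ d e i)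

  right-++ : ∀ {n m U} (d : Fin n → U ⇒ carrier) (e : Fin m → U ⇒ carrier) → right {n} · (d ++ e) ≈ᵈ e
  right-++ d e i = Equiv.reflexive (lookup-++ʳ d e i)

  -- Over the concatenation `d ++ e` the maps `α ⨟ left` and `β ⨟ right` are parallel and agree, so
  -- flatness applies; splitting the resulting Kleisli map along the sum gives the two legs of the
  -- square.
  square-locally : ∀ {n k l c} (α : Kleisli n k) (β : Kleisli n l)
    (d : Fin k → L₀ c ⇒ carrier) (e : Fin l → L₀ c ⇒ carrier) → α · d ≈ᵈ β · e →
    Local (λ {w} f → Σ[ r ∈ ℕ ] Σ[ γ ∈ Kleisli k r ] Σ[ δ ∈ Kleisli l r ] Σ[ b ∈ (Fin r → L₀ w ⇒ carrier) ]
      ((α ⨟ γ) ≋ᴷ (β ⨟ δ)) × (γ · b ≈ᵈ d ∣ᵈ L₁ f) × (δ · b ≈ᵈ e ∣ᵈ L₁ f)) (S.id {c})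
  square-locally {k = k} α β d e αd≈βe = mapLocal
    (λ f (r , γ , b , p , q) → r , left ⨟ γ , right {k} ⨟ γ , b
      , (λ i → ≋-trans (≋-sym ([]-[] (α i) left γ)) (≋-trans (p i) ([]-[] (β i) right γ)))
      , (λ j → Equiv.trans (q (j ↑ˡ _)) (∘-resp-≈ˡ (left-++ d e j)))
      , (λ j → Equiv.trans (q (k ↑ʳ j)) (∘-resp-≈ˡ (right-++ d e j))))
    (flat-locally (α ⨟ left) (β ⨟ right {k}) (d ++ e) λ i → begin
      ((α ⨟ left) · (d ++ e)) i        ≈⟨ ⨟-· α left (d ++ e) i ⟩
      (α · (left · (d ++ e))) i        ≈⟨ ·-cong α (left-++ d e) i ⟩
      (α · d) i                        ≈⟨ αd≈βe i ⟩
      (β · e) i                        ≈⟨ ·-cong β (right-++ d e) i ⟨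
      (β · (right {k} · (d ++ e))) i   ≈⟨ ⨟-· β (right {k}) (d ++ e) i ⟨
      ((β ⨟ right {k}) · (d ++ e)) i   ∎)

  -- A span over d and e in the category of elements of D.
  Refinement : ∀ {n m c} (d : Fin n → L₀ c ⇒ carrier) (e : Fin m → L₀ c ⇒ carrier) →
               (∀ {k} → Kleisli n k → Kleisli m k → Set) → Set
  Refinement {n} {m} {c} d e R =
    Σ[ k ∈ ℕ ] Σ[ α ∈ Kleisli n k ] Σ[ β ∈ Kleisli m k ] Σ[ b ∈ (Fin k → L₀ c ⇒ carrier) ]
      (α · b ≈ᵈ d) × (β · b ≈ᵈ e) × R α β

  module _ {n m : ℕ} {R : ∀ {k} → Kleisli n k → Kleisli m k → Set} where

    refinement-cong : ∀ {c} {d d′ : Fin n → L₀ c ⇒ carrier} {e e′ : Fin m → L₀ c ⇒ carrier} →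
                      d ≈ᵈ d′ → e ≈ᵈ e′ → Refinement d e R → Refinement d′ e′ R
    refinement-cong p q (k , α , β , b , αb≈d , βb≈e , r) =
      k , α , β , b , (λ i → Equiv.trans (αb≈d i) (p i)) , (λ i → Equiv.trans (βb≈e i) (q i)) , r

    refinement-∣ : ∀ {c c′} {d : Fin n → L₀ c ⇒ carrier} {e : Fin m → L₀ c ⇒ carrier} (h : L₀ c′ ⇒ L₀ c) →
                   Refinement d e R → Refinement (d ∣ᵈ h) (e ∣ᵈ h) R
    refinement-∣ h (k , α , β , b , p , q , r) =
      k , α , β , b ∣ᵈ h , ·-restrict α h p , ·-restrict β h q , r

    refinement-stable : ∀ {c} {d : Fin n → L₀ c ⇒ carrier} {e : Fin m → L₀ c ⇒ carrier} →
                        Stable (λ f → Refinement (d ∣ᵈ L₁ f) (e ∣ᵈ L₁ f) R)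
    refinement-stable g p r = refinement-cong (λ i → L-triangle p) (λ i → L-triangle p) (refinement-∣ (L₁ g) r)

  Closed : ∀ {n m} → (∀ {k} → Kleisli n k → Kleisli m k → Set) → Set
  Closed {n} {m} R = ∀ {k l} {α : Kleisli n k} {β : Kleisli m k} {α′ : Kleisli n l} {β′ : Kleisli m l}
    (γ : Kleisli k l) → (α ⨟ γ) ≋ᴷ α′ → (β ⨟ γ) ≋ᴷ β′ → R α β → R α′ β′

  module _ {n m : ℕ} {R R′ : ∀ {k} → Kleisli n k → Kleisli m k → Set}
           (closed : Closed R) (closed′ : Closed R′) where

    -- Cofilteredness in two steps. `square-locally` merges the apexes over `d`; the two legs to `e`
    -- then agree only after evaluation at the merged tuple, and a second use of flatness makes them
    -- equal as Kleisli maps. Closure under further refinement carries both conditions along.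
    refine-both : ∀ {c} {d : Fin n → L₀ c ⇒ carrier} {e : Fin m → L₀ c ⇒ carrier} →
                  Refinement d e R → Refinement d e R′ →
                  Local (λ f → Refinement (d ∣ᵈ L₁ f) (e ∣ᵈ L₁ f) (λ α β → R α β × R′ α β)) (S.id {c})
    refine-both (k , α , β , b , αb≈d , βb≈e , r) (l , α′ , β′ , b′ , α′b′≈d , β′b′≈e , r′) =
      square-locally α α′ b b′ (λ i → Equiv.trans (αb≈d i) (Equiv.sym (α′b′≈d i))) >>=
      λ f (k₁ , γ , γ′ , b₁ , αγ≋α′γ′ , γb₁≈b , γ′b₁≈b′) → mapLocal
        (λ g (k₂ , δ , b₂ , βγδ≋β′γ′δ , δb₂≈b₁) →
          k₂ , (α ⨟ γ) ⨟ δ , (β ⨟ γ) ⨟ δ , b₂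
          , (λ i → solve-⨟ α γ δ αb≈d γb₁≈b δb₂≈b₁ i)
          , (λ i → solve-⨟ β γ δ βb≈e γb₁≈b δb₂≈b₁ i)
          , closed (γ ⨟ δ) (λ i → ≋-sym ([]-[] (α i) γ δ)) (λ i → ≋-sym ([]-[] (β i) γ δ)) r
          , closed′ (γ′ ⨟ δ)
              (λ i → ≋-trans (≋-sym ([]-[] (α′ i) γ′ δ)) ([]-≋ (≋-sym (αγ≋α′γ′ i)) δ))
              (λ i → ≋-trans (≋-sym ([]-[] (β′ i) γ′ δ)) (≋-sym (βγδ≋β′γ′δ i))) r′)
        (flat-locally (β ⨟ γ) (β′ ⨟ γ′) b₁ λ i → Equiv.trans (⨟-· β γ b₁ i)
          (Equiv.trans (solve-∘ β γ βb≈e γb₁≈b i) (Equiv.sym (Equiv.trans (⨟-· β′ γ′ b₁ i)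
            (solve-∘ β′ γ′ β′b′≈e γ′b₁≈b′ i)))))

  module Extension (P : Functor (op □) Setoids) where
    private
      module P = Functor P
      module Pᵉ {n} = Setoid (P.F₀ n)

      infixl 8 _∙_
      _∙_ : ∀ {n m} → Setoid.Carrier (P.F₀ n) → Kleisli n m → Setoid.Carrier (P.F₀ m)
      x ∙ α = to (P.F₁ α) x

    Same : ∀ {n m} → Setoid.Carrier (P.F₀ n) → Setoid.Carrier (P.F₀ m) →
           ∀ {k} → Kleisli n k → Kleisli m k → Set
    Same x y α β = (x ∙ α) Pᵉ.≈ (y ∙ β)

    Same-closed : ∀ {n m} {x : Setoid.Carrier (P.F₀ n)} {y : Setoid.Carrier (P.F₀ m)} → Closed (Same x y)
    Same-closed {x = x} {y} γ p q r = Pᵉ.trans (Pᵉ.sym (P.F-resp-≈ p x)) (Pᵉ.trans (P.homomorphism x)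
      (Pᵉ.trans (cong (P.F₁ γ) r) (Pᵉ.trans (Pᵉ.sym (P.homomorphism y)) (P.F-resp-≈ q y))))

    Formal : S.Obj → Set
    Formal c = Σ[ n ∈ ℕ ] Setoid.Carrier (P.F₀ n) × (Fin n → L₀ c ⇒ carrier)

    infix 4 _~_ _∼_
    _~_ : ∀ {c} → Formal c → Formal c → Set
    (_ , x , d) ~ (_ , y , e) = Refinement d e (Same x y)

    infixl 8 _∣ᶠ_
    _∣ᶠ_ : ∀ {c c′} → Formal c → L₀ c′ ⇒ L₀ c → Formal c′
    (n , x , d) ∣ᶠ h = n , x , d ∣ᵈ h

    _∼_ : ∀ {c} → Formal c → Formal c → Set
    _∼_ {c} p q = Local (λ f → p ∣ᶠ L₁ f ~ q ∣ᶠ L₁ f) (S.id {c})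

    ~-along : ∀ {c n k} (x : Setoid.Carrier (P.F₀ n)) (α : Kleisli n k)
              {d : Fin n → L₀ c ⇒ carrier} {b : Fin k → L₀ c ⇒ carrier} {y} →
              α · b ≈ᵈ d → (x ∙ α) Pᵉ.≈ y → (n , x , d) ~ (k , y , b)
    ~-along x α {b = b} {y} p q = _ , α , var , b , p , (λ i → Equiv.refl) , Pᵉ.trans q (Pᵉ.sym (P.identity y))

    ~-pointwise : ∀ {c n} {x y : Setoid.Carrier (P.F₀ n)} {d e : Fin n → L₀ c ⇒ carrier} →
                  x Pᵉ.≈ y → d ≈ᵈ e → (n , x , d) ~ (n , y , e)
    ~-pointwise {x = x} p q = ~-along x var (λ i → Equiv.sym (q i)) (Pᵉ.trans (P.identity x) p)

    ~-sym : ∀ {c} {p q : Formal c} → p ~ q → q ~ p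
    ~-sym (k , α , β , b , p , q , r) = k , β , α , b , q , p , Pᵉ.sym r

    -- The two spans meet at the middle tuple, and a square completing them exists only locally.
    -- This is why the equivalence relation is `_∼_`, local existence of a span, and not `_~_`.
    ~-trans : ∀ {c} {p q r : Formal c} → p ~ q → q ~ r → p ∼ r
    ~-trans {p = _ , x , _} {_ , y , _} {_ , z , _}
            (k , α , β , b , αb≈d , βb≈e , xα≈yβ) (k′ , α′ , β′ , b′ , α′b′≈e , β′b′≈f , yα′≈zβ′) = mapLocal
      (λ f (l , γ , γ′ , b₁ , βγ≋α′γ′ , γb₁≈b , γ′b₁≈b′) →
        l , α ⨟ γ , β′ ⨟ γ′ , b₁
        , (λ i → Equiv.trans (⨟-· α γ b₁ i) (solve-∘ α γ αb≈d γb₁≈b i))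
        , (λ i → Equiv.trans (⨟-· β′ γ′ b₁ i) (solve-∘ β′ γ′ β′b′≈f γ′b₁≈b′ i))
        , Pᵉ.trans (Same-closed {x = x} {y} γ (λ _ → ≋-refl) βγ≋α′γ′ xα≈yβ)
            (Same-closed {x = y} {z} γ′ (λ _ → ≋-refl) (λ _ → ≋-refl) yα′≈zβ′))
      (square-locally β α′ b b′ (λ i → Equiv.trans (βb≈e i) (Equiv.sym (α′b′≈e i))))

    ∼-along : ∀ {c n k} (x : Setoid.Carrier (P.F₀ n)) (α : Kleisli n k)
              {d : Fin n → L₀ c ⇒ carrier} {b : Fin k → L₀ c ⇒ carrier} {y} →
              α · b ≈ᵈ d → (x ∙ α) Pᵉ.≈ y → (n , x , d) ∼ (k , y , b)
    ∼-along x α p q = now (refinement-∣ (L₁ S.id) (~-along x α p q))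

    ∼-pointwise : ∀ {c n} {x y : Setoid.Carrier (P.F₀ n)} {d e : Fin n → L₀ c ⇒ carrier} →
                  x Pᵉ.≈ y → d ≈ᵈ e → (n , x , d) ∼ (n , y , e)
    ∼-pointwise p q = now (refinement-∣ (L₁ S.id) (~-pointwise p q))

    ∼-isEquivalence : ∀ {c} → IsEquivalence (_∼_ {c})
    ∼-isEquivalence = record
      { refl  = ∼-pointwise Pᵉ.refl (λ i → Equiv.refl)
      ; sym   = mapLocal (λ f → ~-sym)
      ; trans = λ p q → both refinement-stable refinement-stable p q >>= λ f (r , s) → mapLocal
          (λ g → refinement-cong (λ i → L-triangle S.Equiv.refl) (λ i → L-triangle S.Equiv.refl))
          (~-trans r s)
      }

    formal : Functor (op S.category) Setoids
    formal = record
      { F₀           = λ c → record { isEquivalence = ∼-isEquivalence {c} }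
      ; F₁           = λ f → record
          { to   = _∣ᶠ L₁ f
          ; cong = λ p → pullLocal f
              (λ g h k q r → refinement-cong
                (λ i → Equiv.sym (L-triangle S.Equiv.refl)) (λ i → Equiv.sym (L-triangle S.Equiv.refl))
                (refinement-stable h q r))
              S.identityʳ (restrictLocal f S.identityˡ p)
          }
      ; identity     = λ (n , x , d) → ∼-pointwise Pᵉ.refl (λ i → ∘L-id)
      ; homomorphism = λ (n , x , d) → ∼-pointwise Pᵉ.refl (λ i → Equiv.sym (L-triangle S.Equiv.refl))
      ; F-resp-≈     = λ p (n , x , d) → ∼-pointwise Pᵉ.refl (λ i → ∘-resp-≈ʳ (L-cong p))
      }

    module R = Realization (realize formal)

    included : ∀ {c} → Formal c → L₀ c ⇒ R.object
    included = inc (realize formal)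

    included-cong : ∀ {c} {p q : Formal c} → p ∼ q → included p ≈ included q
    included-cong = cong (η R.include _)

    -- The coprojection of the coend at `x`. Since Dⁿ need not be a generator, it is defined on the
    -- generator points of `power n` and assembled by `full`.
    generic : ∀ {n} (x : Setoid.Carrier (P.F₀ n)) → Σ[ f ∈ power n ⇒ R.object ]
              (∀ {c} (e : L₀ c ⇒ power n) → f ∘ e ≈ included (n , x , proj ∣ᵈ e))
    generic {n} x = full record
      { η       = λ c → record
          { to   = λ e → included (n , x , proj ∣ᵈ e)
          ; cong = λ p → included-cong (∼-pointwise Pᵉ.refl (λ i → ∘-resp-≈ʳ p))
          }
      ; commute = λ f e → Equiv.trans (included-cong (∼-pointwise Pᵉ.refl (λ i → Equiv.sym assoc)))
          (commute R.include f (n , x , proj ∣ᵈ e))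
      }

    point : ∀ {n} → Setoid.Carrier (P.F₀ n) → power n ⇒ R.object
    point x = proj₁ (generic x)

    point-∘ : ∀ {n c} (x : Setoid.Carrier (P.F₀ n)) {e : L₀ c ⇒ power n} {d : Fin n → L₀ c ⇒ carrier} →
              (∀ (i : Fin n) → proj i ∘ e ≈ d i) → point x ∘ e ≈ included (n , x , d)
    point-∘ x p = Equiv.trans (proj₂ (generic x) _) (included-cong (∼-pointwise Pᵉ.refl p))

    point-cong : ∀ {n} {x y : Setoid.Carrier (P.F₀ n)} → x Pᵉ.≈ y → point x ≈ point y
    point-cong {x = x} {y} p = faithful λ e → Equiv.trans (proj₂ (generic x) e)
      (Equiv.trans (included-cong (∼-pointwise p (λ i → Equiv.refl))) (Equiv.sym (proj₂ (generic y) e)))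

    points-epic : ∀ {A} {f g : R.object ⇒ A} →
                  (∀ {n} (x : Setoid.Carrier (P.F₀ n)) → f ∘ point x ≈ g ∘ point x) → f ≈ g
    points-epic {f = f} {g} p = extend-unique (realize formal) λ (n , x , d) →
      let e = Equiv.sym (point-∘ x (proj-tuple d)) in begin
        f ∘ included (n , x , d)        ≈⟨ ∘-resp-≈ʳ e ⟩
        f ∘ (point x ∘ tuple d)         ≈⟨ assoc ⟨
        (f ∘ point x) ∘ tuple d         ≈⟨ ∘-resp-≈ˡ (p x) ⟩
        (g ∘ point x) ∘ tuple d         ≈⟨ assoc ⟩
        g ∘ (point x ∘ tuple d)         ≈⟨ ∘-resp-≈ʳ e ⟨
        g ∘ included (n , x , d)        ∎

  substitution : ∀ {n m} → Kleisli n m → power m ⇒ power n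
  substitution α = tuple (α · proj)

  proj-substitution : ∀ {n m U} (α : Kleisli n m) (e : U ⇒ power m) (i : Fin n) →
                      proj i ∘ (substitution α ∘ e) ≈ (α · (proj ∣ᵈ e)) i
  proj-substitution α e i = Equiv.trans (Equiv.sym assoc)
    (Equiv.trans (∘-resp-≈ˡ (proj-tuple _ i)) (·-∣ α proj e i))

  substitution-tuple : ∀ {n m U} (α : Kleisli n m) {b : Fin m → U ⇒ carrier} {d : Fin n → U ⇒ carrier} →
                       α · b ≈ᵈ d → substitution α ∘ tuple b ≈ tuple d
  substitution-tuple {n} α {b} {d} p = power-ext n λ i → begin
    proj i ∘ (substitution α ∘ tuple b)   ≈⟨ proj-substitution α (tuple b) i ⟩
    (α · (proj ∣ᵈ tuple b)) i             ≈⟨ ·-cong α (proj-tuple b) i ⟩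
    (α · b) i                             ≈⟨ p i ⟩
    d i                                   ≈⟨ proj-tuple d i ⟨
    proj i ∘ tuple d                      ∎

  -- Right adjoint to the left Kan extension of n ↦ Dⁿ.
  singular : Functor category (Presheaves □)
  singular = record
    { F₀           = λ A → record
        { F₀           = λ n → hom-setoid (power n) A
        ; F₁           = λ α → record { to = _∘ substitution α ; cong = ∘-resp-≈ˡ }
        ; identity     = λ {n} f → Equiv.trans (∘-resp-≈ʳ (power-ext n λ i →
            Equiv.trans (proj-tuple _ i) (Equiv.sym identityʳ))) identityʳ
        ; homomorphism = λ {_} {_} {_} {α} {β} f → Equiv.trans (∘-resp-≈ʳ (Equiv.sym
            (substitution-tuple α λ i → Equiv.sym (⨟-· α β proj i)))) (Equiv.sym assoc)
        ; F-resp-≈     = λ {n} p f → ∘-resp-≈ʳ (power-ext _ λ i → Equiv.trans (proj-tuple _ i)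
            (Equiv.trans (evalᴰ-sound D (p i) proj) (Equiv.sym (proj-tuple _ i))))
        }
    ; F₁           = λ k → record
        { η       = λ n → record { to = k ∘_ ; cong = ∘-resp-≈ʳ }
        ; commute = λ α f → Equiv.sym assoc
        }
    ; identity     = λ n f → identityˡ
    ; homomorphism = λ n f → assoc
    ; F-resp-≈     = λ p n f → ∘-resp-≈ˡ p
    }

  module Induction (P : Functor (op □) Setoids) where
    open Extension P
    private
      module P = Functor P
      module Pᵉ {n} = Setoid (P.F₀ n)

    -- The identification imposed by the coend: α may act on the tuple or on the element.
    point-substitution : ∀ {n m} (α : Kleisli n m) (x : Setoid.Carrier (P.F₀ n)) →
                         point x ∘ substitution α ≈ point (to (P.F₁ α) x)
    point-substitution α x = faithful λ e → begin
      (point x ∘ substitution α) ∘ e                          ≈⟨ assoc ⟩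
      point x ∘ (substitution α ∘ e)                          ≈⟨ point-∘ x (proj-substitution α e) ⟩
      included (_ , x , α · (proj ∣ᵈ e))                      ≈⟨ included-cong (∼-along x α (λ i → Equiv.refl) Pᵉ.refl) ⟩
      included (_ , to (P.F₁ α) x , proj ∣ᵈ e)                ≈⟨ point-∘ (to (P.F₁ α) x) (λ i → Equiv.refl) ⟨
      point (to (P.F₁ α) x) ∘ e                               ∎

    module _ {A : Obj} (g : NaturalTransformation P (Functor.F₀ singular A)) where

      private
        values : ∀ {c} → Formal c → L₀ c ⇒ A
        values (n , x , d) = to (η g n) x ∘ tuple d

        values-along : ∀ {c n k} (x : Setoid.Carrier (P.F₀ n)) (α : Kleisli n k)
                       {d : Fin n → L₀ c ⇒ carrier} {b : Fin k → L₀ c ⇒ carrier} → α · b ≈ᵈ d →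
                       values (n , x , d) ≈ values (k , to (P.F₁ α) x , b)
        values-along x α p = Equiv.trans (∘-resp-≈ʳ (Equiv.sym (substitution-tuple α p)))
          (Equiv.trans (Equiv.sym assoc) (∘-resp-≈ˡ (Equiv.sym (commute g α x))))

        values-∣ : ∀ {c c′} (p : Formal c) (h : L₀ c′ ⇒ L₀ c) → values (p ∣ᶠ h) ≈ values p ∘ h
        values-∣ (n , x , d) h = Equiv.trans (∘-resp-≈ʳ (power-ext n λ i → Equiv.trans (proj-tuple _ i)
          (Equiv.trans (∘-resp-≈ˡ (Equiv.sym (proj-tuple d i))) assoc))) (Equiv.sym assoc)

        -- Well defined because values do not change along the legs of a span, and equality of
        -- arrows from a generator into `A` may be checked locally.
        induced : Σ[ f ∈ R.object ⇒ A ] (∀ {c} (q : Formal c) → f ∘ included q ≈ values q)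
        induced = extend (realize formal) record
          { η       = λ c → record
              { to   = values
              ; cong = λ {p} {q} r → locally-equal (mapLocal
                  (λ f (k , α , β , b , αb≈d , βb≈e , xα≈yβ) → begin
                    values p ∘ L₁ f                             ≈⟨ values-∣ p (L₁ f) ⟨
                    values (p ∣ᶠ L₁ f)                          ≈⟨ values-along (proj₁ (proj₂ p)) α αb≈d ⟩
                    values (k , to (P.F₁ α) (proj₁ (proj₂ p)) , b) ≈⟨ ∘-resp-≈ˡ (cong (η g k) xα≈yβ) ⟩
                    values (k , to (P.F₁ β) (proj₁ (proj₂ q)) , b) ≈⟨ values-along (proj₁ (proj₂ q)) β βb≈e ⟨
                    values (q ∣ᶠ L₁ f)                          ≈⟨ values-∣ q (L₁ f) ⟩
                    values q ∘ L₁ f                             ∎)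
                  r)
              }
          ; commute = λ f p → values-∣ p (L₁ f)
          }

      induce : R.object ⇒ A
      induce = proj₁ induced

      induce-point : ∀ {n} (x : Setoid.Carrier (P.F₀ n)) → induce ∘ point x ≈ to (η g n) x
      induce-point {n} x = faithful λ e → begin
        (induce ∘ point x) ∘ e                    ≈⟨ assoc ⟩
        induce ∘ (point x ∘ e)                    ≈⟨ ∘-resp-≈ʳ (point-∘ x (λ i → Equiv.refl)) ⟩
        induce ∘ included (n , x , proj ∣ᵈ e)     ≈⟨ proj₂ induced _ ⟩
        to (η g n) x ∘ tuple {n} (proj ∣ᵈ e)          ≈⟨ ∘-resp-≈ʳ (power-ext n λ i → proj-tuple (proj ∣ᵈ e) i) ⟩
        to (η g n) x ∘ e                          ∎

  -- Two descriptions of F*P side by side: as a colimit (`point`, `induce`), used for the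
  -- adjunction, and as a sheafified presheaf of formal sections (`included`, `injective`,
  -- `surjective`), used for left exactness. `point-∘` relates them.
  record LeftExtension (P : Functor (op □) Setoids) : Set₁ where
    open Extension P using (Formal; _∼_; _∣ᶠ_)
    private
      module P = Functor P
      module Pᵉ {n} = Setoid (P.F₀ n)
    field
      object             : Obj
      included           : ∀ {c} → Formal c → L₀ c ⇒ object
      included-cong      : ∀ {c} {p q : Formal c} → p ∼ q → included p ≈ included q
      injective          : ∀ {c} (p q : Formal c) → included p ≈ included q → p ∼ q
      included-∣         : ∀ {c d} (p : Formal c) (f : d S.⇒ c) → included (p ∣ᶠ L₁ f) ≈ included p ∘ L₁ f
      surjective         : ∀ {c} (z : L₀ c ⇒ object) →
                           Local (λ {d} f → Σ[ p ∈ Formal d ] included p ≈ z ∘ L₁ f) (S.id {c})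
      point              : ∀ {n} → Setoid.Carrier (P.F₀ n) → power n ⇒ object
      point-cong         : ∀ {n} {x y : Setoid.Carrier (P.F₀ n)} → x Pᵉ.≈ y → point x ≈ point y
      point-∘            : ∀ {n c} (x : Setoid.Carrier (P.F₀ n)) {e : L₀ c ⇒ power n} {d : Fin n → L₀ c ⇒ carrier} →
                           (∀ (i : Fin n) → proj i ∘ e ≈ d i) → point x ∘ e ≈ included (n , x , d)
      point-substitution : ∀ {n m} (α : Kleisli n m) (x : Setoid.Carrier (P.F₀ n)) →
                           point x ∘ substitution α ≈ point (to (P.F₁ α) x)
      points-epic        : ∀ {A} {f g : object ⇒ A} →
                           (∀ {n} (x : Setoid.Carrier (P.F₀ n)) → f ∘ point x ≈ g ∘ point x) → f ≈ g
      induce             : ∀ {A} → NaturalTransformation P (Functor.F₀ singular A) → object ⇒ A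
      induce-point       : ∀ {A} (g : NaturalTransformation P (Functor.F₀ singular A)) {n}
                           (x : Setoid.Carrier (P.F₀ n)) → induce g ∘ point x ≈ to (η g n) x

  leftExtension : ∀ P → LeftExtension P
  leftExtension P = record
    { object             = R.object
    ; included           = included
    ; included-cong      = included-cong
    -- Local injectivity of the realization gives `_∼_` after a cover; the two nested local
    -- statements collapse into one.
    ; injective          = λ p q e → R.injective p q e >>= λ f → mapLocal λ g →
        refinement-cong (λ i → L-triangle S.Equiv.refl) (λ i → L-triangle S.Equiv.refl)
    ; included-∣         = λ p f → commute R.include f p
    ; surjective         = R.surjective
    ; point              = point
    ; point-cong         = point-cong
    ; point-∘            = point-∘
    ; point-substitution = point-substitution
    ; points-epic        = points-epic
    ; induce             = induce
    ; induce-point       = induce-point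
    } where
      open Extension P
      open Induction P

-- The extension as a left exact left adjoint

module LeftExactness {X : GrothendieckTopos} (generated : Generators X) (D : InternalDL X) (flat : Flat X D)
                     (extension : ∀ P → FlatExtension.LeftExtension generated D flat P) where
  open GrothendieckTopos X
  open GeneratedTopos generated hiding (surjective₂)
  open InternalDL D using (carrier)
  open Power X carrier
  open LocalTruth site
  open HomReasoning
  open FlatExtension generated D flat hiding (leftExtension)
  private
    module S = Site site
    module Psh = GrothendieckTopos cubicalSets
    module Ext P = LeftExtension (extension P)

  module _ {P Q : Psh.Obj} (h : P Psh.⇒ Q) where
    private
      module P = Ext P
      module Q = Ext Q

    pointsOf : NaturalTransformation P (Functor.F₀ singular Q.object)
    pointsOf = record
      { η       = λ n → record
          { to   = λ x → Q.point (to (η h n) x)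
          ; cong = λ p → Q.point-cong (cong (η h n) p)
          }
      ; commute = λ {n} {m} α x → Equiv.trans (Q.point-cong (commute h α x))
          (Equiv.sym (Q.point-substitution α (to (η h n) x)))
      }

    map : P.object ⇒ Q.object
    map = P.induce pointsOf

    map-point : ∀ {n} (x : Setoid.Carrier (Functor.F₀ P n)) → map ∘ P.point x ≈ Q.point (to (η h n) x)
    map-point x = P.induce-point pointsOf x

    map-included : ∀ {c n} (x : Setoid.Carrier (Functor.F₀ P n)) (d : Fin n → L₀ c ⇒ carrier) →
                   map ∘ P.included (n , x , d) ≈ Q.included (n , to (η h n) x , d)
    map-included {n = n} x d = begin
      map ∘ P.included (n , x , d)         ≈⟨ ∘-resp-≈ʳ (P.point-∘ x (proj-tuple d)) ⟨
      map ∘ (P.point x ∘ tuple d)          ≈⟨ assoc ⟨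
      (map ∘ P.point x) ∘ tuple d          ≈⟨ ∘-resp-≈ˡ (map-point x) ⟩
      Q.point (to (η h n) x) ∘ tuple d     ≈⟨ Q.point-∘ (to (η h n) x) (proj-tuple d) ⟩
      Q.included (n , to (η h n) x , d)    ∎

  realization : Functor (Presheaves □) category
  realization = record
    { F₀           = Ext.object
    ; F₁           = map
    ; identity     = λ {P} → Ext.points-epic P λ x → Equiv.trans (map-point Psh.id x) (Equiv.sym identityˡ)
    ; homomorphism = λ {P} {Q} {R} {f} {g} → Ext.points-epic P λ {n} x → begin
        map (g Psh.∘ f) ∘ Ext.point P x           ≈⟨ map-point (g Psh.∘ f) x ⟩
        Ext.point R (to (η g n) (to (η f n) x))   ≈⟨ map-point g (to (η f n) x) ⟨
        map g ∘ Ext.point Q (to (η f n) x)        ≈⟨ ∘-resp-≈ʳ (map-point f x) ⟨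
        map g ∘ (map f ∘ Ext.point P x)           ≈⟨ assoc ⟨
        (map g ∘ map f) ∘ Ext.point P x           ∎
    ; F-resp-≈     = λ {P} {Q} {f} {g} p → Ext.points-epic P λ {n} x →
        Equiv.trans (map-point f x) (Equiv.trans (Ext.point-cong Q (p n x)) (Equiv.sym (map-point g x)))
    }

  realization⊣singular : realization ⊣ singular
  realization⊣singular = record
    { φ      = λ {P} {A} f → record
        { η       = λ n → record { to = λ x → f ∘ Ext.point P x ; cong = λ p → ∘-resp-≈ʳ (Ext.point-cong P p) }
        ; commute = λ α x → Equiv.trans (∘-resp-≈ʳ (Equiv.sym (Ext.point-substitution P α x))) (Equiv.sym assoc)
        }
    ; ψ      = λ {P} g → Ext.induce P g
    ; φ-cong = λ p n x → ∘-resp-≈ˡ p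
    ; ψ-cong = λ {P} {A} {f} {g} p → Ext.points-epic P λ {n} x →
        Equiv.trans (Ext.induce-point P f x) (Equiv.trans (p n x) (Equiv.sym (Ext.induce-point P g x)))
    ; ψφ     = λ {P} f → Ext.points-epic P λ x → Ext.induce-point P _ x
    ; φψ     = λ {P} g n x → Ext.induce-point P g x
    ; φ-nat  = λ {P} {P′} h f k n x → Equiv.trans assoc (∘-resp-≈ʳ
        (Equiv.trans assoc (∘-resp-≈ʳ (map-point h x))))
    }

  surjective₂ : ∀ P Q {c} (z : L₀ c ⇒ Ext.object P) (z′ : L₀ c ⇒ Ext.object Q) →
                Local (λ {d} f → Σ[ p ∈ Extension.Formal P d ] Σ[ q ∈ Extension.Formal Q d ]
                  (Ext.included P p ≈ z ∘ L₁ f) × (Ext.included Q q ≈ z′ ∘ L₁ f)) (S.id {c})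
  surjective₂ P Q z z′ = Ext.surjective P z >>= λ f (p , e) → mapLocal
    (λ g (q , e′) → Extension._∣ᶠ_ P p (L₁ g) , q
      , Equiv.trans (Ext.included-∣ P p g) (Equiv.trans (∘-resp-≈ˡ e) (L-triangle S.Equiv.refl))
      , Equiv.trans e′ (L-triangle S.Equiv.refl))
    (Ext.surjective Q (z′ ∘ L₁ f))

  -- Each condition comes with a span of its own, whereas joint injectivity needs a single span for
  -- all of them. Finiteness of the family permits merging them one at a time by `refine-both`.
  refine-all : ∀ {n m c} {d : Fin n → L₀ c ⇒ carrier} {e : Fin m → L₀ c ⇒ carrier} {k}
               (R : Fin k → ∀ {l} → Kleisli n l → Kleisli m l → Set) → (∀ i → Closed (R i)) →
               (∀ i → Local (λ f → Refinement (d ∣ᵈ L₁ f) (e ∣ᵈ L₁ f) (R i)) (S.id {c})) →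
               Local (λ f → Refinement (d ∣ᵈ L₁ f) (e ∣ᵈ L₁ f) (λ α β → ∀ i → R i α β)) (S.id {c})
  -- With no conditions there is no span to start from; the concatenation of the two tuples provides
  -- one.
  refine-all {n} {d = d} {e} {k = zero} R closed r = now (refinement-∣ (L₁ S.id)
    (_ , left , right {n} , d ++ e , left-++ d e , right-++ d e , λ ()))
  refine-all {k = suc k} R closed r =
    both refinement-stable refinement-stable (r zero)
      (refine-all (λ i → R (suc i)) (λ i → closed (suc i)) (λ i → r (suc i))) >>=
    λ f (s , t) → mapLocal
      (λ g (l , α , β , b , p , q , u , v) → refinement-cong
        (λ i → L-triangle S.Equiv.refl) (λ i → L-triangle S.Equiv.refl)
        (l , α , β , b , p , q , λ where
          zero    → u
          (suc i) → v i))
      (refine-both (closed zero) (λ γ p q v i → closed (suc i) γ p q (v i)) s t)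

  module _ {k} {P : Psh.Obj} {A : Fin k → Psh.Obj} (f : ∀ i → P Psh.⇒ A i)
           (injective : ∀ {n} {x y : Setoid.Carrier (Functor.F₀ P n)} →
             (∀ i → Setoid._≈_ (Functor.F₀ (A i) n) (to (η (f i) n) x) (to (η (f i) n) y)) →
             Setoid._≈_ (Functor.F₀ P n) x y) where
    private
      module A i = Ext (A i)
      module A′ i = Extension (A i)
      module P = Ext P

    -- Equality of the images gives, for each `i`, a local span on which the i-th images agree. On a
    -- common span all images of the two refined elements agree, so these elements of `P` are equal
    -- by hypothesis. The empty family is allowed and serves the terminal object.
    map-jointlyMonic : JointlyMonic (λ i → map (f i))
    map-jointlyMonic z z′ p = locally-equal (mapLocal
      (λ g ((n , x , d) , (m , y , e) , q , q′) →
        let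
          same : ∀ i → A.included i (n , to (η (f i) n) x , d) ≈ A.included i (m , to (η (f i) m) y , e)
          same i = begin
            A.included i (n , to (η (f i) n) x , d)      ≈⟨ map-included (f i) x d ⟨
            map (f i) ∘ P.included (n , x , d)   ≈⟨ ∘-resp-≈ʳ q ⟩
            map (f i) ∘ (z ∘ L₁ g)               ≈⟨ assoc ⟨
            (map (f i) ∘ z) ∘ L₁ g               ≈⟨ ∘-resp-≈ˡ (p i) ⟩
            (map (f i) ∘ z′) ∘ L₁ g              ≈⟨ assoc ⟩
            map (f i) ∘ (z′ ∘ L₁ g)              ≈⟨ ∘-resp-≈ʳ q′ ⟨
            map (f i) ∘ P.included (m , y , e)   ≈⟨ map-included (f i) y e ⟩
            A.included i (m , to (η (f i) m) y , e)      ∎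
        in Equiv.trans (Equiv.sym q) (Equiv.trans
          (P.included-cong (mapLocal
            (λ h (l , α , β , b , αb≈d , βb≈e , s) → l , α , β , b , αb≈d , βb≈e , injective λ i →
              Setoid.trans (Functor.F₀ (A i) l) (commute (f i) α x)
                (Setoid.trans (Functor.F₀ (A i) l) (s i) (Setoid.sym (Functor.F₀ (A i) l) (commute (f i) β y))))
            (refine-all (λ i → A′.Same i (to (η (f i) n) x) (to (η (f i) m) y))
              (λ i → A′.Same-closed i {x = to (η (f i) n) x} {to (η (f i) m) y})
              (λ i → A.injective i (n , to (η (f i) n) x , d) (m , to (η (f i) m) y , e) (same i)))))
          q′))
      (surjective₂ P P z z′))

  -- The common tuple is the concatenation of the two given ones; each element is weakened along its
  -- inclusion of variables, which does not change its class.
  chart₂ : ∀ (P Q : Psh.Obj) {c} (z : L₀ c ⇒ Ext.object P) (z′ : L₀ c ⇒ Ext.object Q) →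
           Local (λ {w} f → Σ[ n ∈ ℕ ] Σ[ x ∈ Setoid.Carrier (Functor.F₀ P n) ]
             Σ[ y ∈ Setoid.Carrier (Functor.F₀ Q n) ] Σ[ d ∈ (Fin n → L₀ w ⇒ carrier) ]
             (Ext.included P (n , x , d) ≈ z ∘ L₁ f) × (Ext.included Q (n , y , d) ≈ z′ ∘ L₁ f)) (S.id {c})
  chart₂ P Q z z′ = mapLocal
    (λ f ((n , x , d) , (m , y , e) , p , q) →
      n + m , to (Functor.F₁ P (left {n} {m})) x , to (Functor.F₁ Q (right {n} {m})) y , d ++ e
      , Equiv.trans (Equiv.sym (Ext.included-cong P (Extension.∼-along P x left (left-++ d e)
          (Setoid.refl (Functor.F₀ P (n + m)))))) p
      , Equiv.trans (Equiv.sym (Ext.included-cong Q (Extension.∼-along Q y (right {n}) (right-++ d e)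
          (Setoid.refl (Functor.F₀ Q (n + m)))))) q)
    (surjective₂ P Q z z′)

  open Yoneda using (よ; element)

  element-naturality : ∀ {P Q : Psh.Obj} (h : P Psh.⇒ Q) {n} (x : Setoid.Carrier (Functor.F₀ P n))
                       {y : Setoid.Carrier (Functor.F₀ Q n)} → Setoid._≈_ (Functor.F₀ Q n) (to (η h n) x) y →
                       h Psh.∘ element P x Psh.≈ element Q y
  element-naturality {Q = Q} h x p c γ =
    Setoid.trans (Functor.F₀ Q c) (commute h γ x) (cong (Functor.F₁ Q γ) p)

  element-injective : ∀ {P : Psh.Obj} {n} {x y : Setoid.Carrier (Functor.F₀ P n)} →
                      element P x Psh.≈ element P y → Setoid._≈_ (Functor.F₀ P n) x y
  element-injective {P} {n} {x} {y} p = trans (sym (Functor.identity P x)) (trans (p n var) (Functor.identity P y))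
    where open Setoid (Functor.F₀ P n)

  name : ∀ {P : Psh.Obj} {n} → よ n Psh.⇒ P → Setoid.Carrier (Functor.F₀ P n)
  name {n = n} h = to (η h n) var

  realization-terminal : ∀ {T} → IsTerminal Psh.category T → IsTerminal category (Ext.object T)
  realization-terminal {T} isTerminal = record
    -- Over any point the lift is the empty tuple paired with the element of `T` at dimension 0 that
    -- the unique map from the 0-cube names.
    { !        = proj₁ (lift maps monic (λ ()) λ x → now (Ext.included T (0 , name {T} T.! , λ ()) , λ ()))
    ; !-unique = λ f → jointlyMonic⇒unique maps monic λ ()
    } where
    module T = IsTerminal isTerminal

    family : ∀ i → T Psh.⇒ (λ (_ : Fin 0) → T) i
    family ()

    maps : (i : Fin 0) → Ext.object T ⇒ Ext.object T
    maps i = map (family i)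

    monic : JointlyMonic maps
    monic = map-jointlyMonic family λ {n} {x} {y} _ → element-injective {T}
      (Psh.Equiv.trans {_} {_} {element T x} {T.!} {element T y}
        (Psh.Equiv.sym {_} {_} {T.!} {element T x} (T.!-unique (element T x))) (T.!-unique (element T y)))

  -- `chart₂` brings sections of both factors to elements at the same `n` over one tuple. Since `P`
  -- is known only by its universal property, the pair is formed as a map out of the n-cube and read
  -- off by `name`.
  realization-product : ∀ {A B P} {p : P Psh.⇒ A} {q : P Psh.⇒ B} → IsProduct Psh.category p q →
                        IsProduct category (map p) (map q)
  realization-product {A} {B} {P} {p} {q} isProduct = record
    { ⟨_,_⟩    = λ f g → proj₁ (pair f g)
    ; project₁ = λ {_} {f} {g} → proj₂ (pair f g) zero
    ; project₂ = λ {_} {f} {g} → proj₂ (pair f g) (suc zero)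
    ; unique   = λ {_} {f} {g} r s → jointlyMonic⇒unique maps monic λ where
        zero       → Equiv.trans (proj₂ (pair f g) zero) (Equiv.sym r)
        (suc zero) → Equiv.trans (proj₂ (pair f g) (suc zero)) (Equiv.sym s)
    } where
    module P = IsProduct isProduct

    factor : Fin 2 → Psh.Obj
    factor zero       = A
    factor (suc zero) = B

    family : ∀ i → P Psh.⇒ factor i
    family zero       = p
    family (suc zero) = q

    maps : ∀ i → Ext.object P ⇒ Ext.object (factor i)
    maps i = map (family i)

    monic : JointlyMonic maps
    monic = map-jointlyMonic {A = factor} family λ {n} {x} {y} e →
      let a  = element A (to (η p n) y)
          b  = element B (to (η q n) y)
          ab = P.⟨ a , b ⟩
      in element-injective {P} (Psh.Equiv.trans {_} {_} {element P x} {ab} {element P y}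
        (Psh.Equiv.sym {_} {_} {ab} {element P x} (P.unique {f = a} {b} {element P x}
          (element-naturality p x (e zero)) (element-naturality q x (e (suc zero)))))
        (P.unique {f = a} {b} {element P y} (element-naturality p y (Setoid.refl (Functor.F₀ A n)))
          (element-naturality q y (Setoid.refl (Functor.F₀ B n)))))

    module _ {U} (f : U ⇒ Ext.object A) (g : U ⇒ Ext.object B) where
      legs : ∀ i → U ⇒ Ext.object (factor i)
      legs zero       = f
      legs (suc zero) = g

      pair : Σ[ k ∈ U ⇒ Ext.object P ] (∀ i → maps i ∘ k ≈ legs i)
      pair = lift maps monic legs λ x → mapLocal
        (λ h (n , a , b , d , r , s) →
          let ab = P.⟨ element A a , element B b ⟩ in
          Ext.included P (n , name {P} ab , d) , λ where
            zero       → Equiv.trans (map-included p (name {P} ab) d) (Equiv.trans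
              (Ext.included-cong A (Extension.∼-pointwise A (Setoid.trans (Functor.F₀ A n)
                (P.project₁ {f = element A a} {element B b} n var) (Functor.identity A a)) (λ i → Equiv.refl)))
              (Equiv.trans r assoc))
            (suc zero) → Equiv.trans (map-included q (name {P} ab) d) (Equiv.trans
              (Ext.included-cong B (Extension.∼-pointwise B (Setoid.trans (Functor.F₀ B n)
                (P.project₂ {f = element A a} {element B b} n var) (Functor.identity B b)) (λ i → Equiv.refl)))
              (Equiv.trans s assoc)))
        (chart₂ A B (f ∘ x) (g ∘ x))

  realization-equalizer : ∀ {A B E} {m : E Psh.⇒ A} {f g : A Psh.⇒ B} → IsEqualizer Psh.category m f g →
                          IsEqualizer category (map m) (map f) (map g)
  realization-equalizer {A} {B} {E} {m} {f} {g} isEqualizer = record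
    { equality  = Equiv.trans (Equiv.sym homomorphism) (Equiv.trans
        (F-resp-≈ {f = f Psh.∘ m} {g Psh.∘ m} E.equality) homomorphism)
    ; equalize  = λ p → proj₁ (factor p)
    ; universal = λ {_} {_} {p} → proj₂ (factor p) zero
    ; unique    = λ {_} {_} {p} q → jointlyMonic⇒unique maps monic
        λ i → Equiv.trans (proj₂ (factor p) i) (Equiv.sym q)
    } where
    module E = IsEqualizer isEqualizer
    open Functor realization using (homomorphism; F-resp-≈)

    family : Fin 1 → E Psh.⇒ A
    family _ = m

    maps : Fin 1 → Ext.object E ⇒ Ext.object A
    maps i = map (family i)

    solves : ∀ {n} (a : Setoid.Carrier (Functor.F₀ A n)) →
             Setoid._≈_ (Functor.F₀ B n) (to (η f n) a) (to (η g n) a) →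
             f Psh.∘ element A a Psh.≈ g Psh.∘ element A a
    solves {n} a p = Psh.Equiv.trans {_} {_} {f Psh.∘ element A a} {element B (to (η g n) a)} {g Psh.∘ element A a}
      (element-naturality f a p)
      (Psh.Equiv.sym {_} {_} {g Psh.∘ element A a} {element B (to (η g n) a)}
        (element-naturality g a (Setoid.refl (Functor.F₀ B n))))

    monic : JointlyMonic maps
    monic = map-jointlyMonic {A = λ _ → A} family λ {n} {x} {y} e →
      let p = Psh.Equiv.trans {_} {_} {f Psh.∘ (m Psh.∘ element E y)} {g Psh.∘ (m Psh.∘ element E y)}
                {g Psh.∘ (m Psh.∘ element E y)}
                (λ c γ → E.equality c (to (Functor.F₁ E γ) y)) (λ c γ → Setoid.refl (Functor.F₀ B c))
          k = E.equalize {h = m Psh.∘ element E y} p in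
      element-injective {E} (Psh.Equiv.trans {_} {_} {element E x} {k} {element E y}
        (Psh.Equiv.sym {_} {_} {k} {element E x} (E.unique {p = p} {element E x}
          (λ c γ → Setoid.trans (Functor.F₀ A c) (commute m γ x) (Setoid.trans (Functor.F₀ A c)
            (cong (Functor.F₁ A γ) (e zero)) (Setoid.sym (Functor.F₀ A c) (commute m γ y))))))
        (E.unique {p = p} {element E y} (λ c γ → Setoid.refl (Functor.F₀ A c))))

    -- Equality of the two images of a section `(n , a , d)` gives only a span whose legs α and β
    -- may differ, with `f` applied to a·α equal to `g` applied to a·β. Both legs evaluate to `d`,
    -- so flatness equalizes them after some γ; then a·(αγ) equalizes `f` and `g` and comes from
    -- `E`.
    solution : ∀ {c} (z : L₀ c ⇒ Ext.object A) → map f ∘ z ≈ map g ∘ z →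
               Local (λ h → Σ[ w ∈ L₀ _ ⇒ Ext.object E ] (map m ∘ w ≈ z ∘ L₁ h)) (S.id {c})
    solution z p = Ext.surjective A z >>= λ h ((n , a , d) , q) →
      Ext.injective B (n , to (η f n) a , d) (n , to (η g n) a , d)
        (Equiv.trans (Equiv.sym (map-included f a d)) (Equiv.trans
          (Equiv.trans (∘-resp-≈ʳ q) (Equiv.trans (Equiv.sym assoc) (Equiv.trans (∘-resp-≈ˡ p)
            (Equiv.trans assoc (∘-resp-≈ʳ (Equiv.sym q))))))
          (map-included g a d))) >>=
      λ h′ (k , α , β , b , αb≈d , βb≈d , fα≈gβ) → mapLocal
        (λ h″ (l , γ , b′ , αγ≋βγ , γb′≈b) →
          let a′ = to (Functor.F₁ A (α ⨟ γ)) a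
              r  = solves a′ (Setoid.trans (Functor.F₀ B l) (commute f (α ⨟ γ) a)
                     (Setoid.trans (Functor.F₀ B l)
                       (Extension.Same-closed B {x = to (η f n) a} {to (η g n) a} γ (λ i → ≋-refl)
                         (λ i → ≋-sym (αγ≋βγ i)) fα≈gβ)
                       (Setoid.sym (Functor.F₀ B l) (commute g (α ⨟ γ) a))))
              e  = E.equalize {h = element A a′} r
          in Ext.included E (l , name {E} e , b′) , (begin
            map m ∘ Ext.included E (l , name {E} e , b′)      ≈⟨ map-included m (name {E} e) b′ ⟩
            Ext.included A (l , to (η m l) (name {E} e) , b′) ≈⟨ Ext.included-cong A (Extension.∼-pointwise A
              (Setoid.trans (Functor.F₀ A l) (E.universal {p = r} l var) (Functor.identity A a′)) (λ i → Equiv.refl)) ⟩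
            Ext.included A (l , a′ , b′)                      ≈⟨ Ext.included-cong A (Extension.∼-along A a (α ⨟ γ)
              (λ i → Equiv.trans (⨟-· α γ b′ i) (Equiv.trans (solve-∘ α γ αb≈d γb′≈b i)
                (L-triangle S.Equiv.refl))) (Setoid.refl (Functor.F₀ A l))) ⟨
            Ext.included A (n , a , d ∣ᵈ L₁ (h′ S.∘ h″))       ≈⟨ Ext.included-∣ A (n , a , d) (h′ S.∘ h″) ⟩
            Ext.included A (n , a , d) ∘ L₁ (h′ S.∘ h″)        ≈⟨ ∘-resp-≈ˡ q ⟩
            (z ∘ L₁ h) ∘ L₁ (h′ S.∘ h″)                        ≈⟨ L-triangle S.Equiv.refl ⟩
            z ∘ L₁ (h S.∘ (h′ S.∘ h″))                         ∎))
        (flat-locally α β b λ i → Equiv.trans (αb≈d i) (Equiv.sym (βb≈d i)))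

    factor : ∀ {U} {h : U ⇒ Ext.object A} → map f ∘ h ≈ map g ∘ h →
             Σ[ k ∈ U ⇒ Ext.object E ] ((i : Fin 1) → maps i ∘ k ≈ h)
    factor {h = h} p = lift maps monic (λ _ → h) λ x → mapLocal
      (λ k (w , e) → w , λ i → Equiv.trans e assoc)
      (solution (h ∘ x) (Equiv.trans (Equiv.sym assoc) (Equiv.trans (∘-resp-≈ˡ p) assoc)))

-- The equivalence and its naturality

module FromFullyFaithful {o ℓ e o′ ℓ′ e′} {C : Category o ℓ e} {D : Category o′ ℓ′ e′} (K : Functor C D) where
  private
    module C = Category C
    module K = Functor K
  open Category D
  open HomReasoning

  module _ (full : ∀ {A B} (h : K.F₀ A ⇒ K.F₀ B) → Σ[ f ∈ A C.⇒ B ] K.F₁ f ≈ h)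
           (faithful : ∀ {A B} {f g : A C.⇒ B} → K.F₁ f ≈ K.F₁ g → f C.≈ g)
           (G : Obj → C.Obj) (ε : ∀ B → K.F₀ (G B) ⇒ B) (ε⁻¹ : ∀ B → B ⇒ K.F₀ (G B))
           (ε⁻¹∘ε : ∀ B → ε⁻¹ B ∘ ε B ≈ id) (ε∘ε⁻¹ : ∀ B → ε B ∘ ε⁻¹ B ≈ id) where

    private
      preimage : ∀ {A B} → K.F₀ A ⇒ K.F₀ B → A C.⇒ B
      preimage h = proj₁ (full h)

      K-preimage : ∀ {A B} (h : K.F₀ A ⇒ K.F₀ B) → K.F₁ (preimage h) ≈ h
      K-preimage h = proj₂ (full h)

      conjugate : ∀ {A B} → A ⇒ B → K.F₀ (G A) ⇒ K.F₀ (G B)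
      conjugate {A} {B} h = ε⁻¹ B ∘ (h ∘ ε A)

      ε-conjugate : ∀ {A B} (h : A ⇒ B) → ε B ∘ conjugate h ≈ h ∘ ε A
      ε-conjugate {B = B} h = Equiv.trans (Equiv.sym assoc) (Equiv.trans (∘-resp-≈ˡ (ε∘ε⁻¹ B)) identityˡ)

      conjugate-ε⁻¹ : ∀ {A B} (h : A ⇒ B) → conjugate h ∘ ε⁻¹ A ≈ ε⁻¹ B ∘ h
      conjugate-ε⁻¹ {A} h = Equiv.trans assoc (∘-resp-≈ʳ (Equiv.trans assoc
        (Equiv.trans (∘-resp-≈ʳ (ε∘ε⁻¹ A)) identityʳ)))

      K-∘ : ∀ {A B E} {f : A C.⇒ B} {g : B C.⇒ E} {h k} → K.F₁ f ≈ h → K.F₁ g ≈ k → K.F₁ (g C.∘ f) ≈ k ∘ h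
      K-∘ p q = Equiv.trans K.homomorphism (∘-resp-≈ q p)

    -- `G` is given on objects only. Its action on arrows is the preimage of conjugation by `ε`, and
    -- equations in `C` are checked after applying `K`.
    isEquivalence : IsEquivalenceOfCategories K
    isEquivalence = record
      { inverse = record
          { F₀           = G
          ; F₁           = λ h → preimage (conjugate h)
          ; identity     = λ {A} → faithful (Equiv.trans (K-preimage _) (Equiv.trans (∘-resp-≈ʳ identityˡ)
              (Equiv.trans (ε⁻¹∘ε A) (Equiv.sym K.identity))))
          ; homomorphism = λ {A} {B} {E} {f} {g} → faithful (begin
              K.F₁ (preimage (conjugate (g ∘ f)))  ≈⟨ K-preimage _ ⟩
              ε⁻¹ E ∘ ((g ∘ f) ∘ ε A)              ≈⟨ ∘-resp-≈ʳ (Equiv.trans assoc (∘-resp-≈ʳ (Equiv.sym (ε-conjugate f)))) ⟩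
              ε⁻¹ E ∘ (g ∘ (ε B ∘ conjugate f))    ≈⟨ Equiv.trans (∘-resp-≈ʳ (Equiv.sym assoc)) (Equiv.sym assoc) ⟩
              conjugate g ∘ conjugate f            ≈⟨ K-∘ (K-preimage _) (K-preimage _) ⟨
              K.F₁ (preimage (conjugate g) C.∘ preimage (conjugate f)) ∎)
          ; F-resp-≈     = λ p → faithful (Equiv.trans (K-preimage _)
              (Equiv.trans (∘-resp-≈ʳ (∘-resp-≈ˡ p)) (Equiv.sym (K-preimage _))))
          }
      ; unit    = record
          { F⇒G  = record
              { η       = λ A → preimage (ε⁻¹ (K.F₀ A))
              ; commute = λ f → faithful (Equiv.trans (K-∘ Equiv.refl (K-preimage _))
                  (Equiv.sym (Equiv.trans (K-∘ (K-preimage _) (K-preimage _)) (conjugate-ε⁻¹ (K.F₁ f)))))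
              }
          ; F⇐G  = record
              { η       = λ A → preimage (ε (K.F₀ A))
              ; commute = λ f → faithful (Equiv.trans (K-∘ (K-preimage _) (K-preimage _))
                  (Equiv.trans (ε-conjugate (K.F₁ f)) (Equiv.sym (K-∘ (K-preimage _) Equiv.refl))))
              }
          ; isoˡ = λ A → faithful (Equiv.trans (K-∘ (K-preimage _) (K-preimage _))
              (Equiv.trans (ε∘ε⁻¹ (K.F₀ A)) (Equiv.sym K.identity)))
          ; isoʳ = λ A → faithful (Equiv.trans (K-∘ (K-preimage _) (K-preimage _))
              (Equiv.trans (ε⁻¹∘ε (K.F₀ A)) (Equiv.sym K.identity)))
          }
      ; counit  = record
          { F⇒G  = record
              { η       = ε
              ; commute = λ h → Equiv.trans (∘-resp-≈ʳ (K-preimage _)) (ε-conjugate h)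
              }
          ; F⇐G  = record
              { η       = ε⁻¹
              ; commute = λ h → Equiv.sym (Equiv.trans (∘-resp-≈ˡ (K-preimage _)) (conjugate-ε⁻¹ h))
              }
          ; isoˡ = ε⁻¹∘ε
          ; isoʳ = ε∘ε⁻¹
          }
      }

module InverseHom {X : GrothendieckTopos} {D E : InternalDL X} (f : LatticeHom X D E) where
  open GrothendieckTopos X
  open Evaluation X using (binary-∘; preserves-binary)
  open LatticeHom f
  private
    module D = InternalDL D
    module E = InternalDL E

  module _ (g : E.carrier ⇒ D.carrier) (g∘f : g ∘ hom ≈ id) (f∘g : hom ∘ g ≈ id) where
    private
      transport : ∀ {U} {x : U ⇒ D.carrier} {y : U ⇒ E.carrier} → hom ∘ x ≈ y → g ∘ y ≈ x
      transport p = Equiv.trans (∘-resp-≈ʳ (Equiv.sym p)) (Equiv.trans (Equiv.sym assoc)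
        (Equiv.trans (∘-resp-≈ˡ g∘f) identityˡ))

      binary : ∀ {m : (D.carrier ⊗ D.carrier) ⇒ D.carrier} {m′ : (E.carrier ⊗ E.carrier) ⇒ E.carrier} →
               hom ∘ m ≈ m′ ∘ ⟨ hom ∘ π₁ , hom ∘ π₂ ⟩ → g ∘ m′ ≈ m ∘ ⟨ g ∘ π₁ , g ∘ π₂ ⟩
      binary p = transport (Equiv.trans (preserves-binary f p) (Equiv.trans (∘-resp-≈ʳ (unique
        (Equiv.trans identityʳ (cancel π₁)) (Equiv.trans identityʳ (cancel π₂)))) identityʳ))
        where
        cancel : ∀ {U} (x : U ⇒ E.carrier) → x ≈ hom ∘ (g ∘ x)
        cancel x = Equiv.sym (Equiv.trans (Equiv.sym assoc) (Equiv.trans (∘-resp-≈ˡ f∘g) identityˡ))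

    inverseHom : LatticeHom X E D
    inverseHom = record
      { hom           = g
      ; preserve-join = binary preserve-join
      ; preserve-meet = binary preserve-meet
      ; preserve-top  = transport preserve-top
      ; preserve-bot  = transport preserve-bot
      }

record Classification {X : GrothendieckTopos} (D : InternalDL X) : Set₁ where
  open GrothendieckTopos X
  field
    morphism : GeometricMorphism X cubicalSets
    ε        : LatticeHom X (inverseImageDL morphism 𝕀) D
    ι        : LatticeHom X D (inverseImageDL morphism 𝕀)
    ι∘ε      : LatticeHom.hom ι ∘ LatticeHom.hom ε ≈ id
    ε∘ι      : LatticeHom.hom ε ∘ LatticeHom.hom ι ≈ id

-- The classifying morphism of a flat lattice

module ClassifyingMorphism {X : GrothendieckTopos} (generated : Generators X) (D : InternalDL X) (flat : Flat X D)
                           (extension : ∀ P → FlatExtension.LeftExtension generated D flat P) where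
  open GrothendieckTopos X
  open Evaluation X
  open FlatExtension generated D flat hiding (leftExtension)
  open LeftExactness generated D flat extension
  open InternalDL D using (carrier; _·_)
  open Power X carrier
  open Yoneda using (interval; coordinate; element)
  open HomReasoning
  private
    module 𝕀* = LeftExtension (extension interval)
    module E = GrothendieckTopos cubicalSets

  morphism : GeometricMorphism X cubicalSets
  morphism = record
    { inverseImage = realization
    ; directImage  = singular
    ; adjoint      = realization⊣singular
    ; leftExact    = record
        { terminal  = realization-terminal
        ; product   = realization-product
        ; equalizer = realization-equalizer
        }
    }

  D′ : InternalDL X
  D′ = inverseImageDL morphism 𝕀

  -- The transpose of `ε`: an element of the interval at n is a term, and it acts as a polynomial
  -- map from Dⁿ to D.
  terms : NaturalTransformation interval (Functor.F₀ singular carrier)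
  terms = record
    { η       = λ n → record
        { to   = λ t → evalᴰ D t proj
        ; cong = λ p → evalᴰ-sound D p proj
        }
    ; commute = λ α t → Equiv.trans (evalᴰ-[] D t α proj) (Equiv.sym (Equiv.trans (eval-∘ D t proj (substitution α))
        (evalᴰ-cong D t (proj-tuple _))))
    }

  ε : 𝕀*.object ⇒ carrier
  ε = 𝕀*.induce terms

  -- The coprojection at the generic element `var zero` of the interval in dimension 1, precomposed
  -- with the identification of D with D¹.
  ι : carrier ⇒ 𝕀*.object
  ι = 𝕀*.point {1} (var zero) ∘ tuple (λ (_ : Fin 1) → id)

  -- A term `t` is the restriction of `var zero` along the Kleisli map `δ` that picks it out, so the
  -- coend relation moves `t` from the tuple to the element.
  ι-eval : ∀ {n U} (t : Term n) (d : Fin n → U ⇒ carrier) → ι ∘ evalᴰ D t d ≈ 𝕀*.point t ∘ tuple d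
  ι-eval {n} t d = begin
    ι ∘ evalᴰ D t d
      ≈⟨ assoc ⟩
    𝕀*.point (var zero) ∘ (tuple (λ (_ : Fin 1) → id) ∘ evalᴰ D t d)
      ≈⟨ ∘-resp-≈ʳ (power-ext 1 λ i → Equiv.trans (Equiv.sym assoc)
           (Equiv.trans (∘-resp-≈ˡ (proj-tuple _ i)) (Equiv.trans identityˡ (Equiv.sym (proj-tuple _ i))))) ⟩
    𝕀*.point (var zero) ∘ tuple {1} (δ · d)
      ≈⟨ ∘-resp-≈ʳ (substitution-tuple δ (λ i → Equiv.refl)) ⟨
    𝕀*.point (var zero) ∘ (substitution δ ∘ tuple d)
      ≈⟨ assoc ⟨
    (𝕀*.point (var zero) ∘ substitution δ) ∘ tuple d
      ≈⟨ ∘-resp-≈ˡ (𝕀*.point-substitution δ (var zero)) ⟩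
    𝕀*.point t ∘ tuple d
      ∎
    where
    δ : Kleisli 1 n
    δ _ = t

  ε∘ι : ε ∘ ι ≈ id
  ε∘ι = begin
    ε ∘ ι                                                           ≈⟨ assoc ⟨
    (ε ∘ 𝕀*.point (var zero)) ∘ tuple (λ (_ : Fin 1) → id)          ≈⟨ ∘-resp-≈ˡ (𝕀*.induce-point terms (var zero)) ⟩
    proj {1} zero ∘ tuple (λ (_ : Fin 1) → id)                      ≈⟨ proj-tuple {1} (λ _ → id) zero ⟩
    id                                                              ∎

  ι∘ε : ι ∘ ε ≈ id
  ι∘ε = 𝕀*.points-epic λ {n} t → begin
    (ι ∘ ε) ∘ 𝕀*.point t               ≈⟨ assoc ⟩
    ι ∘ (ε ∘ 𝕀*.point t)               ≈⟨ ∘-resp-≈ʳ (𝕀*.induce-point terms t) ⟩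
    ι ∘ evalᴰ D t proj                 ≈⟨ ι-eval t proj ⟩
    𝕀*.point t ∘ tuple (proj {n})      ≈⟨ ∘-resp-≈ʳ (power-ext n λ i →
      Equiv.trans (proj-tuple _ i) (Equiv.sym identityʳ)) ⟩
    𝕀*.point t ∘ id                    ≈⟨ identityʳ ⟩
    𝕀*.point t                         ≈⟨ identityˡ ⟨
    id ∘ 𝕀*.point t                    ∎

  -- Both sides are the image under F* of the polynomial t on the representable
  -- n, evaluated at the point of F*(□ⁿ) that d names.
  ι-preserves : ∀ {n U} (t : Term n) (d : Fin n → U ⇒ carrier) →
                ι ∘ evalᴰ D t d ≈ evalᴰ D′ t (λ i → ι ∘ d i)
  ι-preserves {n} t d = begin
    ι ∘ evalᴰ D t d                                       ≈⟨ ι-eval t d ⟩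
    𝕀*.point t ∘ tuple d                                  ≈⟨ named t (EE.evalᴰ 𝕀 t coordinate)
                                                               (≋-trans (Yoneda.eval-𝕀 t coordinate var) ([]-var t)) ⟨
    map (EE.evalᴰ 𝕀 t coordinate) ∘ h                     ≈⟨ F.eval-inverseImage 𝕀 t coordinate h ⟨
    evalᴰ D′ t (λ i → map (coordinate i) ∘ h)             ≈⟨ evalᴰ-cong D′ t (λ i → Equiv.trans
                                                               (named (var i) (coordinate i) ≋-refl)
                                                               (Equiv.sym (ι-eval (var i) d))) ⟩
    evalᴰ D′ t (λ i → ι ∘ d i)                            ∎
    where
    module F = InverseImage morphism
    module EE = Evaluation cubicalSets
    module よ* = LeftExtension (extension (Yoneda.よ n))

    h = よ*.point var ∘ tuple d

    named : ∀ (s : Term n) (k : Yoneda.よ n E.⇒ interval) → to (η k n) var ≋ s → map k ∘ h ≈ 𝕀*.point s ∘ tuple d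
    named s k p = Equiv.trans (Equiv.sym assoc)
      (∘-resp-≈ˡ (Equiv.trans (map-point k var) (𝕀*.point-cong p)))

  ι-hom : LatticeHom X D D′
  ι-hom = record
    { hom           = ι
    -- Each operation is a term evaluated at the generic tuple, the two projections or the empty
    -- tuple, so `ι-preserves` covers all four.
    ; preserve-join = Equiv.trans (∘-resp-≈ʳ (pairing _)) (ι-preserves (var zero ∨ᵗ var (suc zero)) pair)
    ; preserve-meet = Equiv.trans (∘-resp-≈ʳ (pairing _)) (ι-preserves (var zero ∧ᵗ var (suc zero)) pair)
    ; preserve-top  = Equiv.trans (∘-resp-≈ʳ (terminal _)) (Equiv.trans (ι-preserves {0} ⊤ᵗ (λ ())) (Equiv.sym (terminal _)))
    ; preserve-bot  = Equiv.trans (∘-resp-≈ʳ (terminal _)) (Equiv.trans (ι-preserves {0} ⊥ᵗ (λ ())) (Equiv.sym (terminal _)))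
    } where
    pair : Fin 2 → (carrier ⊗ carrier) ⇒ carrier
    pair zero       = π₁
    pair (suc zero) = π₂

    pairing : ∀ {A B C} (m : (A ⊗ B) ⇒ C) → m ≈ m ∘ ⟨ π₁ , π₂ ⟩
    pairing m = Equiv.sym (Equiv.trans (∘-resp-≈ʳ (unique identityʳ identityʳ)) identityʳ)

    terminal : ∀ {A} (t : 𝟏 ⇒ A) → t ≈ t ∘ !
    terminal t = Equiv.sym (Equiv.trans (∘-resp-≈ʳ (!-unique id)) identityʳ)

  -- Polynomials are easier to follow along `ι`; `ε` is a homomorphism because its inverse `ι` is
  -- one.
  ε-hom : LatticeHom X D′ D
  ε-hom = InverseHom.inverseHom ι-hom ε ε∘ι ι∘ε

  classification : Classification D
  classification = record { morphism = morphism ; ε = ε-hom ; ι = ι-hom ; ι∘ε = ι∘ε ; ε∘ι = ε∘ι }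

abstract
  classify : ∀ {X} (D : InternalDL X) → Flat X D → Classification D
  classify {X} D flat = ClassifyingMorphism.classification (generators X) D flat
    (FlatExtension.leftExtension (generators X) D flat)

  pres : InverseImagePreservesFlat
  pres {X} {Y} G {D} = inverseImage-flat {X} {Y} G {D}

  flat𝕀 : Flat cubicalSets 𝕀
  flat𝕀 = Yoneda.𝕀-flat

evaluateAt𝕀-isEquivalence : ∀ X → IsEquivalenceOfCategories (evaluateAtFlat pres cubicalSets 𝕀 flat𝕀 X)
evaluateAt𝕀-isEquivalence X = FromFullyFaithful.isEquivalence _
  (λ {F} {G} h → FullyFaithful.evaluate-full F G h)
  (λ {F} {G} {α} {β} p → FullyFaithful.evaluate-faithful F G α β p)
  (λ (D , flat) → morphism (classify D flat))
  (λ (D , flat) → ε (classify D flat))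
  (λ (D , flat) → ι (classify D flat))
  (λ (D , flat) → ι∘ε (classify D flat))
  (λ (D , flat) → ε∘ι (classify D flat))
  where open Classification

-- Compatibility with composition of geometric morphisms

module Coherence {E X Y : GrothendieckTopos} (D : InternalDL E)
                 (G : GeometricMorphism Y X) (F : GeometricMorphism X E) where
  open GrothendieckTopos Y
  open HomReasoning
  private
    module E = GrothendieckTopos E
    module X = GrothendieckTopos X
    module D = InternalDL D
    module F = InverseImage F
    module G = InverseImage G
    module FL = PreservesFiniteLimits F.leftExact
    module GL = PreservesFiniteLimits G.leftExact
    module FP {A B : E.Obj} = IsProduct (FL.product (E.isProduct {A} {B}))
    module FT = IsTerminal (FL.terminal E.isTerminal)
    module GP {A B : X.Obj} = IsProduct (GL.product (X.isProduct {A} {B}))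
    module GT = IsTerminal (GL.terminal X.isTerminal)
    module GFP {A B : E.Obj} = IsProduct (GL.product (FL.product (E.isProduct {A} {B})))
    module GFT = IsTerminal (GL.terminal (FL.terminal E.isTerminal))

    binary : ∀ {A : E.Obj} (m : (A E.⊗ A) E.⇒ A) →
             id ∘ (G.F₁ (F.F₁ m) ∘ GFP.⟨ π₁ , π₂ ⟩) ≈
             (G.F₁ (F.F₁ m X.∘ FP.⟨ X.π₁ , X.π₂ ⟩) ∘ GP.⟨ π₁ , π₂ ⟩) ∘ ⟨ id ∘ π₁ , id ∘ π₂ ⟩
    binary m = begin
      id ∘ (G.F₁ (F.F₁ m) ∘ GFP.⟨ π₁ , π₂ ⟩)
        ≈⟨ identityˡ ⟩
      G.F₁ (F.F₁ m) ∘ GFP.⟨ π₁ , π₂ ⟩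
        ≈⟨ ∘-resp-≈ʳ (GFP.unique
             (Equiv.trans (G.F-triangle FP.project₁) GP.project₁)
             (Equiv.trans (G.F-triangle FP.project₂) GP.project₂)) ⟩
      G.F₁ (F.F₁ m) ∘ (G.F₁ FP.⟨ X.π₁ , X.π₂ ⟩ ∘ GP.⟨ π₁ , π₂ ⟩)
        ≈⟨ G.F-triangle X.Equiv.refl ⟩
      G.F₁ (F.F₁ m X.∘ FP.⟨ X.π₁ , X.π₂ ⟩) ∘ GP.⟨ π₁ , π₂ ⟩
        ≈⟨ identityʳ ⟨
      (G.F₁ (F.F₁ m X.∘ FP.⟨ X.π₁ , X.π₂ ⟩) ∘ GP.⟨ π₁ , π₂ ⟩) ∘ id
        ≈⟨ ∘-resp-≈ʳ (unique (Equiv.trans identityʳ (Equiv.sym identityˡ))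
                             (Equiv.trans identityʳ (Equiv.sym identityˡ))) ⟨
      (G.F₁ (F.F₁ m X.∘ FP.⟨ X.π₁ , X.π₂ ⟩) ∘ GP.⟨ π₁ , π₂ ⟩) ∘ ⟨ id ∘ π₁ , id ∘ π₂ ⟩
        ∎

    nullary : ∀ {A : E.Obj} (t : E.𝟏 E.⇒ A) →
              id ∘ (G.F₁ (F.F₁ t) ∘ GFT.! {𝟏}) ≈ G.F₁ (F.F₁ t X.∘ FT.!) ∘ GT.!
    nullary t = begin
      id ∘ (G.F₁ (F.F₁ t) ∘ GFT.! {𝟏})          ≈⟨ identityˡ ⟩
      G.F₁ (F.F₁ t) ∘ GFT.!                     ≈⟨ ∘-resp-≈ʳ (GFT.!-unique _) ⟩
      G.F₁ (F.F₁ t) ∘ (G.F₁ FT.! ∘ GT.!)        ≈⟨ G.F-triangle X.Equiv.refl ⟩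
      G.F₁ (F.F₁ t X.∘ FT.!) ∘ GT.!             ∎

  -- The carriers coincide, but the operations are assembled differently: one side pairs directly
  -- into the cone preserved by both functors, the other passes through the chosen product in `X`.
  -- Uniqueness of pairing into the twice preserved cone shows that the identity respects them.
  comparison : LatticeHom Y (inverseImageDL (F ∘ᵍ G) D) (inverseImageDL G (inverseImageDL F D))
  comparison = record
    { hom           = id
    ; preserve-join = binary D.join
    ; preserve-meet = binary D.meet
    ; preserve-top  = nullary D.top
    ; preserve-bot  = nullary D.bot
    }

  comparison⁻¹ : LatticeHom Y (inverseImageDL G (inverseImageDL F D)) (inverseImageDL (F ∘ᵍ G) D)
  comparison⁻¹ = InverseHom.inverseHom comparison id identityˡ identityˡ

module _ (pres : InverseImagePreservesFlat) (E : GrothendieckTopos) (D : InternalDL E) (flat : Flat E D)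
         {X Y : GrothendieckTopos} (G : GeometricMorphism Y X) where
  private
    module G = Functor (GeometricMorphism.inverseImage G)
    module D = InternalDL D
    module Y = GrothendieckTopos Y

    identity-commutes : ∀ {A B} (f : A Y.⇒ B) → Y.id Y.∘ f Y.≈ f Y.∘ Y.id
    identity-commutes f = Y.Equiv.trans Y.identityˡ (Y.Equiv.sym Y.identityʳ)

  naturalAlong : NaturalAlong pres E D flat G
  naturalAlong = record
    { F⇒G  = record
        { η       = λ F → let open LatticeHom (Coherence.comparison {E} {X} {Y} D G F) in record
            { hom           = Y.id
            ; preserve-join = preserve-join
            ; preserve-meet = preserve-meet
            ; preserve-top  = preserve-top
            ; preserve-bot  = preserve-bot
            }
        ; commute = λ α → identity-commutes (G.F₁ (NaturalTransformation.η α D.carrier))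
        }
    ; F⇐G  = record
        { η       = λ F → let open LatticeHom (Coherence.comparison⁻¹ {E} {X} {Y} D G F) in record
            { hom           = Y.id
            ; preserve-join = preserve-join
            ; preserve-meet = preserve-meet
            ; preserve-top  = preserve-top
            ; preserve-bot  = preserve-bot
            }
        ; commute = λ α → identity-commutes (G.F₁ (NaturalTransformation.η α D.carrier))
        }
    ; isoˡ = λ F → Y.identityˡ {f = Y.id}
    ; isoʳ = λ F → Y.identityˡ {f = Y.id}
    } , λ F → Y.Equiv.refl {x = Y.id}

theorem2 : Σ[ pres ∈ InverseImagePreservesFlat ]
    Σ[ flat𝕀 ∈ Flat cubicalSets 𝕀 ]
    ((X : GrothendieckTopos) →
    IsEquivalenceOfCategories (evaluateAtFlat pres cubicalSets 𝕀 flat𝕀 X))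
    × ({X Y : GrothendieckTopos} (G : GeometricMorphism Y X) →
    NaturalAlong pres cubicalSets 𝕀 flat𝕀 G)
theorem2 = (λ {X} {Y} → pres {X} {Y}) , flat𝕀 , evaluateAt𝕀-isEquivalence , naturalAlong pres cubicalSets 𝕀 flat𝕀
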